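{- Algebraic model counting (AMC) generalizes satisfiability (SAT), model counting (#SAT), weighted model counting (WMC), probabilistic inference (PROB), sensitivity analysis (SENS), gradient (GRAD), probability of most likely states (MPE), shortest paths (S-PATH), widest paths (W-PATH), fuzzy constraints (FUZZY), $k$-weighted constraints ($k$WEIGHT), and $\mathrm{OBDD}_<$ construction. Precisely: let $T$ be a propositional theory over a finite set of variables $\mathcal V$. In each item below the structure $(\mathcal A,\oplus,\otimes,e^\oplus,e^\otimes)$ is a commutative semiring, and for every labeling function $\alpha$ of the given form the value $\mathbf A(T)$ is the solution of the named task (as described in the context). In each case $v$ ranges over $\mathcal V$. \begin{itemize} \item SAT: $(\{true,false\},\vee,\wedge,false,true)$, $\alpha(v)=\alpha(\neg v)=true$. \item #SAT: $(\mathbb N,+,\cdot,0,1)$, $\alpha(v)=\alpha(\neg v)=1$. \item WMC: $(\mathbb R_{\ge 0},+,\cdot,0,1)$, $\alpha(v),\alpha(\neg v)\in\mathbb R_{\ge 0}$. \item PROB: $(\mathbb R_{\ge 0},+,\cdot,0,1)$, $\alpha(v)\in[0,1]$, $\alpha(\neg v)=1-\alpha(v)$. \item SENS: $(\mathbb R[\mathcal V],+,\cdot,0,1)$, $\alpha(v)=v$ or $\alpha(v)\in[0,1]$, $\alpha(\neg v)=1-\alpha(v)$. \item GRAD: $(\mathbb R_{\ge 0}\times\mathbb R,\oplus,\otimes,(0,0),(1,0))$ with $(a_1,a_2)\oplus(b_1,b_2)=(a_1+b_1,a_2+b_2)$ and $(a_1,a_2)\otimes(b_1,b_2)=(a_1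 b_1,\,a_1b_2+a_2b_1)$; writing $\mathcal V=\{v_1,\dots,v_n\}$, fixing an index $k$ and numbers $p_i\in[0,1]$: $\alpha(v_k)=(p_k,1)$, $\alpha(\neg v_k)=(1-p_k,-1)$, and $\alpha(v_i)=(p_i,0)$, $\alpha(\neg v_i)=(1-p_i,0)$ for $i\ne k$. \item MPE: $(\mathbb R_{\ge 0},\max,\cdot,0,1)$, $\alpha(v)\in[0,1]$, $\alpha(\neg v)=1-\alpha(v)$. \item S-PATH: $(\mathbb N^\infty,\min,+,\infty,0)$, $\alpha(v)\in\mathbb N$, $\alpha(\neg v)=0$. \item W-PATH: $(\mathbb N^\infty,\max,\min,0,\infty)$, $\alpha(v)\in\mathbb N$, $\alpha(\neg v)=\infty$. \item FUZZY: $([0,1],\max,\min,0,1)$, $\alpha(v)\in[0,1]$, $\alpha(\neg v)=1$. \item $k$WEIGHT: $(\{0,\dots,k\},\min,+^k,k,0)$, $\alpha(v),\alpha(\neg v)\in\{0,\dots,k\}$, where $a+^k b=\min(a+b,k)$. \item $\mathrm{OBDD}_<$: $(\mathrm{OBDD}_<(\mathcal V),\vee,\wedge,\mathrm{OBDD}_<(0),\mathrm{OBDD}_<(1))$, $\alpha(v)=\mathrm{OBDD}_<(v)$, $\alpha(\neg v)=\neg\mathrm{OBDD}_<(v)$. \end{itemize}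
   Context: A semiring $(\mathcal A,\oplus,\otimes,e^\oplus,e^\otimes)$ has associative binary operations $\oplus,\otimes$ on $\mathcal A$, with $\oplus$ commutative, $\otimes$ distributing over $\oplus$, $e^\oplus$ neutral for $\oplus$, $e^\otimes$ neutral for $\otimes$, and $e^\oplus\otimes a=a\otimes e^\oplus=e^\oplus$ for all $a$. It is commutative if $\otimes$ is also commutative. AMC problem: given a propositional theory $T$ over $\mathcal V$, a commutative semiring, and a labeling function $\alpha:\mathcal L\to\mathcal A$ on the set $\mathcal L$ of literals of variables in $\mathcal V$, compute $$\mathbf A(T)=\bigoplus_{I\in\mathcal M(T)}\ \bigotimes_{l\in I}\alpha(l),$$ where $\mathcal M(T)$ is the set of models of $T$; a model is a set of literals containing exactly one of $v,\neg v$ for each $v\in\mathcal V$. Empty sums are $e^\oplus$, empty products $e^\otimes$. $\mathbb N^\infty=\mathbb N\cup\{\infty\}$ with $0\in\mathbb N$; $\mathbb R[\mathcal V]$ is the polynomial ring with the elements of $\mathcal V$ as indeterminates. $\mathrm{OBDD}_<(\mathcal V)$ is the set of (reduced, canonical) ordered binary decision diagrams over $\mathcal V$ for a fixed variable order $<$; $\mathrm{OBDD}_<(\varphi)$ is the diagram representing $\varphi$ (with $0,1$ the constants false and true), and $\vee,\wedge,\neg$ on diagrams denote the corresponding Boolean operations. Tasks: \begin{itemize} \item SAT: decide whether $T$ has a model ($true$ iff it does). \item #SAT: the number of models of $T$. \item WMC: the sum over the models of $T$ of the product of the nonnegative real weights of the model's literals. \item PROB: the probability that $T$ holds when each $v$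 is independently true with probability $\alpha(v)$. \item SENS: the probability that $T$ holds, as a polynomial in the symbolic parameters $v$ (those with $\alpha(v)=v$); i.e. the polynomial whose evaluation at any values in $[0,1]$ of the symbolic parameters is the PROB value of $T$ for these probabilities. \item GRAD: the pair $(P,\partial P/\partial p_k)$, where $P$ is the probability that $T$ holds when each $v_i$ is independently true with probability $p_i$, regarded as a polynomial in $p_1,\dots,p_n$ and evaluated at the given values. \item MPE: the maximum, over the models of $T$, of the model's probability when each $v$ is independently true with probability $\alpha(v)$ ($0$ if there is no model). \item S-PATH / W-PATH: $\mathcal V$ is the edge set of a finite directed graph with distinct nodes $s,t$, and $T$ is the disjunction over all simple $s$–$t$ paths of the conjunction of the edges of the path. S-PATH: the minimum over $s$–$t$ paths of the sum of the edge labels $\alpha(v)$ ($\infty$ if there is no path). W-PATH: the maximum over $s$–$t$ paths of the minimum edge label $\alpha(v)$ on the path ($0$ if there is no path). \item FUZZY: the maximum over models of $T$ of the minimum of the degrees $\alpha(v)$ of the variables true in the model (minimum over the empty set being $1$; value $0$ if there is no model). \item $k$WEIGHT: the minimum over models of $T$ of the total cost of the model's literals, truncated at $k$ ($k$ if there is no model). \item $\mathrm{OBDD}_<$ construction: the diagram $\mathrm{OBDD}_<(T)$. \end{itemize} -}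

module Defs where

open import Algebra.Bundles.Raw using (RawSemiring)
import Algebra.Definitions.RawSemiring as RawSemiringOps
open import Algebra.Structures using (IsCommutativeSemiring)
open import Data.Bool.Base using (Bool; true; false; if_then_else_; _∧_; _∨_; not)
import Data.Bool.Properties as Bool
open import Data.Fin.Base using (Fin; toℕ; fromℕ; fromℕ<) renaming (zero to 0F)
import Data.Fin.Properties as Fin
open import Data.List.Base
  using (List; []; _∷_; _++_; map; foldr; filter; allFin; upTo; concatMap; cartesianProductWith)
open import Data.List.Membership.Propositional using (_∈_)
open import Data.List.Relation.Unary.All as All using (All; []; _∷_)
open import Data.List.Relation.Unary.AllPairs using (AllPairs; []; _∷_)
open import Data.List.Relation.Unary.Unique.Propositional using (Unique)
import Data.List.Relation.Unary.Unique.Propositional.Properties as Unique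
import Data.List.Relation.Unary.Unique.DecPropositional as DecUnique
import Data.List.Relation.Unary.Sorted.TotalOrder.Properties as Sorted
import Data.List.Relation.Binary.Permutation.Propositional as Perm
import Data.List.Relation.Binary.Permutation.Setoid.Properties as PermSetoid
import Data.List.Sort as Sort
open import Data.Nat.Base as ℕ using (ℕ; zero; suc; pred)
import Data.Nat.Properties as ℕ
open import Data.Product.Base using (∃; _×_; _,_; proj₁; proj₂)
open import Data.Rational.Base as ℚ using (ℚ; 0ℚ; 1ℚ; ½; ∣_∣; Positive)
import Data.Rational.Properties as ℚ
open import Data.Rational.Solver using (module +-*-Solver)
open import Data.Sum.Base using (_⊎_; inj₁; inj₂)
open import Data.Unit.Base using (⊤; tt)
open import Data.Vec.Base as Vec using (Vec; []; _∷_; lookup; updateAt; _[_]≔_)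
import Data.Vec.Properties as Vec
open import Function.Base using (_∘_)
open import Level using (Level; 0ℓ; _⊔_)
open import Relation.Binary.Bundles using (StrictTotalOrder)
open import Relation.Binary.Core using (Rel)
open import Relation.Binary.Definitions using (DecidableEquality)
open import Relation.Binary.PropositionalEquality.Core
  using (_≡_; _≢_; refl; sym; trans; cong; cong₂; subst)
open import Relation.Binary.PropositionalEquality.Properties using (setoid)
open import Relation.Binary.Structures using (IsStrictTotalOrder)
import Relation.Binary.Properties.StrictTotalOrder as STO
import Relation.Binary.Construct.Add.Supremum.NonStrict as AddSupremum
open import Relation.Nullary.Construct.Add.Supremum using (_⁺; [_]; ⊤⁺)
open import Relation.Nullary.Decidable.Core using (Dec; yes; no; _×-dec_)
open import Relation.Nullary.Negation.Core using (¬_; contradiction)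

private
  variable
    n : ℕ
    c ℓ : Level

------------------------------------------------------------------------

data Literal (n : ℕ) : Set where
  pos neg : Fin n → Literal n

data Formula (n : ℕ) : Set where
  var       : Fin n → Formula n
  ⊤ᶠ ⊥ᶠ     : Formula n
  ¬ᶠ_       : Formula n → Formula n
  _∧ᶠ_ _∨ᶠ_ : Formula n → Formula n → Formula n

-- I stands for the set of literals containing pos v if lookup I v is
-- true, and neg v otherwise.

Interpretation : ℕ → Set
Interpretation n = Vec Bool n

literal : Interpretation n → Fin n → Literal n
literal I v = if lookup I v then pos v else neg v

literals : Interpretation n → List (Literal n)
literals {n} I = map (literal I) (allFin n)

⟦_⟧ : Formula n → Interpretation n → Bool
⟦ var v ⟧  I = lookup I v
⟦ ⊤ᶠ ⟧     I = true
⟦ ⊥ᶠ ⟧     I = false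
⟦ ¬ᶠ φ ⟧   I = not (⟦ φ ⟧ I)
⟦ φ ∧ᶠ ψ ⟧ I = ⟦ φ ⟧ I ∧ ⟦ ψ ⟧ I
⟦ φ ∨ᶠ ψ ⟧ I = ⟦ φ ⟧ I ∨ ⟦ ψ ⟧ I

infix 4 _⊨_

_⊨_ : Interpretation n → Formula n → Set
I ⊨ T = ⟦ T ⟧ I ≡ true

Model : Formula n → Set
Model T = ∃ λ I → I ⊨ T

interpretations : ∀ n → List (Interpretation n)
interpretations zero    = [] ∷ []
interpretations (suc n) =
  cartesianProductWith _∷_ (false ∷ true ∷ []) (interpretations n)

models : Formula n → List (Interpretation n)
models {n} T = filter (λ I → ⟦ T ⟧ I Bool.≟ true) (interpretations n)

⋁ᶠ ⋀ᶠ : List (Formula n) → Formula n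
⋁ᶠ = foldr _∨ᶠ_ ⊥ᶠ
⋀ᶠ = foldr _∧ᶠ_ ⊤ᶠ

------------------------------------------------------------------------

module BigOps (R : RawSemiring c ℓ) where
  open RawSemiring R

  ⨁ ⨂ : List Carrier → Carrier
  ⨁ = foldr _+_ 0#
  ⨂ = foldr _*_ 1#

IsCommutativeSemiringOn : RawSemiring c ℓ → Set (c ⊔ ℓ)
IsCommutativeSemiringOn R = IsCommutativeSemiring _≈_ _+_ _*_ 0# 1#
  where open RawSemiring R

AMC : (R : RawSemiring c ℓ) → (Literal n → RawSemiring.Carrier R) →
      Formula n → RawSemiring.Carrier R
AMC R α T = ⨁ (map (λ I → ⨂ (map α (literals I))) (models T))
  where open BigOps R

------------------------------------------------------------------------

module _ {A : Set} (_≤_ : Rel A 0ℓ) where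

  IsMinimum IsMaximum : (A → Set) → A → Set
  IsMinimum S m = S m × (∀ x → S x → m ≤ x)
  IsMaximum S m = S m × (∀ x → S x → x ≤ m)

module _ {A : Set} (_≈_ _≤_ : Rel A 0ℓ) where

  IsMinimumOr IsMaximumOr : A → (A → Set) → A → Set
  IsMinimumOr d S m = (∃ S → IsMinimum _≤_ S m) × (¬ ∃ S → m ≈ d)
  IsMaximumOr d S m = (∃ S → IsMaximum _≤_ S m) × (¬ ∃ S → m ≈ d)

------------------------------------------------------------------------
-- Reals are Cauchy sequences of rationals (the modulus of convergence is
-- part of the proof of Cauchy), equal when their difference tends to 0.

Cauchy : (ℕ → ℚ) → Set
Cauchy x = ∀ ε → 0ℚ ℚ.< ε → ∃ λ N → ∀ i j → N ℕ.≤ i → N ℕ.≤ j →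
  ∣ x i ℚ.- x j ∣ ℚ.≤ ε

record ℝ : Set where
  constructor mkℝ
  field
    seq    : ℕ → ℚ
    cauchy : Cauchy seq

open ℝ

infix 4 _≈ℝ_ _≤ℝ_

record _≈ℝ_ (x y : ℝ) : Set where
  constructor mk≈
  field
    close : ∀ ε → 0ℚ ℚ.< ε → ∃ λ N → ∀ i → N ℕ.≤ i →
      ∣ seq x i ℚ.- seq y i ∣ ℚ.≤ ε

record _≤ℝ_ (x y : ℝ) : Set where
  constructor mk≤
  field
    below : ∀ ε → 0ℚ ℚ.< ε → ∃ λ N → ∀ i → N ℕ.≤ i →
      seq x i ℚ.≤ seq y i ℚ.+ ε

open _≤ℝ_

module RealLemmas where

  open +-*-Solver
  open ℚ.≤-Reasoning

  p≤∣p∣ : ∀ p → p ℚ.≤ ∣ p ∣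
  p≤∣p∣ p with ℚ.∣p∣≡p∨∣p∣≡-p p
  ... | inj₁ eq = ℚ.≤-reflexive (sym eq)
  ... | inj₂ eq with ℚ.≤-total 0ℚ p
  ...   | inj₁ 0≤p = ℚ.≤-reflexive (sym (ℚ.0≤p⇒∣p∣≡p 0≤p))
  ...   | inj₂ p≤0 = ℚ.≤-trans p≤0 (ℚ.0≤∣p∣ p)

  ∣-∣⇒≤ : ∀ p q ε → ∣ p ℚ.- q ∣ ℚ.≤ ε → p ℚ.≤ q ℚ.+ ε
  ∣-∣⇒≤ p q ε h = begin
    p                 ≡⟨ solve 2 (λ p q → p := q :+ (p :- q)) refl p q ⟩
    q ℚ.+ (p ℚ.- q)   ≤⟨ ℚ.+-monoʳ-≤ q (ℚ.≤-trans (p≤∣p∣ _) h) ⟩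
    q ℚ.+ ε           ∎

  ≤⇒∣-∣ : ∀ p q ε → p ℚ.≤ q ℚ.+ ε → q ℚ.≤ p ℚ.+ ε → ∣ p ℚ.- q ∣ ℚ.≤ ε
  ≤⇒∣-∣ p q ε h k with ℚ.∣p∣≡p∨∣p∣≡-p (p ℚ.- q)
  ... | inj₁ eq = begin
    ∣ p ℚ.- q ∣         ≡⟨ eq ⟩
    p ℚ.- q             ≤⟨ ℚ.+-monoˡ-≤ (ℚ.- q) h ⟩
    (q ℚ.+ ε) ℚ.- q     ≡⟨ solve 2 (λ q ε → (q :+ ε) :- q := ε) refl q ε ⟩
    ε                   ∎
  ... | inj₂ eq = begin
    ∣ p ℚ.- q ∣         ≡⟨ eq ⟩
    ℚ.- (p ℚ.- q)       ≡⟨ solve 2 (λ p q → :- (p :- q) := q :- p) refl p q ⟩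
    q ℚ.- p             ≤⟨ ℚ.+-monoˡ-≤ (ℚ.- p) k ⟩
    (p ℚ.+ ε) ℚ.- p     ≡⟨ solve 2 (λ q ε → (q :+ ε) :- q := ε) refl p ε ⟩
    ε                   ∎

  0<1 : 0ℚ ℚ.< 1ℚ
  0<1 = ℚ.positive⁻¹ 1ℚ

  0<½* : ∀ {ε} → 0ℚ ℚ.< ε → 0ℚ ℚ.< ½ ℚ.* ε
  0<½* {ε} h = begin-strict
    0ℚ          ≡⟨ ℚ.*-zeroʳ ½ ⟨
    ½ ℚ.* 0ℚ    <⟨ ℚ.*-monoʳ-<-pos ½ h ⟩
    ½ ℚ.* ε     ∎

  halves : ∀ ε → ½ ℚ.* ε ℚ.+ ½ ℚ.* ε ≡ ε
  halves ε = trans (sym (ℚ.*-distribʳ-+ ε ½ ½)) (ℚ.*-identityˡ ε)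

  toCauchy : ∀ (x : ℕ → ℚ) →
    (∀ ε → 0ℚ ℚ.< ε → ∃ λ N → ∀ i j → N ℕ.≤ i → N ℕ.≤ j → x i ℚ.≤ x j ℚ.+ ε) →
    Cauchy x
  toCauchy x h ε 0<ε with h ε 0<ε
  ... | N , near = N , λ i j N≤i N≤j →
    ≤⇒∣-∣ (x i) (x j) ε (near i j N≤i N≤j) (near j i N≤j N≤i)

  fromCauchy : ∀ (x : ℕ → ℚ) → Cauchy x → ∀ ε → 0ℚ ℚ.< ε →
    ∃ λ N → ∀ i j → N ℕ.≤ i → N ℕ.≤ j → x i ℚ.≤ x j ℚ.+ ε
  fromCauchy x h ε 0<ε with h ε 0<ε
  ... | N , near = N , λ i j N≤i N≤j → ∣-∣⇒≤ (x i) (x j) ε (near i j N≤i N≤j)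

  split-+ : ∀ a b ε → (a ℚ.+ ½ ℚ.* ε) ℚ.+ (b ℚ.+ ½ ℚ.* ε) ≡ (a ℚ.+ b) ℚ.+ ε
  split-+ a b ε = trans
    (solve 3 (λ a b h → (a :+ h) :+ (b :+ h) := (a :+ b) :+ (h :+ h)) refl a b (½ ℚ.* ε))
    (cong ((a ℚ.+ b) ℚ.+_) (halves ε))

  abstract
    +-cauchy : ∀ x y → Cauchy x → Cauchy y → Cauchy (λ i → x i ℚ.+ y i)
    +-cauchy x y cx cy = toCauchy (λ i → x i ℚ.+ y i) λ ε 0<ε →
      let M , p = fromCauchy x cx _ (0<½* 0<ε)
          N , q = fromCauchy y cy _ (0<½* 0<ε)
      in M ℕ.⊔ N , λ i j mi mj → ℚ.≤-trans
           (ℚ.+-mono-≤ (p i j (ℕ.m⊔n≤o⇒m≤o M N mi) (ℕ.m⊔n≤o⇒m≤o M N mj))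
                       (q i j (ℕ.m⊔n≤o⇒n≤o M N mi) (ℕ.m⊔n≤o⇒n≤o M N mj)))
           (ℚ.≤-reflexive (split-+ (x j) (y j) ε))

  abstract
    neg-cauchy : ∀ x → Cauchy x → Cauchy (λ i → ℚ.- x i)
    neg-cauchy x cx = toCauchy (λ i → ℚ.- x i) λ ε 0<ε →
      let N , p = fromCauchy x cx ε 0<ε
      in N , λ i j ni nj → begin
           ℚ.- x i                   ≡⟨ solve 3 (λ a b e → :- a := (:- (a :+ e)) :+ e) refl (x i) (x j) ε ⟩
           ℚ.- (x i ℚ.+ ε) ℚ.+ ε     ≤⟨ ℚ.+-monoˡ-≤ ε (ℚ.neg-antimono-≤ (p j i nj ni)) ⟩
           ℚ.- x j ℚ.+ ε             ∎

  abstract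
    ⊔-cauchy : ∀ x y → Cauchy x → Cauchy y → Cauchy (λ i → x i ℚ.⊔ y i)
    ⊔-cauchy x y cx cy = toCauchy (λ i → x i ℚ.⊔ y i) λ ε 0<ε →
      let M , p = fromCauchy x cx ε 0<ε
          N , q = fromCauchy y cy ε 0<ε
      in M ℕ.⊔ N , λ i j mi mj → ℚ.⊔-lub
           (ℚ.≤-trans (p i j (ℕ.m⊔n≤o⇒m≤o M N mi) (ℕ.m⊔n≤o⇒m≤o M N mj))
                      (ℚ.+-monoˡ-≤ ε (ℚ.p≤p⊔q (x j) (y j))))
           (ℚ.≤-trans (q i j (ℕ.m⊔n≤o⇒n≤o M N mi) (ℕ.m⊔n≤o⇒n≤o M N mj))
                      (ℚ.+-monoˡ-≤ ε (ℚ.p≤q⊔p (x j) (y j))))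

  +-distrib-⊓ : ∀ a b ε → (a ℚ.⊓ b) ℚ.+ ε ≡ (a ℚ.+ ε) ℚ.⊓ (b ℚ.+ ε)
  +-distrib-⊓ a b ε = ℚ.mono-≤-distrib-⊓ (ℚ.+-monoˡ-≤ ε) a b

  abstract
    ⊓-cauchy : ∀ x y → Cauchy x → Cauchy y → Cauchy (λ i → x i ℚ.⊓ y i)
    ⊓-cauchy x y cx cy = toCauchy (λ i → x i ℚ.⊓ y i) λ ε 0<ε →
      let M , p = fromCauchy x cx ε 0<ε
          N , q = fromCauchy y cy ε 0<ε
      in M ℕ.⊔ N , λ i j mi mj → ℚ.≤-trans
           (ℚ.⊓-glb
             (ℚ.≤-trans (ℚ.p⊓q≤p (x i) (y i)) (p i j (ℕ.m⊔n≤o⇒m≤o M N mi) (ℕ.m⊔n≤o⇒m≤o M N mj)))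
             (ℚ.≤-trans (ℚ.p⊓q≤q (x i) (y i)) (q i j (ℕ.m⊔n≤o⇒n≤o M N mi) (ℕ.m⊔n≤o⇒n≤o M N mj))))
           (ℚ.≤-reflexive (sym (+-distrib-⊓ (x j) (y j) ε)))

  EventuallyBounded : (ℕ → ℚ) → Set
  EventuallyBounded x = ∃ λ B → 0ℚ ℚ.< B × ∃ λ N → ∀ i → N ℕ.≤ i → ∣ x i ∣ ℚ.≤ B

  bounded : ∀ x → Cauchy x → EventuallyBounded x
  bounded x cx with cx 1ℚ 0<1
  ... | N , near = ∣ x N ∣ ℚ.+ 1ℚ
    , (begin-strict
        0ℚ              <⟨ 0<1 ⟩
        1ℚ              ≡⟨ ℚ.+-identityˡ 1ℚ ⟨
        0ℚ ℚ.+ 1ℚ       ≤⟨ ℚ.+-monoˡ-≤ 1ℚ (ℚ.0≤∣p∣ (x N)) ⟩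
        ∣ x N ∣ ℚ.+ 1ℚ  ∎)
    , N
    , λ i ni → begin
        ∣ x i ∣                        ≡⟨ cong ∣_∣ (solve 2 (λ a b → a := b :+ (a :- b)) refl (x i) (x N)) ⟩
        ∣ x N ℚ.+ (x i ℚ.- x N) ∣      ≤⟨ ℚ.∣p+q∣≤∣p∣+∣q∣ (x N) (x i ℚ.- x N) ⟩
        ∣ x N ∣ ℚ.+ ∣ x i ℚ.- x N ∣    ≤⟨ ℚ.+-monoʳ-≤ ∣ x N ∣ (near i N ni ℕ.≤-refl) ⟩
        ∣ x N ∣ ℚ.+ 1ℚ                 ∎

  quotient : ∀ ε D → 0ℚ ℚ.< ε → 0ℚ ℚ.< D → ∃ λ δ → 0ℚ ℚ.< δ × δ ℚ.* D ≡ ε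
  quotient ε D 0<ε 0<D = ε ℚ.* D⁻¹ , 0<δ , δD≡ε
    where
    instance
      D-pos : Positive D
      D-pos = ℚ.positive 0<D
      D-nonZero : ℚ.NonZero D
      D-nonZero = ℚ.pos⇒nonZero D
    D⁻¹ : ℚ
    D⁻¹ = ℚ.1/ D
    0<δ : 0ℚ ℚ.< ε ℚ.* D⁻¹
    0<δ = begin-strict
      0ℚ            ≡⟨ ℚ.*-zeroˡ D⁻¹ ⟨
      0ℚ ℚ.* D⁻¹    <⟨ ℚ.*-monoˡ-<-pos D⁻¹ {{ℚ.1/pos⇒pos D}} 0<ε ⟩
      ε ℚ.* D⁻¹     ∎
    δD≡ε : (ε ℚ.* D⁻¹) ℚ.* D ≡ ε
    δD≡ε = trans (ℚ.*-assoc ε D⁻¹ D)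
             (trans (cong (ε ℚ.*_) (ℚ.*-inverseˡ D)) (ℚ.*-identityʳ ε))

  *-mono-≤ : ∀ {a b c d} → 0ℚ ℚ.≤ a → 0ℚ ℚ.≤ d → a ℚ.≤ b → c ℚ.≤ d →
    a ℚ.* c ℚ.≤ b ℚ.* d
  *-mono-≤ {a} {b} {c} {d} 0≤a 0≤d a≤b c≤d = ℚ.≤-trans
    (ℚ.*-monoˡ-≤-nonNeg a {{ℚ.nonNegative 0≤a}} c≤d)
    (ℚ.*-monoʳ-≤-nonNeg d {{ℚ.nonNegative 0≤d}} a≤b)

  abstract
    *-cauchy : ∀ x y → Cauchy x → Cauchy y → Cauchy (λ i → x i ℚ.* y i)
    *-cauchy x y cx cy ε 0<ε =
      let B , 0<B , M , p = bounded x cx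
          C , 0<C , N , q = bounded y cy
          δ , 0<δ , δD≡ε  = quotient ε (B ℚ.+ C) 0<ε (ℚ.+-mono-< 0<B 0<C)
          K , r           = cx δ 0<δ
          L , s           = cy δ 0<δ
          bound = (M ℕ.⊔ N) ℕ.⊔ (K ℕ.⊔ L)
      in bound , λ i j hi hj →
        let M≤i = ℕ.m⊔n≤o⇒m≤o M N (ℕ.m⊔n≤o⇒m≤o (M ℕ.⊔ N) (K ℕ.⊔ L) hi)
            N≤j = ℕ.m⊔n≤o⇒n≤o M N (ℕ.m⊔n≤o⇒m≤o (M ℕ.⊔ N) (K ℕ.⊔ L) hj)
            KLi = ℕ.m⊔n≤o⇒n≤o (M ℕ.⊔ N) (K ℕ.⊔ L) hi
            KLj = ℕ.m⊔n≤o⇒n≤o (M ℕ.⊔ N) (K ℕ.⊔ L) hj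
        in begin
          ∣ x i ℚ.* y i ℚ.- x j ℚ.* y j ∣
            ≡⟨ cong ∣_∣ (solve 4 (λ a b c d → a :* b :- c :* d := a :* (b :- d) :+ (a :- c) :* d)
                         refl (x i) (y i) (x j) (y j)) ⟩
          ∣ x i ℚ.* (y i ℚ.- y j) ℚ.+ (x i ℚ.- x j) ℚ.* y j ∣
            ≤⟨ ℚ.∣p+q∣≤∣p∣+∣q∣ (x i ℚ.* (y i ℚ.- y j)) ((x i ℚ.- x j) ℚ.* y j) ⟩
          ∣ x i ℚ.* (y i ℚ.- y j) ∣ ℚ.+ ∣ (x i ℚ.- x j) ℚ.* y j ∣
            ≡⟨ cong₂ ℚ._+_ (ℚ.∣p*q∣≡∣p∣*∣q∣ (x i) (y i ℚ.- y j)) (ℚ.∣p*q∣≡∣p∣*∣q∣ (x i ℚ.- x j) (y j)) ⟩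
          ∣ x i ∣ ℚ.* ∣ y i ℚ.- y j ∣ ℚ.+ ∣ x i ℚ.- x j ∣ ℚ.* ∣ y j ∣
            ≤⟨ ℚ.+-mono-≤
                 (*-mono-≤ (ℚ.0≤∣p∣ (x i)) (ℚ.<⇒≤ 0<δ) (p i M≤i)
                   (s i j (ℕ.m⊔n≤o⇒n≤o K L KLi) (ℕ.m⊔n≤o⇒n≤o K L KLj)))
                 (*-mono-≤ (ℚ.0≤∣p∣ (x i ℚ.- x j)) (ℚ.<⇒≤ 0<C)
                   (r i j (ℕ.m⊔n≤o⇒m≤o K L KLi) (ℕ.m⊔n≤o⇒m≤o K L KLj)) (q j N≤j)) ⟩
          B ℚ.* δ ℚ.+ δ ℚ.* C
            ≡⟨ solve 3 (λ B C δ → B :* δ :+ δ :* C := δ :* (B :+ C)) refl B C δ ⟩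
          δ ℚ.* (B ℚ.+ C)
            ≡⟨ δD≡ε ⟩
          ε ∎

  p≤p+ε : ∀ p {ε} → 0ℚ ℚ.< ε → p ℚ.≤ p ℚ.+ ε
  p≤p+ε p {ε} 0<ε = begin
    p           ≡⟨ ℚ.+-identityʳ p ⟨
    p ℚ.+ 0ℚ    ≤⟨ ℚ.+-monoʳ-≤ p (ℚ.<⇒≤ 0<ε) ⟩
    p ℚ.+ ε     ∎

  abstract
    const-cauchy : ∀ q → Cauchy (λ _ → q)
    const-cauchy q ε 0<ε = 0 , λ _ _ _ _ → ≤⇒∣-∣ q q ε (p≤p+ε q 0<ε) (p≤p+ε q 0<ε)

infixl 6 _+ℝ_ _-ℝ_ _⊔ℝ_ _⊓ℝ_
infixl 7 _*ℝ_
infix  8 -ℝ_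

_+ℝ_ _*ℝ_ _⊔ℝ_ _⊓ℝ_ : ℝ → ℝ → ℝ
x +ℝ y = mkℝ (λ i → seq x i ℚ.+ seq y i) (RealLemmas.+-cauchy (seq x) (seq y) (cauchy x) (cauchy y))
x *ℝ y = mkℝ (λ i → seq x i ℚ.* seq y i) (RealLemmas.*-cauchy (seq x) (seq y) (cauchy x) (cauchy y))
x ⊔ℝ y = mkℝ (λ i → seq x i ℚ.⊔ seq y i) (RealLemmas.⊔-cauchy (seq x) (seq y) (cauchy x) (cauchy y))
x ⊓ℝ y = mkℝ (λ i → seq x i ℚ.⊓ seq y i) (RealLemmas.⊓-cauchy (seq x) (seq y) (cauchy x) (cauchy y))

-ℝ_ : ℝ → ℝ
-ℝ_ x = mkℝ (λ i → ℚ.- seq x i) (RealLemmas.neg-cauchy (seq x) (cauchy x))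

_-ℝ_ : ℝ → ℝ → ℝ
x -ℝ y = x +ℝ (-ℝ y)

0ℝ 1ℝ : ℝ
0ℝ = mkℝ (λ _ → 0ℚ) (RealLemmas.const-cauchy 0ℚ)
1ℝ = mkℝ (λ _ → 1ℚ) (RealLemmas.const-cauchy 1ℚ)

ℝ-rawSemiring : RawSemiring 0ℓ 0ℓ
ℝ-rawSemiring = record
  { Carrier = ℝ ; _≈_ = _≈ℝ_ ; _+_ = _+ℝ_ ; _*_ = _*ℝ_ ; 0# = 0ℝ ; 1# = 1ℝ }

open BigOps ℝ-rawSemiring using () renaming (⨁ to ∑ℝ; ⨂ to ∏ℝ)
open RawSemiringOps ℝ-rawSemiring using () renaming (_^_ to _^ℝ_; _×_ to _·ℝ_)

module BoundLemmas where

  open +-*-Solver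
  open ℚ.≤-Reasoning
  open RealLemmas

  abstract
    ≤ℝ-refl : ∀ x → x ≤ℝ x
    ≤ℝ-refl x = mk≤ λ ε 0<ε → 0 , λ i _ → p≤p+ε (seq x i) 0<ε

  abstract
    +-nonNegative : ∀ x y → 0ℝ ≤ℝ x → 0ℝ ≤ℝ y → 0ℝ ≤ℝ x +ℝ y
    +-nonNegative x y 0≤x 0≤y = mk≤ λ ε 0<ε →
      let M , p = below 0≤x _ (0<½* 0<ε)
          N , q = below 0≤y _ (0<½* 0<ε)
      in M ℕ.⊔ N , λ i mi → begin
           0ℚ ℚ.+ 0ℚ                                       ≤⟨ ℚ.+-mono-≤ (p i (ℕ.m⊔n≤o⇒m≤o M N mi)) (q i (ℕ.m⊔n≤o⇒n≤o M N mi)) ⟩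
           (seq x i ℚ.+ ½ ℚ.* ε) ℚ.+ (seq y i ℚ.+ ½ ℚ.* ε) ≡⟨ split-+ (seq x i) (seq y i) ε ⟩
           (seq x i ℚ.+ seq y i) ℚ.+ ε                     ∎

  ⊓-pos : ∀ p q → 0ℚ ℚ.< p → 0ℚ ℚ.< q → 0ℚ ℚ.< p ℚ.⊓ q
  ⊓-pos p q 0<p 0<q with ℚ.⊓-sel p q
  ... | inj₁ eq = subst (0ℚ ℚ.<_) (sym eq) 0<p
  ... | inj₂ eq = subst (0ℚ ℚ.<_) (sym eq) 0<q

  -- 0 ≤ (a + δ)(b + δ) = ab + δ(a + b + δ) ≤ ab + δ(B + C + 1)

  almost-nonNegative : ∀ a b B C δ ε → a ℚ.≤ B → b ℚ.≤ C → 0ℚ ℚ.≤ δ → δ ℚ.≤ 1ℚ →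
    δ ℚ.* ((B ℚ.+ C) ℚ.+ 1ℚ) ℚ.≤ ε → 0ℚ ℚ.≤ a ℚ.+ δ → 0ℚ ℚ.≤ b ℚ.+ δ →
    0ℚ ℚ.≤ a ℚ.* b ℚ.+ ε
  almost-nonNegative a b B C δ ε a≤B b≤C 0≤δ δ≤1 δD≤ε 0≤a+δ 0≤b+δ = begin
    0ℚ                                        ≡⟨ ℚ.*-zeroˡ (b ℚ.+ δ) ⟨
    0ℚ ℚ.* (b ℚ.+ δ)                          ≤⟨ ℚ.*-monoʳ-≤-nonNeg (b ℚ.+ δ) {{ℚ.nonNegative 0≤b+δ}} 0≤a+δ ⟩
    (a ℚ.+ δ) ℚ.* (b ℚ.+ δ)                   ≡⟨ solve 3 (λ a b d → (a :+ d) :* (b :+ d) := a :* b :+ d :* ((a :+ b) :+ d)) refl a b δ ⟩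
    a ℚ.* b ℚ.+ δ ℚ.* ((a ℚ.+ b) ℚ.+ δ)       ≤⟨ ℚ.+-monoʳ-≤ (a ℚ.* b) (ℚ.*-monoˡ-≤-nonNeg δ {{ℚ.nonNegative 0≤δ}} (ℚ.+-mono-≤ (ℚ.+-mono-≤ a≤B b≤C) δ≤1)) ⟩
    a ℚ.* b ℚ.+ δ ℚ.* ((B ℚ.+ C) ℚ.+ 1ℚ)      ≤⟨ ℚ.+-monoʳ-≤ (a ℚ.* b) δD≤ε ⟩
    a ℚ.* b ℚ.+ ε                             ∎

  capped : ∀ δ D ε → 0ℚ ℚ.< D → δ ℚ.* D ≡ ε → (δ ℚ.⊓ 1ℚ) ℚ.* D ℚ.≤ ε
  capped δ D ε 0<D δD≡ε = begin
    (δ ℚ.⊓ 1ℚ) ℚ.* D    ≤⟨ ℚ.*-monoʳ-≤-nonNeg D {{ℚ.nonNegative (ℚ.<⇒≤ 0<D)}} (ℚ.p⊓q≤p δ 1ℚ) ⟩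
    δ ℚ.* D             ≡⟨ δD≡ε ⟩
    ε                   ∎

  abstract
    *-nonNegative : ∀ x y → 0ℝ ≤ℝ x → 0ℝ ≤ℝ y → 0ℝ ≤ℝ x *ℝ y
    *-nonNegative x y 0≤x 0≤y = mk≤ λ ε 0<ε →
      main ε 0<ε (bounded (seq x) (cauchy x)) (bounded (seq y) (cauchy y))
      where
      Goal : ℚ → Set
      Goal ε = ∃ λ N → ∀ i → N ℕ.≤ i → 0ℚ ℚ.≤ seq x i ℚ.* seq y i ℚ.+ ε

      main : ∀ ε → 0ℚ ℚ.< ε → EventuallyBounded (seq x) → EventuallyBounded (seq y) → Goal ε
      main ε 0<ε (B , 0<B , M , p) (C , 0<C , N , q) = step (quotient ε D 0<ε 0<D)
        where
        D : ℚ
        D = (B ℚ.+ C) ℚ.+ 1ℚ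

        0<D : 0ℚ ℚ.< D
        0<D = ℚ.+-mono-< {0ℚ} {B ℚ.+ C} {0ℚ} {1ℚ} (ℚ.+-mono-< {0ℚ} {B} {0ℚ} {C} 0<B 0<C) 0<1

        near : ∀ δ → 0ℚ ℚ.< δ → δ ℚ.≤ 1ℚ → δ ℚ.* D ℚ.≤ ε → Goal ε
        near δ 0<δ δ≤1 δD≤ε with below 0≤x δ 0<δ | below 0≤y δ 0<δ
        ... | K , r | L , s = (M ℕ.⊔ N) ℕ.⊔ (K ℕ.⊔ L) , λ i hi →
          let MN = ℕ.m⊔n≤o⇒m≤o (M ℕ.⊔ N) (K ℕ.⊔ L) hi
              KL = ℕ.m⊔n≤o⇒n≤o (M ℕ.⊔ N) (K ℕ.⊔ L) hi
          in almost-nonNegative (seq x i) (seq y i) B C δ ε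
               (ℚ.≤-trans (p≤∣p∣ (seq x i)) (p i (ℕ.m⊔n≤o⇒m≤o M N MN)))
               (ℚ.≤-trans (p≤∣p∣ (seq y i)) (q i (ℕ.m⊔n≤o⇒n≤o M N MN)))
               (ℚ.<⇒≤ 0<δ) δ≤1 δD≤ε
               (r i (ℕ.m⊔n≤o⇒m≤o K L KL)) (s i (ℕ.m⊔n≤o⇒n≤o K L KL))

        step : (∃ λ δ → 0ℚ ℚ.< δ × δ ℚ.* D ≡ ε) → Goal ε
        step (δ , 0<δ , δD≡ε) =
          near (δ ℚ.⊓ 1ℚ) (⊓-pos δ 1ℚ 0<δ 0<1) (ℚ.p⊓q≤q δ 1ℚ) (capped δ D ε 0<D δD≡ε)

  abstract
    x≤x⊔y : ∀ x y → x ≤ℝ x ⊔ℝ y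
    x≤x⊔y x y = mk≤ λ ε 0<ε → 0 , λ i _ →
      ℚ.≤-trans (ℚ.p≤p⊔q (seq x i) (seq y i)) (p≤p+ε _ 0<ε)

  abstract
    x⊓y≤x : ∀ x y → x ⊓ℝ y ≤ℝ x
    x⊓y≤x x y = mk≤ λ ε 0<ε → 0 , λ i _ →
      ℚ.≤-trans (ℚ.p⊓q≤p (seq x i) (seq y i)) (p≤p+ε _ 0<ε)

  abstract
    ≤ℝ-trans : ∀ x y z → x ≤ℝ y → y ≤ℝ z → x ≤ℝ z
    ≤ℝ-trans x y z x≤y y≤z = mk≤ λ ε 0<ε →
      let M , p = below x≤y _ (0<½* 0<ε)
          N , q = below y≤z _ (0<½* 0<ε)
      in M ℕ.⊔ N , λ i mi → begin
           seq x i                              ≤⟨ p i (ℕ.m⊔n≤o⇒m≤o M N mi) ⟩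
           seq y i ℚ.+ ½ ℚ.* ε                  ≤⟨ ℚ.+-monoˡ-≤ (½ ℚ.* ε) (q i (ℕ.m⊔n≤o⇒n≤o M N mi)) ⟩
           (seq z i ℚ.+ ½ ℚ.* ε) ℚ.+ ½ ℚ.* ε    ≡⟨ ℚ.+-assoc (seq z i) _ _ ⟩
           seq z i ℚ.+ (½ ℚ.* ε ℚ.+ ½ ℚ.* ε)    ≡⟨ cong (seq z i ℚ.+_) (halves ε) ⟩
           seq z i ℚ.+ ε                        ∎

  abstract
    ⊔-least : ∀ x y z → x ≤ℝ z → y ≤ℝ z → x ⊔ℝ y ≤ℝ z
    ⊔-least x y z x≤z y≤z = mk≤ λ ε 0<ε →
      let M , p = below x≤z ε 0<ε
          N , q = below y≤z ε 0<ε
      in M ℕ.⊔ N , λ i mi → ℚ.⊔-lub (p i (ℕ.m⊔n≤o⇒m≤o M N mi)) (q i (ℕ.m⊔n≤o⇒n≤o M N mi))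

  abstract
    ⊓-greatest : ∀ x y z → z ≤ℝ x → z ≤ℝ y → z ≤ℝ x ⊓ℝ y
    ⊓-greatest x y z z≤x z≤y = mk≤ λ ε 0<ε →
      let M , p = below z≤x ε 0<ε
          N , q = below z≤y ε 0<ε
      in M ℕ.⊔ N , λ i mi → ℚ.≤-trans
           (ℚ.⊓-glb (p i (ℕ.m⊔n≤o⇒m≤o M N mi)) (q i (ℕ.m⊔n≤o⇒n≤o M N mi)))
           (ℚ.≤-reflexive (sym (+-distrib-⊓ (seq x i) (seq y i) ε)))

  abstract
    0≤1 : 0ℝ ≤ℝ 1ℝ
    0≤1 = mk≤ λ ε 0<ε → 0 , λ _ _ → ℚ.≤-trans (ℚ.<⇒≤ 0<1) (p≤p+ε 1ℚ 0<ε)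

  abstract
    0≤1-x : ∀ x → x ≤ℝ 1ℝ → 0ℝ ≤ℝ 1ℝ -ℝ x
    0≤1-x x x≤1 = mk≤ λ ε 0<ε →
      let N , p = below x≤1 ε 0<ε
      in N , λ i ni → begin
           0ℚ                              ≡⟨ ℚ.+-inverseʳ (seq x i) ⟨
           seq x i ℚ.- seq x i             ≤⟨ ℚ.+-monoˡ-≤ (ℚ.- seq x i) (p i ni) ⟩
           (1ℚ ℚ.+ ε) ℚ.- seq x i          ≡⟨ solve 3 (λ o e a → (o :+ e) :- a := (o :- a) :+ e) refl 1ℚ ε (seq x i) ⟩
           (1ℚ ℚ.- seq x i) ℚ.+ ε          ∎

  abstract
    1-x≤1 : ∀ x → 0ℝ ≤ℝ x → 1ℝ -ℝ x ≤ℝ 1ℝ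
    1-x≤1 x 0≤x = mk≤ λ ε 0<ε →
      let N , p = below 0≤x ε 0<ε
      in N , λ i ni → begin
           1ℚ ℚ.- seq x i                        ≡⟨ ℚ.+-identityʳ _ ⟨
           (1ℚ ℚ.- seq x i) ℚ.+ 0ℚ               ≤⟨ ℚ.+-monoʳ-≤ (1ℚ ℚ.- seq x i) (p i ni) ⟩
           (1ℚ ℚ.- seq x i) ℚ.+ (seq x i ℚ.+ ε)  ≡⟨ solve 3 (λ o a e → (o :- a) :+ (a :+ e) := o :+ e) refl 1ℚ (seq x i) ε ⟩
           1ℚ ℚ.+ ε                              ∎

record ℝ≥0 : Set where
  constructor mkℝ≥0
  field
    ⌊_⌋         : ℝ
    nonNegative : 0ℝ ≤ℝ ⌊_⌋

record UnitInterval : Set where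
  constructor mkUnit
  field
    ⌊_⌋ᵘ        : ℝ
    nonNegative : 0ℝ ≤ℝ ⌊_⌋ᵘ
    atMostOne   : ⌊_⌋ᵘ ≤ℝ 1ℝ

open ℝ≥0 public using (⌊_⌋)
open UnitInterval public using (⌊_⌋ᵘ)

infix 4 _≈ℝ≥0_ _≈ᵘ_ _≤ᵘ_

_≈ℝ≥0_ : Rel ℝ≥0 0ℓ
a ≈ℝ≥0 b = ⌊ a ⌋ ≈ℝ ⌊ b ⌋

_≈ᵘ_ _≤ᵘ_ : Rel UnitInterval 0ℓ
a ≈ᵘ b = ⌊ a ⌋ᵘ ≈ℝ ⌊ b ⌋ᵘ
a ≤ᵘ b = ⌊ a ⌋ᵘ ≤ℝ ⌊ b ⌋ᵘ

infixl 6 _+ℝ≥0_ _⊔ℝ≥0_ _⊔ᵘ_ _⊓ᵘ_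
infixl 7 _*ℝ≥0_

_+ℝ≥0_ _*ℝ≥0_ _⊔ℝ≥0_ : ℝ≥0 → ℝ≥0 → ℝ≥0
mkℝ≥0 x p +ℝ≥0 mkℝ≥0 y q = mkℝ≥0 (x +ℝ y) (BoundLemmas.+-nonNegative x y p q)
mkℝ≥0 x p *ℝ≥0 mkℝ≥0 y q = mkℝ≥0 (x *ℝ y) (BoundLemmas.*-nonNegative x y p q)
mkℝ≥0 x p ⊔ℝ≥0 mkℝ≥0 y q =
  mkℝ≥0 (x ⊔ℝ y) (BoundLemmas.≤ℝ-trans 0ℝ x (x ⊔ℝ y) p (BoundLemmas.x≤x⊔y x y))

0ℝ≥0 1ℝ≥0 : ℝ≥0
0ℝ≥0 = mkℝ≥0 0ℝ (BoundLemmas.≤ℝ-refl 0ℝ)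
1ℝ≥0 = mkℝ≥0 1ℝ BoundLemmas.0≤1

_⊔ᵘ_ _⊓ᵘ_ : UnitInterval → UnitInterval → UnitInterval
mkUnit x p p′ ⊔ᵘ mkUnit y q q′ = mkUnit (x ⊔ℝ y)
  (BoundLemmas.≤ℝ-trans 0ℝ x (x ⊔ℝ y) p (BoundLemmas.x≤x⊔y x y))
  (BoundLemmas.⊔-least x y 1ℝ p′ q′)
mkUnit x p p′ ⊓ᵘ mkUnit y q q′ = mkUnit (x ⊓ℝ y)
  (BoundLemmas.⊓-greatest x y 0ℝ p q)
  (BoundLemmas.≤ℝ-trans (x ⊓ℝ y) x 1ℝ (BoundLemmas.x⊓y≤x x y) p′)

0ᵘ 1ᵘ : UnitInterval
0ᵘ = mkUnit 0ℝ (BoundLemmas.≤ℝ-refl 0ℝ) BoundLemmas.0≤1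
1ᵘ = mkUnit 1ℝ BoundLemmas.0≤1 (BoundLemmas.≤ℝ-refl 1ℝ)

1-ᵘ_ : UnitInterval → UnitInterval
1-ᵘ mkUnit x p p′ = mkUnit (1ℝ -ℝ x) (BoundLemmas.0≤1-x x p′) (BoundLemmas.1-x≤1 x p)

toℝ≥0 : UnitInterval → ℝ≥0
toℝ≥0 (mkUnit x p _) = mkℝ≥0 x p

------------------------------------------------------------------------

SAT-rawSemiring : RawSemiring 0ℓ 0ℓ
SAT-rawSemiring = record
  { Carrier = Bool ; _≈_ = _≡_ ; _+_ = _∨_ ; _*_ = _∧_ ; 0# = false ; 1# = true }

#SAT-rawSemiring : RawSemiring 0ℓ 0ℓ
#SAT-rawSemiring = ℕ.+-*-rawSemiring

------------------------------------------------------------------------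

WMC-rawSemiring : RawSemiring 0ℓ 0ℓ
WMC-rawSemiring = record
  { Carrier = ℝ≥0 ; _≈_ = _≈ℝ≥0_ ; _+_ = _+ℝ≥0_ ; _*_ = _*ℝ≥0_
  ; 0# = 0ℝ≥0 ; 1# = 1ℝ≥0 }

weightedCount : (Literal n → ℝ) → Formula n → ℝ
weightedCount w T = ∑ℝ (map (λ I → ∏ℝ (map w (literals I))) (models T))

-- The product of the Bernoulli distributions with parameters p v.

mass : (Fin n → ℝ) → Interpretation n → ℝ
mass {n} p I = ∏ℝ (map (λ v → if lookup I v then p v else 1ℝ -ℝ p v) (allFin n))

probability : (Fin n → ℝ) → Formula n → ℝ
probability {n} p T =
  ∑ℝ (map (λ I → if ⟦ T ⟧ I then mass p I else 0ℝ) (interpretations n))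

------------------------------------------------------------------------
-- A polynomial is a list of terms, in which a monomial may occur several
-- times; two polynomials are equal when all their coefficients are.

Monomial : ℕ → Set
Monomial n = Vec ℕ n

Poly : ℕ → Set
Poly n = List (ℝ × Monomial n)

coeff : Poly n → Monomial n → ℝ
coeff P μ = ∑ℝ (map proj₁ (filter (λ t → Vec.≡-dec ℕ._≟_ (proj₂ t) μ) P))

infix 4 _≈ᴾ_

_≈ᴾ_ : Rel (Poly n) 0ℓ
P ≈ᴾ Q = ∀ μ → coeff P μ ≈ℝ coeff Q μ

infixl 6 _+ᴾ_ _-ᴾ_
infixl 7 _*ᴾ_

_+ᴾ_ _*ᴾ_ _-ᴾ_ : Poly n → Poly n → Poly n
P +ᴾ Q = P ++ Q
P *ᴾ Q = cartesianProductWith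
  (λ (a , μ) (b , ν) → a *ℝ b , Vec.zipWith ℕ._+_ μ ν) P Q
P -ᴾ Q = P +ᴾ map (λ (b , ν) → -ℝ_ b , ν) Q

constᴾ : ℝ → Poly n
constᴾ {n} a = (a , Vec.replicate n 0) ∷ []

varᴾ : Fin n → Poly n
varᴾ {n} v = (1ℝ , Vec.replicate n 0 [ v ]≔ 1) ∷ []

evaluate : Poly n → (Fin n → ℝ) → ℝ
evaluate {n} P x =
  ∑ℝ (map (λ (a , μ) → a *ℝ ∏ℝ (map (λ v → x v ^ℝ lookup μ v) (allFin n))) P)

-- Where the exponent of v is 0 the new coefficient is 0, so truncation
-- by pred is harmless.

∂ : Fin n → Poly n → Poly n
∂ v = map (λ (a , μ) → lookup μ v ·ℝ a , updateAt μ v pred)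

SENS-rawSemiring : ℕ → RawSemiring 0ℓ 0ℓ
SENS-rawSemiring n = record
  { Carrier = Poly n ; _≈_ = _≈ᴾ_ ; _+_ = _+ᴾ_ ; _*_ = _*ᴾ_
  ; 0# = [] ; 1# = constᴾ 1ℝ }

-- P lies in the subring generated by the symbolic parameters, and takes
-- the value probability p T at every p in [0,1]ⁿ that agrees with α on
-- the parameters with a constant label.

IsSensitivityPoly : (Literal n → Poly n) → Formula n → Poly n → Set
IsSensitivityPoly {n} α T P =
  (∀ v μ → ¬ (α (pos v) ≈ᴾ varᴾ v) → lookup μ v ≢ 0 → coeff P μ ≈ℝ 0ℝ) ×
  (∀ (p : Fin n → UnitInterval) →
     (∀ v (a : UnitInterval) → α (pos v) ≈ᴾ constᴾ ⌊ a ⌋ᵘ → p v ≈ᵘ a) →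
     evaluate P (⌊_⌋ᵘ ∘ p) ≈ℝ probability (⌊_⌋ᵘ ∘ p) T)

IsProbabilityPoly : Formula n → Poly n → Set
IsProbabilityPoly {n} T P = ∀ (p : Fin n → UnitInterval) →
  evaluate P (⌊_⌋ᵘ ∘ p) ≈ℝ probability (⌊_⌋ᵘ ∘ p) T

infix 4 _≈ᴳ_

_≈ᴳ_ : Rel (ℝ≥0 × ℝ) 0ℓ
(a₁ , a₂) ≈ᴳ (b₁ , b₂) = (a₁ ≈ℝ≥0 b₁) × (a₂ ≈ℝ b₂)

GRAD-rawSemiring : RawSemiring 0ℓ 0ℓ
GRAD-rawSemiring = record
  { Carrier = ℝ≥0 × ℝ
  ; _≈_     = _≈ᴳ_
  ; _+_     = λ (a₁ , a₂) (b₁ , b₂) → a₁ +ℝ≥0 b₁ , a₂ +ℝ b₂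
  ; _*_     = λ (a₁ , a₂) (b₁ , b₂) → a₁ *ℝ≥0 b₁ , ⌊ a₁ ⌋ *ℝ b₂ +ℝ a₂ *ℝ ⌊ b₁ ⌋
  ; 0#      = 0ℝ≥0 , 0ℝ
  ; 1#      = 1ℝ≥0 , 0ℝ
  }

IsGradient : Poly n → Fin n → (Fin n → ℝ) → ℝ≥0 × ℝ → Set
IsGradient P k p (a , b) = (⌊ a ⌋ ≈ℝ evaluate P p) × (b ≈ℝ evaluate (∂ k P) p)

------------------------------------------------------------------------

MPE-rawSemiring : RawSemiring 0ℓ 0ℓ
MPE-rawSemiring = record
  { Carrier = ℝ≥0 ; _≈_ = _≈ℝ≥0_ ; _+_ = _⊔ℝ≥0_ ; _*_ = _*ℝ≥0_
  ; 0# = 0ℝ≥0 ; 1# = 1ℝ≥0 }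

-- The order of the reals is not decidable, so which of finitely many
-- reals is the largest (or smallest) is known only up to double negation;
-- hence ¬ ¬ in the definitions of the sets of values.

IsMPE : (Fin n → ℝ) → Formula n → ℝ → Set
IsMPE p T = IsMaximumOr _≈ℝ_ _≤ℝ_ 0ℝ
  (λ x → ¬ ¬ ∃ λ I → I ⊨ T × x ≈ℝ mass p I)

FUZZY-rawSemiring : RawSemiring 0ℓ 0ℓ
FUZZY-rawSemiring = record
  { Carrier = UnitInterval ; _≈_ = _≈ᵘ_ ; _+_ = _⊔ᵘ_ ; _*_ = _⊓ᵘ_
  ; 0# = 0ᵘ ; 1# = 1ᵘ }

IsFuzzyDegree : (Fin n → UnitInterval) → Interpretation n → UnitInterval → Set
IsFuzzyDegree d I = IsMinimumOr _≈ᵘ_ _≤ᵘ_ 1ᵘ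
  (λ x → ¬ ¬ ∃ λ v → lookup I v ≡ true × x ≈ᵘ d v)

IsFuzzyValue : (Fin n → UnitInterval) → Formula n → UnitInterval → Set
IsFuzzyValue d T = IsMaximumOr _≈ᵘ_ _≤ᵘ_ 0ᵘ
  (λ x → ¬ ¬ ∃ λ I → I ⊨ T × IsFuzzyDegree d I x)

------------------------------------------------------------------------

kWEIGHT-rawSemiring : ℕ → RawSemiring 0ℓ 0ℓ
kWEIGHT-rawSemiring k = record
  { Carrier = Fin (suc k)
  ; _≈_     = _≡_
  ; _+_     = λ a b → truncate (toℕ a ℕ.⊓ toℕ b)
  ; _*_     = λ a b → truncate (toℕ a ℕ.+ toℕ b)
  ; 0#      = fromℕ k
  ; 1#      = 0F
  }
  where
  truncate : ℕ → Fin (suc k)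
  truncate m = fromℕ< {m ℕ.⊓ k} (ℕ.s≤s (ℕ.m⊓n≤n m k))

totalCost : (Literal n → ℕ) → Interpretation n → ℕ
totalCost w I = foldr ℕ._+_ 0 (map w (literals I))

IsTruncatedMinCost : ∀ k → (Literal n → Fin (suc k)) → Formula n → Fin (suc k) → Set
IsTruncatedMinCost k w T m =
  (Model T → ∃ λ c → IsMinimum ℕ._≤_ (λ x → ∃ λ I → I ⊨ T × x ≡ totalCost (toℕ ∘ w) I) c
                     × toℕ m ≡ c ℕ.⊓ k) ×
  (¬ Model T → m ≡ fromℕ k)

------------------------------------------------------------------------

ℕ∞ : Set
ℕ∞ = ℕ ⁺

open AddSupremum ℕ._≤_ public using () renaming (_≤⁺_ to _≤∞_)

infixl 6 _+∞_ _⊓∞_ _⊔∞_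

_+∞_ _⊓∞_ _⊔∞_ : ℕ∞ → ℕ∞ → ℕ∞
[ a ] +∞ [ b ] = [ a ℕ.+ b ]
[ _ ] +∞ ⊤⁺    = ⊤⁺
⊤⁺    +∞ _     = ⊤⁺
[ a ] ⊓∞ [ b ] = [ a ℕ.⊓ b ]
[ a ] ⊓∞ ⊤⁺    = [ a ]
⊤⁺    ⊓∞ b     = b
[ a ] ⊔∞ [ b ] = [ a ℕ.⊔ b ]
[ _ ] ⊔∞ ⊤⁺    = ⊤⁺
⊤⁺    ⊔∞ _     = ⊤⁺

S-PATH-rawSemiring W-PATH-rawSemiring : RawSemiring 0ℓ 0ℓ
S-PATH-rawSemiring = record
  { Carrier = ℕ∞ ; _≈_ = _≡_ ; _+_ = _⊓∞_ ; _*_ = _+∞_ ; 0# = ⊤⁺ ; 1# = [ 0 ] }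
W-PATH-rawSemiring = record
  { Carrier = ℕ∞ ; _≈_ = _≡_ ; _+_ = _⊔∞_ ; _*_ = _⊓∞_ ; 0# = [ 0 ] ; 1# = ⊤⁺ }

-- The edge set is Fin n, so that edges are propositional variables.

record Digraph (n : ℕ) : Set where
  field
    #nodes        : ℕ
    source target : Fin n → Fin #nodes
    noMultiEdges  : ∀ {e f} → source e ≡ source f → target e ≡ target f → e ≡ f

  Node : Set
  Node = Fin #nodes

  IsPath : Node → Node → List (Fin n) → Set
  IsPath s t []       = s ≡ t
  IsPath s t (e ∷ es) = source e ≡ s × IsPath (target e) t es

  IsSimplePath : Node → Node → List (Fin n) → Set
  IsSimplePath s t es = IsPath s t es × Unique (s ∷ map target es)

  isPath? : ∀ s t es → Dec (IsPath s t es)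
  isPath? s t []       = s Fin.≟ t
  isPath? s t (e ∷ es) = (source e Fin.≟ s) ×-dec isPath? (target e) t es

  isSimplePath? : ∀ s t es → Dec (IsSimplePath s t es)
  isSimplePath? s t es =
    isPath? s t es ×-dec DecUnique.unique? Fin._≟_ (s ∷ map target es)

  edgeLists : ℕ → List (List (Fin n))
  edgeLists zero    = [] ∷ []
  edgeLists (suc k) = cartesianProductWith _∷_ (allFin n) (edgeLists k)

  -- A simple path has fewer edges than the graph has nodes.

  simplePaths : Node → Node → List (List (Fin n))
  simplePaths s t = filter (isSimplePath? s t) (concatMap edgeLists (upTo #nodes))

  pathTheory : Node → Node → Formula n
  pathTheory s t = ⋁ᶠ (map (λ es → ⋀ᶠ (map var es)) (simplePaths s t))

  -- Paths here, unlike in pathTheory, may repeat nodes and edges.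

  IsShortestPathLength : (Fin n → ℕ∞) → Node → Node → ℕ∞ → Set
  IsShortestPathLength w s t = IsMinimumOr _≡_ _≤∞_ ⊤⁺
    (λ x → ∃ λ es → IsPath s t es × x ≡ foldr _+∞_ [ 0 ] (map w es))

  IsWidestPathWidth : (Fin n → ℕ∞) → Node → Node → ℕ∞ → Set
  IsWidestPathWidth w s t = IsMaximumOr _≡_ _≤∞_ [ 0 ]
    (λ x → ∃ λ es → IsPath s t es ×
                    IsMinimum _≤∞_ (λ y → ∃ λ e → e ∈ es × y ≡ w e) x)

------------------------------------------------------------------------
-- Reduced ordered binary decision diagrams.  A diagram is given by its
-- unfolding to a tree; isomorphic subgraphs, which a reduced diagram
-- shares, are equal subtrees.

data BDD (n : ℕ) : Set where
  leaf : Bool → BDD n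
  node : (v : Fin n) (lo hi : BDD n) → BDD n

module _ {n : ℕ} where

  node-injective : ∀ {v w : Fin n} {l l′ h h′} →
    node v l h ≡ node w l′ h′ → v ≡ w × l ≡ l′ × h ≡ h′
  node-injective refl = refl , refl , refl

  infix 4 _≟ᴮ_

  _≟ᴮ_ : DecidableEquality (BDD n)
  leaf a ≟ᴮ leaf b with a Bool.≟ b
  ... | yes refl = yes refl
  ... | no a≢b   = no λ { refl → a≢b refl }
  leaf _ ≟ᴮ node _ _ _ = no λ ()
  node _ _ _ ≟ᴮ leaf _ = no λ ()
  node v l h ≟ᴮ node w l′ h′ with v Fin.≟ w | l ≟ᴮ l′ | h ≟ᴮ h′
  ... | yes refl | yes refl | yes refl = yes refl
  ... | no v≢w   | _        | _        = no (v≢w ∘ proj₁ ∘ node-injective)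
  ... | yes _    | no l≢l′  | _        = no (l≢l′ ∘ proj₁ ∘ proj₂ ∘ node-injective)
  ... | yes _    | yes _    | no h≢h′  = no (h≢h′ ∘ proj₂ ∘ proj₂ ∘ node-injective)

  ⟦_⟧ᴮ : BDD n → Interpretation n → Bool
  ⟦ leaf b ⟧ᴮ       I = b
  ⟦ node v lo hi ⟧ᴮ I = if lookup I v then ⟦ hi ⟧ᴮ I else ⟦ lo ⟧ᴮ I

module Diagrams {n : ℕ} {_<_ : Rel (Fin n) 0ℓ} (isOrder : IsStrictTotalOrder _≡_ _<_) where

  _≺_ : Fin n → BDD n → Set
  v ≺ leaf _     = ⊤
  v ≺ node w _ _ = v < w

  Ordered : BDD n → Set
  Ordered (leaf _)       = ⊤
  Ordered (node v lo hi) = v ≺ lo × v ≺ hi × Ordered lo × Ordered hi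

  Reduced : BDD n → Set
  Reduced (leaf _)       = ⊤
  Reduced (node v lo hi) = lo ≢ hi × Reduced lo × Reduced hi

  record OBDD : Set where
    constructor mkOBDD
    field
      diagram : BDD n
      ordered : Ordered diagram
      reduced : Reduced diagram

  open OBDD

  infix 4 _≈ᴼ_

  _≈ᴼ_ : Rel OBDD 0ℓ
  D ≈ᴼ E = diagram D ≡ diagram E

  strictTotalOrder : StrictTotalOrder 0ℓ 0ℓ 0ℓ
  strictTotalOrder = record { isStrictTotalOrder = isOrder }

  module S = Sort (STO.decTotalOrder strictTotalOrder)

  variables : List (Fin n)
  variables = S.sort (allFin n)

  unique : Unique variables
  unique = PermSetoid.Unique-resp-↭ (setoid (Fin n))
    (Perm.↭⇒↭ₛ (Perm.↭-sym (S.sort-↭ (allFin n)))) (Unique.allFin⁺ n)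

  strict : ∀ {xs} → AllPairs (λ v w → v < w ⊎ v ≡ w) xs → Unique xs → AllPairs _<_ xs
  strict []         []         = []
  strict (px ∷ pxs) (qx ∷ qxs) = All.zipWith both (px , qx) ∷ strict pxs qxs
    where
    both : ∀ {v w} → (v < w ⊎ v ≡ w) × v ≢ w → v < w
    both (inj₁ v<w , _)   = v<w
    both (inj₂ v≡w , v≢w) = contradiction v≡w v≢w

  increasing : AllPairs _<_ variables
  increasing = strict
    (Sorted.Sorted⇒AllPairs (STO.totalOrder strictTotalOrder) (S.sort-↗ (allFin n))) unique

  -- Shannon expansion along a list of variables, dropping redundant tests.

  branch : Fin n → BDD n → BDD n → BDD n
  branch v lo hi with lo ≟ᴮ hi
  ... | yes _ = lo
  ... | no  _ = node v lo hi

  expand : List (Fin n) → (Interpretation n → Bool) → Interpretation n → BDD n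
  expand []       f I = leaf (f I)
  expand (v ∷ vs) f I = branch v (expand vs f (I [ v ]≔ false)) (expand vs f (I [ v ]≔ true))

  branch-≺ : ∀ u v lo hi → u < v → u ≺ lo → u ≺ branch v lo hi
  branch-≺ u v lo hi u<v u≺lo with lo ≟ᴮ hi
  ... | yes _ = u≺lo
  ... | no  _ = u<v

  branch-ordered : ∀ v lo hi → v ≺ lo → v ≺ hi → Ordered lo → Ordered hi →
    Ordered (branch v lo hi)
  branch-ordered v lo hi p q r s with lo ≟ᴮ hi
  ... | yes _ = r
  ... | no  _ = p , q , r , s

  branch-reduced : ∀ v lo hi → Reduced lo → Reduced hi → Reduced (branch v lo hi)
  branch-reduced v lo hi p q with lo ≟ᴮ hi
  ... | yes _     = p
  ... | no  lo≢hi = lo≢hi , p , q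

  expand-≺ : ∀ u vs f I → All (u <_) vs → u ≺ expand vs f I
  expand-≺ u []       f I []       = tt
  expand-≺ u (v ∷ vs) f I (p ∷ ps) =
    branch-≺ u v (expand vs f (I [ v ]≔ false)) _ p (expand-≺ u vs f _ ps)

  expand-ordered : ∀ vs f I → AllPairs _<_ vs → Ordered (expand vs f I)
  expand-ordered []       f I []       = tt
  expand-ordered (v ∷ vs) f I (p ∷ ps) = branch-ordered v _ _
    (expand-≺ v vs f (I [ v ]≔ false) p) (expand-≺ v vs f (I [ v ]≔ true) p)
    (expand-ordered vs f (I [ v ]≔ false) ps) (expand-ordered vs f (I [ v ]≔ true) ps)

  expand-reduced : ∀ vs f I → Reduced (expand vs f I)
  expand-reduced []       f I = tt
  expand-reduced (v ∷ vs) f I = branch-reduced v _ _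
    (expand-reduced vs f (I [ v ]≔ false)) (expand-reduced vs f (I [ v ]≔ true))

  -- The starting interpretation is irrelevant: every variable is expanded.

  fromFunction : (Interpretation n → Bool) → OBDD
  fromFunction f = record
    { diagram = expand variables f (Vec.replicate n false)
    ; ordered = expand-ordered variables f _ increasing
    ; reduced = expand-reduced variables f _
    }

  obdd : Formula n → OBDD
  obdd φ = fromFunction ⟦ φ ⟧

  infixr 6 _∧ᴼ_
  infixr 5 _∨ᴼ_

  _∨ᴼ_ _∧ᴼ_ : OBDD → OBDD → OBDD
  D ∨ᴼ E = fromFunction λ I → ⟦ diagram D ⟧ᴮ I ∨ ⟦ diagram E ⟧ᴮ I
  D ∧ᴼ E = fromFunction λ I → ⟦ diagram D ⟧ᴮ I ∧ ⟦ diagram E ⟧ᴮ I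

  ¬ᴼ_ : OBDD → OBDD
  ¬ᴼ D = fromFunction λ I → not (⟦ diagram D ⟧ᴮ I)

  OBDD-rawSemiring : RawSemiring 0ℓ 0ℓ
  OBDD-rawSemiring = record
    { Carrier = OBDD ; _≈_ = _≈ᴼ_ ; _+_ = _∨ᴼ_ ; _*_ = _∧ᴼ_
    ; 0# = obdd ⊥ᶠ ; 1# = obdd ⊤ᶠ }

  Represents : Formula n → OBDD → Set
  Represents φ D = ∀ I → ⟦ diagram D ⟧ᴮ I ≡ ⟦ φ ⟧ I

  IsDiagramOf : Formula n → OBDD → Set
  IsDiagramOf φ D = Represents φ D × (∀ E → Represents φ E → E ≈ᴼ D)

module Submission where

-- Most of the tasks ask for a sum or an optimum over the models of the very
-- quantity that the semiring forms from the labels of a model, so the work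
-- is to verify the semiring laws and to compare two expressions.  Two
-- principles do most of it.
--
-- First, algebraic model counting commutes with semiring homomorphisms
-- (AMC-homo).  Forgetting nonnegativity maps the semiring of WMC and PROB
-- to the reals; evaluation at a point maps polynomials to the reals;
-- evaluation of a polynomial together with its partial derivative maps
-- polynomials to the dual numbers, into which the gradient semiring embeds;
-- the value of a diagram at an interpretation J maps diagrams to the
-- Booleans, where only the model J contributes (AMC-truth).
--
-- Second, where the sum is a maximum or a minimum, a nonempty finite sum bounds
-- each of its terms and is equal to one of them (IsSelection).  The order of the
-- reals is undecidable, so there the second half holds only under a double
-- negation; this suffices because equality and order of the reals are
-- stable (≤ℝ-stable), and the same argument proves that multiplication
-- distributes over the maximum of nonnegative reals.
--
-- Paths: a path contains the edges of a simple one (simplify), the edges of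
-- a simple path form a model, and every model contains a simple path.  As
-- the product over a larger set of edges is never better, the optima over
-- models, simple paths and all paths coincide (OptimalPath).
--
-- Diagrams: reduced ordered diagrams with equal Boolean functions are equal
-- (canonical), because a reduced diagram cannot test a variable on which its
-- function does not depend.  Hence equality of diagrams is equality of
-- functions, and the semiring laws are those of Boolean functions.
--
-- Polynomials: a list of terms P is studied through the functional
-- h ↦ ⟪ P , h ⟫ that replaces each monomial μ by the real h μ.  It depends
-- only on the coefficients of P (⟪⟫-resp-≈ᴾ) and determines them
-- (⟪⟫-injective), since coefficients, values and values of derivatives are
-- all of this form.  The semiring laws become identities of iterated sums.
--
-- Uniqueness of the sensitivity polynomial: let Q be a polynomial in the
-- symbolic variables only that vanishes on the part of the unit cube where
-- the variables with a constant label take that constant.  Halving the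
-- symbolic variable v multiplies a monomial ν by (1/2)^(ν v), so if the
-- functional of Q annihilates all functions g(ν) x^ν with x in that set, it
-- also annihilates g(ν) ((1/2)^(ν v) - r) x^ν for every real r.  Taking such
-- factors for the monomials of Q other than μ isolates the coefficient of μ,
-- up to an invertible factor, and shows that it is 0 (coeff≈0).  The
-- probability polynomial is the case in which every variable is symbolic,
-- so it is unique as well, and its gradient is the one computed above.

import Algebra.Construct.Pointwise as Pointwise
import Algebra.Definitions as AlgebraDefinitions
import Algebra.Definitions.RawSemiring as RawSemiringOps
import Algebra.Morphism.MonoidMonomorphism as MonoidMonomorphism
import Algebra.Morphism.Structures as Morphisms
open import Algebra.Bundles.Raw using (RawSemiring)
open import Algebra.Core using (Op₂)
open import Algebra.Structures using (IsCommutativeMonoid; IsCommutativeSemiring)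
open import Algebra.Structures.Biased using (isCommutativeMonoidˡ; isCommutativeSemiringˡ)
open import Axiom.UniquenessOfIdentityProofs using (module Decidable⇒UIP)
open import Data.Bool.Base using (Bool; true; false; if_then_else_; _∧_; _∨_; not)
import Data.Bool.Properties as Bool
open import Data.Fin.Base using (Fin; toℕ) renaming (zero to 0F; suc to sucF)
import Data.Fin.Properties as Fin
import Data.Integer.Base as ℤ
open import Data.List.Base as List using (List; []; _∷_; _++_; map; foldr; filter; allFin; length)
import Data.List.Properties as List
open import Data.List.Membership.Propositional using (_∈_; find; lose)
open import Data.List.Membership.DecPropositional using (_∈?_)
import Data.List.Membership.Propositional.Properties as ∈
import Data.List.Relation.Binary.Permutation.Propositional as Perm
import Data.List.Relation.Binary.Permutation.Propositional.Properties as Perm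
open import Data.List.Relation.Binary.Subset.Propositional using (_⊆_)
open import Data.List.Relation.Unary.All as All using (All; []; _∷_)
import Data.List.Relation.Unary.All.Properties as All
open import Data.List.Relation.Unary.AllPairs using ([]; _∷_)
open import Data.List.Relation.Unary.Any as Any using (here; there)
import Data.List.Relation.Unary.Any.Properties as Any
open import Data.List.Relation.Unary.Unique.Propositional using (Unique)
import Data.List.Relation.Unary.Unique.DecPropositional.Properties as DecUnique
import Data.List.Relation.Unary.Unique.Propositional.Properties as Unique
open import Data.Nat.Base as ℕ using (ℕ; zero; suc; pred)
import Data.Nat.Properties as ℕ
open import Data.Product.Base using (∃; _×_; _,_; proj₁; proj₂)
open import Data.Rational.Base as ℚ using (ℚ; 0ℚ; 1ℚ; ½; ∣_∣)
import Data.Rational.Properties as ℚ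
open import Data.Rational.Solver using (module +-*-Solver)
open import Data.Sum.Base as Sum using (_⊎_; inj₁; inj₂)
open import Data.Vec.Base as Vec using (Vec; []; _∷_; lookup; updateAt; _[_]≔_)
import Data.Vec.Properties as Vec
open import Function.Base using (_∘_; id; flip)
open import Function.Bundles using (_⇔_; _↔_; mk⇔; mk↔ₛ′)
open import Level using (Level; 0ℓ)
open import Relation.Binary.Bundles using (Setoid)
open import Relation.Binary.Core using (Rel)
open import Relation.Binary.Definitions using (DecidableEquality; Tri; tri<; tri≈; tri>)
open import Relation.Binary.PropositionalEquality
  using (_≡_; _≢_; refl; sym; trans; cong; cong₂; subst; isEquivalence; module ≡-Reasoning)
open import Relation.Binary.Structures using (IsEquivalence; IsStrictTotalOrder)
import Relation.Binary.Construct.Add.Supremum.NonStrict as AddSupremum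
import Relation.Binary.Construct.On as On
import Relation.Binary.Reasoning.Setoid as SetoidReasoning
open import Relation.Nullary.Construct.Add.Supremum using ([_]; ⊤⁺; ≡-dec)
open import Relation.Nullary.Decidable using (dec-true; dec-false)
open import Relation.Nullary.Decidable.Core
  using (Dec; yes; no; does; ¬?; _×-dec_; decidable-stable)
open import Relation.Nullary.Negation.Core using (¬_; contradiction; ¬¬-map)
open import Defs
open +-*-Solver using (solve; _:+_; _:*_; _:-_; :-_; _:=_)
open AddSupremum ℕ._≤_ using ([_]; _≤⊤⁺; [≤]-injective; ≤⁺-trans; ≤⁺-reflexive-≡; ≤⁺-antisym-≡)
open ℝ using (seq; cauchy)
open _≈ℝ_ using (close)
open _≤ℝ_ using (below)
open BigOps ℝ-rawSemiring using () renaming (⨁ to ∑ℝ; ⨂ to ∏ℝ)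
open RawSemiringOps ℝ-rawSemiring using () renaming (_^_ to _^ℝ_; _×_ to _·ℝ_)

private
  variable
    n : ℕ
    c c′ ℓ ℓ′ : Level

------------------------------------------------------------------------
-- Commutative semirings and their homomorphisms

module _ (R : RawSemiring c ℓ) where
  open RawSemiring R
  open AlgebraDefinitions _≈_

  commutativeSemiring :
    IsEquivalence _≈_ →
    Congruent₂ _+_ → Associative _+_ → Commutative _+_ → LeftIdentity 0# _+_ →
    Congruent₂ _*_ → Associative _*_ → Commutative _*_ → LeftIdentity 1# _*_ →
    _*_ DistributesOverʳ _+_ → LeftZero 0# _*_ →
    IsCommutativeSemiringOn R
  commutativeSemiring ≈-equiv +-cong +-assoc +-comm +-identityˡ
                              *-cong *-assoc *-comm *-identityˡ distribʳ zeroˡ =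
    isCommutativeSemiringˡ record
      { +-isCommutativeMonoid = monoid +-cong +-assoc +-comm +-identityˡ
      ; *-isCommutativeMonoid = monoid *-cong *-assoc *-comm *-identityˡ
      ; distribʳ              = distribʳ
      ; zeroˡ                 = zeroˡ
      }
    where
    monoid : ∀ {_∙_ ε} → Congruent₂ _∙_ → Associative _∙_ → Commutative _∙_ →
      LeftIdentity ε _∙_ → IsCommutativeMonoid _≈_ _∙_ ε
    monoid ∙-cong assoc comm identityˡ = isCommutativeMonoidˡ record
      { isSemigroup = record
        { isMagma = record { isEquivalence = ≈-equiv ; ∙-cong = ∙-cong } ; assoc = assoc }
      ; identityˡ   = identityˡ
      ; comm        = comm
      }

module _ (R : RawSemiring c ℓ) (S : RawSemiring c′ ℓ′) where
  private
    module R = RawSemiring R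
    module S = RawSemiring S
  open Morphisms.SemiringMorphisms R S

  semiringHomomorphism : ∀ f →
    (∀ {a b} → a R.≈ b → f a S.≈ f b) →
    (∀ a b → f (a R.+ b) S.≈ f a S.+ f b) → f R.0# S.≈ S.0# →
    (∀ a b → f (a R.* b) S.≈ f a S.* f b) → f R.1# S.≈ S.1# →
    IsSemiringHomomorphism f
  semiringHomomorphism f f-cong +-homo 0-homo *-homo 1-homo = record
    { isNearSemiringHomomorphism = record
      { +-isMonoidHomomorphism = record
        { isMagmaHomomorphism = record
          { isRelHomomorphism = record { cong = f-cong } ; homo = +-homo }
        ; ε-homo = 0-homo
        }
      ; *-homo = *-homo
      }
    ; 1#-homo = 1-homo
    }

  -- A structure embedded in a commutative semiring, with the equality
  -- induced by the embedding, is a commutative semiring.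

  isCommutativeSemiring-transport : ∀ {f} → IsSemiringMonomorphism f →
    IsCommutativeSemiringOn S → IsCommutativeSemiringOn R
  isCommutativeSemiring-transport {f} f-mono isS = isCommutativeSemiringˡ record
    { +-isCommutativeMonoid =
        MonoidMonomorphism.isCommutativeMonoid +-isMonoidMonomorphism +-isCommutativeMonoid
    ; *-isCommutativeMonoid =
        MonoidMonomorphism.isCommutativeMonoid *-isMonoidMonomorphism *-isCommutativeMonoid
    ; distribʳ = λ a b c → injective
        (≈-trans (≈-trans (*-homo (b R.+ c) a) (*-cong (+-homo b c) ≈-refl))
        (≈-trans (distribʳ (f a) (f b) (f c))
        (≈-sym (≈-trans (+-homo (b R.* a) (c R.* a)) (+-cong (*-homo b a) (*-homo c a))))))
    ; zeroˡ = λ a → injective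
        (≈-trans (≈-trans (*-homo R.0# a) (*-cong 0#-homo ≈-refl))
        (≈-trans (zeroˡ (f a)) (≈-sym 0#-homo)))
    }
    where
    open IsSemiringMonomorphism f-mono
    open IsCommutativeSemiring isS
      using (+-isCommutativeMonoid; *-isCommutativeMonoid; distribʳ; zeroˡ; +-cong; *-cong)
      renaming (refl to ≈-refl; sym to ≈-sym; trans to ≈-trans)

------------------------------------------------------------------------
-- Folds in commutative monoids

module Fold {A : Set c} {_≈_ : Rel A ℓ} {_∙_ : Op₂ A} {ε : A}
  (isCommutativeMonoid : IsCommutativeMonoid _≈_ _∙_ ε) where
  private module M = IsCommutativeMonoid isCommutativeMonoid

  fold : List A → A
  fold = foldr _∙_ ε

  -- The middle-four interchange law.

  interchange : ∀ w x y z → ((w ∙ x) ∙ (y ∙ z)) ≈ ((w ∙ y) ∙ (x ∙ z))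
  interchange w x y z = M.trans (M.assoc w x (y ∙ z)) (M.trans (M.∙-cong M.refl
    (M.trans (M.sym (M.assoc x y z)) (M.trans (M.∙-cong (M.comm x y) M.refl) (M.assoc y x z))))
    (M.sym (M.assoc w y (x ∙ z))))

  module _ {B : Set} where

    fold-cong : ∀ {f g : B → A} xs → (∀ {x} → x ∈ xs → f x ≈ g x) →
      fold (map f xs) ≈ fold (map g xs)
    fold-cong []       f≈g = M.refl
    fold-cong (x ∷ xs) f≈g = M.∙-cong (f≈g (here refl)) (fold-cong xs (f≈g ∘ there))

    fold-ε : ∀ {f : B → A} xs → (∀ {x} → x ∈ xs → f x ≈ ε) → fold (map f xs) ≈ ε
    fold-ε []       f≈ε = M.refl
    fold-ε (x ∷ xs) f≈ε = M.trans (M.∙-cong (f≈ε (here refl)) (fold-ε xs (f≈ε ∘ there))) (M.identityˡ ε)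

    fold-∙ : ∀ (f g : B → A) xs →
      fold (map (λ x → f x ∙ g x) xs) ≈ (fold (map f xs) ∙ fold (map g xs))
    fold-∙ f g []       = M.sym (M.identityˡ ε)
    fold-∙ f g (x ∷ xs) = M.trans (M.∙-cong M.refl (fold-∙ f g xs)) (interchange _ _ _ _)

    -- One occurrence of x moved to the front of a fold over xs.  The remaining
    -- list still contains the members of xs other than x, and no x if xs has no
    -- repetitions.

    record Extraction (x : B) (xs : List B) : Set (c Level.⊔ ℓ) where
      field
        others      : List B
        ∈-others    : ∀ {y} → y ∈ xs → y ≢ x → y ∈ others
        others-≢    : Unique xs → ∀ {y} → y ∈ others → y ≢ x
        fold-others : ∀ f → fold (map f xs) ≈ (f x ∙ fold (map f others))

    extract : ∀ {x xs} → x ∈ xs → Extraction x xs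
    extract {x} {_ ∷ xs} (here refl) = record
      { others      = xs
      ; ∈-others    = λ { (here refl) x≢x → contradiction refl x≢x ; (there y∈) _ → y∈ }
      ; others-≢    = λ { (x∉xs ∷ _) y∈ refl → All.lookup x∉xs y∈ refl }
      ; fold-others = λ f → M.refl
      }
    extract {x} {z ∷ xs} (there x∈xs) = record
      { others      = z ∷ others
      ; ∈-others    = λ { (here refl) _ → here refl ; (there y∈) y≢x → there (∈-others y∈ y≢x) }
      ; others-≢    = λ { (z∉xs ∷ _) (here refl) refl → All.lookup z∉xs x∈xs refl
                        ; (_ ∷ xs!) (there y∈) → others-≢ xs! y∈ }
      ; fold-others = λ f → M.trans (M.∙-cong M.refl (fold-others f))
          (M.trans (M.sym (M.assoc (f z) (f x) _))
          (M.trans (M.∙-cong (M.comm (f z) (f x)) M.refl) (M.assoc (f x) (f z) _)))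
      }
      where open Extraction (extract x∈xs)

    -- If all terms but one are trivial, the fold is that term.

    fold-single : ∀ {f : B → A} {x xs} → Unique xs → x ∈ xs → (∀ {y} → y ≢ x → f y ≈ ε) →
      fold (map f xs) ≈ f x
    fold-single {f} xs! x∈xs f≈ε = M.trans (fold-others f)
      (M.trans (M.∙-cong M.refl (fold-ε others (f≈ε ∘ others-≢ xs!))) (M.identityʳ _))
      where open Extraction (extract x∈xs)

------------------------------------------------------------------------
-- Algebraic model counting

-- Algebraic model counting commutes with semiring homomorphisms.

module _ (R : RawSemiring c ℓ) (S : RawSemiring c′ ℓ′) (isS : IsCommutativeSemiringOn S) where
  private
    module R = RawSemiring R
    module S = RawSemiring S
  open Morphisms.SemiringMorphisms R S
  open IsCommutativeSemiring isS using (+-cong; *-cong) renaming (trans to ≈-trans)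

  AMC-homo : ∀ {f} → IsSemiringHomomorphism f → ∀ {α β} →
    (∀ l → f (α l) S.≈ β l) → (T : Formula n) → f (AMC R α T) S.≈ AMC S β T
  AMC-homo {f = f} f-homo {α} {β} fα≈β T = sum (models T)
    where
    open IsSemiringHomomorphism f-homo
    product : ∀ ls → f (BigOps.⨂ R (map α ls)) S.≈ BigOps.⨂ S (map β ls)
    product []       = 1#-homo
    product (l ∷ ls) = ≈-trans (*-homo _ _) (*-cong (fα≈β l) (product ls))
    sum : ∀ Is → f (BigOps.⨁ R (map (λ I → BigOps.⨂ R (map α (literals I))) Is)) S.≈
                 BigOps.⨁ S (map (λ I → BigOps.⨂ S (map β (literals I))) Is)
    sum []       = 0#-homo
    sum (I ∷ Is) = ≈-trans (+-homo _ _) (+-cong (product (literals I)) (sum Is))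

AMC-cong : (R : RawSemiring c ℓ) → IsCommutativeSemiringOn R → ∀ {α β} →
  (∀ l → RawSemiring._≈_ R (α l) (β l)) →
  (T : Formula n) → RawSemiring._≈_ R (AMC R α T) (AMC R β T)
AMC-cong R isR = AMC-homo R R isR
  (semiringHomomorphism R R id id (λ _ _ → ≈-refl) ≈-refl (λ _ _ → ≈-refl) ≈-refl)
  where open IsCommutativeSemiring isR renaming (refl to ≈-refl)

------------------------------------------------------------------------
-- Interpretations and models

∈-interpretations : (I : Interpretation n) → I ∈ interpretations n
∈-interpretations []      = here refl
∈-interpretations (b ∷ I) =
  ∈.∈-cartesianProductWith⁺ _∷_ (∈-bools b) (∈-interpretations I)
  where
  ∈-bools : ∀ b → b ∈ false ∷ true ∷ []
  ∈-bools false = here refl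
  ∈-bools true  = there (here refl)

interpretations-unique : ∀ n → Unique (interpretations n)
interpretations-unique zero    = [] ∷ []
interpretations-unique (suc n) = Unique.cartesianProductWith⁺ _∷_
  Vec.∷-injective (((λ ()) ∷ []) ∷ [] ∷ []) (interpretations-unique n)

lookup-ext : ∀ {A : Set} {I J : Vec A n} → (∀ v → lookup I v ≡ lookup J v) → I ≡ J
lookup-ext {I = I} {J} eq = trans (sym (Vec.tabulate∘lookup I))
  (trans (Vec.tabulate-cong eq) (Vec.tabulate∘lookup J))

-- A list without repetitions lists each of its members at one index.

lookup-injective : ∀ {A : Set} {xs : List A} → Unique xs → ∀ {i j} →
  List.lookup xs i ≡ List.lookup xs j → i ≡ j
lookup-injective (x∉xs ∷ _) {0F}     {0F}     eq = refl
lookup-injective (x∉xs ∷ _) {0F}     {sucF j} eq = contradiction eq (All.lookup x∉xs (∈.∈-lookup j))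
lookup-injective (x∉xs ∷ _) {sucF i} {0F}     eq = contradiction (sym eq) (All.lookup x∉xs (∈.∈-lookup i))
lookup-injective (_ ∷ xs!)  {sucF i} {sucF j} eq = cong sucF (lookup-injective xs! eq)

module _ (T : Formula n) where

  ∈-models⁺ : ∀ {I} → I ⊨ T → I ∈ models T
  ∈-models⁺ {I} = ∈.∈-filter⁺ (λ I → ⟦ T ⟧ I Bool.≟ true) (∈-interpretations I)

  ∈-models⁻ : ∀ {I} → I ∈ models T → I ⊨ T
  ∈-models⁻ = proj₂ ∘ ∈.∈-filter⁻ (λ I → ⟦ T ⟧ I Bool.≟ true) {xs = interpretations n}

  models-unique : Unique (models T)
  models-unique = Unique.filter⁺ (λ I → ⟦ T ⟧ I Bool.≟ true) (interpretations-unique n)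

  Model-≡ : ∀ {M N : Model T} → proj₁ M ≡ proj₁ N → M ≡ N
  Model-≡ {I , p} {.I , q} refl = cong (I ,_) (Decidable⇒UIP.≡-irrelevant Bool._≟_ p q)

  -- The list of models enumerates the models without repetition.

  models↔ : Fin (length (models T)) ↔ Model T
  models↔ = mk↔ₛ′ to from
    (λ (I , p) → Model-≡ (sym (Any.lookup-index (∈-models⁺ p))))
    from∘to
    where
    to : Fin (length (models T)) → Model T
    to i = List.lookup (models T) i , ∈-models⁻ (∈.∈-lookup i)
    from : Model T → Fin (length (models T))
    from (I , p) = Any.index (∈-models⁺ p)
    from∘to : ∀ i → from (to i) ≡ i
    from∘to i = lookup-injective models-unique (sym (Any.lookup-index (∈-models⁺ (proj₂ (to i)))))

------------------------------------------------------------------------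
-- Satisfiability and model counting

SAT-isCommutativeSemiring : IsCommutativeSemiringOn SAT-rawSemiring
SAT-isCommutativeSemiring = Bool.∨-∧-isCommutativeSemiring

-- A property of the labels of both literals of every variable holds of the
-- labels of all literals.

labels-satisfy : ∀ {A : Set} {P : A → Set} (α : Literal n → A) →
  (∀ v → P (α (pos v)) × P (α (neg v))) → ∀ l → P (α l)
labels-satisfy α Pα (pos v) = proj₁ (Pα v)
labels-satisfy α Pα (neg v) = proj₂ (Pα v)

module _ {A : Set} (f : A → Bool) where
  open BigOps SAT-rawSemiring

  -- A finite disjunction is true exactly if one of its members is.

  ⋁-true⁺ : ∀ {x xs} → x ∈ xs → f x ≡ true → ⨁ (map f xs) ≡ true
  ⋁-true⁺ {xs = _ ∷ xs} (here refl) fx = cong (_∨ ⨁ (map f xs)) fx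
  ⋁-true⁺ (there {y} x∈xs) fx = trans (cong (f y ∨_) (⋁-true⁺ x∈xs fx)) (Bool.∨-zeroʳ (f y))

  ⋁-true⁻ : ∀ xs → ⨁ (map f xs) ≡ true → ∃ λ x → x ∈ xs × f x ≡ true
  ⋁-true⁻ (x ∷ xs) eq with f x in fx
  ... | true  = x , here refl , fx
  ... | false = let y , y∈xs , fy = ⋁-true⁻ xs eq in y , there y∈xs , fy

SAT-correct : (T : Formula n) (α : Literal n → Bool) → (∀ v → α (pos v) ≡ true × α (neg v) ≡ true) →
  AMC SAT-rawSemiring α T ≡ true ⇔ Model T
SAT-correct T α α≡true = mk⇔
  (λ eq → let I , I∈ , _ = ⋁-true⁻ weight (models T) eq in I , ∈-models⁻ T I∈)
  (λ (I , I⊨T) → ⋁-true⁺ weight (∈-models⁺ T I⊨T)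
    (fold-ε (literals I) λ {l} _ → labels-satisfy {P = _≡ true} α α≡true l))
  where
  open Fold (IsCommutativeSemiring.*-isCommutativeMonoid SAT-isCommutativeSemiring)
  weight : Interpretation _ → Bool
  weight I = BigOps.⨂ SAT-rawSemiring (map α (literals I))

#SAT-correct : (T : Formula n) (α : Literal n → ℕ) → (∀ v → α (pos v) ≡ 1 × α (neg v) ≡ 1) →
  Fin (AMC #SAT-rawSemiring α T) ↔ Model T
#SAT-correct T α α≡1 = subst (λ k → Fin k ↔ Model T) (sym (count (models T))) (models↔ T)
  where
  open Fold (IsCommutativeSemiring.*-isCommutativeMonoid ℕ.+-*-isCommutativeSemiring)
  count : ∀ Is → BigOps.⨁ #SAT-rawSemiring
    (map (λ I → BigOps.⨂ #SAT-rawSemiring (map α (literals I))) Is) ≡ length Is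
  count []       = refl
  count (I ∷ Is) = cong₂ ℕ._+_
    (fold-ε (literals I) λ {l} _ → labels-satisfy {P = _≡ 1} α α≡1 l)
    (count Is)

------------------------------------------------------------------------
-- The ordered field operations on the reals

abstract

  -- Reals with equal approximating sequences are equal; identities between
  -- reals thus reduce to identities between rationals.

  pointwise : ∀ {x y} → (∀ i → seq x i ≡ seq y i) → x ≈ℝ y
  pointwise {x} {y} eq = mk≈ λ ε 0<ε → 0 , λ i _ →
    subst (λ q → ∣ seq x i ℚ.- q ∣ ℚ.≤ ε) (eq i)
      (subst (ℚ._≤ ε) (sym (cong ∣_∣ (ℚ.+-inverseʳ (seq x i)))) (ℚ.<⇒≤ 0<ε))

  ≤ℝ-refl : ∀ {x} → x ≤ℝ x
  ≤ℝ-refl {x} = BoundLemmas.≤ℝ-refl x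

  ≤ℝ-trans : ∀ {x y z} → x ≤ℝ y → y ≤ℝ z → x ≤ℝ z
  ≤ℝ-trans {x} {y} {z} = BoundLemmas.≤ℝ-trans x y z

  ≤ℝ-antisym : ∀ {x y} → x ≤ℝ y → y ≤ℝ x → x ≈ℝ y
  ≤ℝ-antisym {x} {y} x≤y y≤x = mk≈ λ ε 0<ε →
    let M , p = below x≤y ε 0<ε
        N , q = below y≤x ε 0<ε
    in M ℕ.⊔ N , λ i h → RealLemmas.≤⇒∣-∣ (seq x i) (seq y i) ε
         (p i (ℕ.m⊔n≤o⇒m≤o M N h)) (q i (ℕ.m⊔n≤o⇒n≤o M N h))

  ≈⇒≤ : ∀ {x y} → x ≈ℝ y → x ≤ℝ y
  ≈⇒≤ {x} {y} x≈y = mk≤ λ ε 0<ε →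
    let N , p = close x≈y ε 0<ε
    in N , λ i N≤i → RealLemmas.∣-∣⇒≤ (seq x i) (seq y i) ε (p i N≤i)

  ≈ℝ-refl : ∀ {x} → x ≈ℝ x
  ≈ℝ-refl = pointwise λ _ → refl

  ∣-∣-sym : ∀ p q → ∣ p ℚ.- q ∣ ≡ ∣ q ℚ.- p ∣
  ∣-∣-sym p q = trans (sym (ℚ.∣-p∣≡∣p∣ (p ℚ.- q)))
    (cong ∣_∣ (solve 2 (λ p q → :- (p :- q) := q :- p) refl p q))

  ≈ℝ-sym : ∀ {x y} → x ≈ℝ y → y ≈ℝ x
  ≈ℝ-sym {x} {y} x≈y = mk≈ λ ε 0<ε →
    let N , p = close x≈y ε 0<ε
    in N , λ i N≤i → subst (ℚ._≤ ε) (∣-∣-sym (seq x i) (seq y i)) (p i N≤i)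

  ≈ℝ-trans : ∀ {x y z} → x ≈ℝ y → y ≈ℝ z → x ≈ℝ z
  ≈ℝ-trans x≈y y≈z = ≤ℝ-antisym (≤ℝ-trans (≈⇒≤ x≈y) (≈⇒≤ y≈z))
    (≤ℝ-trans (≈⇒≤ (≈ℝ-sym y≈z)) (≈⇒≤ (≈ℝ-sym x≈y)))

  ≈ℝ-isEquivalence : IsEquivalence _≈ℝ_
  ≈ℝ-isEquivalence = record { refl = ≈ℝ-refl ; sym = ≈ℝ-sym ; trans = ≈ℝ-trans }

ℝ-setoid : Setoid 0ℓ 0ℓ
ℝ-setoid = record { isEquivalence = ≈ℝ-isEquivalence }

abstract
  ≥⇐≈ : ∀ {x y} → x ≈ℝ y → y ≤ℝ x
  ≥⇐≈ = ≈⇒≤ ∘ ≈ℝ-sym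

  +ℝ-mono-≤ : ∀ {x x′ y y′} → x ≤ℝ x′ → y ≤ℝ y′ → x +ℝ y ≤ℝ x′ +ℝ y′
  +ℝ-mono-≤ {x} {x′} {y} {y′} x≤x′ y≤y′ = mk≤ λ ε 0<ε →
    let M , p = below x≤x′ _ (RealLemmas.0<½* 0<ε)
        N , q = below y≤y′ _ (RealLemmas.0<½* 0<ε)
    in M ℕ.⊔ N , λ i h → ℚ.≤-trans
         (ℚ.+-mono-≤ (p i (ℕ.m⊔n≤o⇒m≤o M N h)) (q i (ℕ.m⊔n≤o⇒n≤o M N h)))
         (ℚ.≤-reflexive (RealLemmas.split-+ (seq x′ i) (seq y′ i) ε))

  +ℝ-cong : ∀ {x x′ y y′} → x ≈ℝ x′ → y ≈ℝ y′ → x +ℝ y ≈ℝ x′ +ℝ y′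
  +ℝ-cong p q = ≤ℝ-antisym (+ℝ-mono-≤ (≈⇒≤ p) (≈⇒≤ q)) (+ℝ-mono-≤ (≥⇐≈ p) (≥⇐≈ q))

  -ℝ-cong : ∀ {x y} → x ≈ℝ y → -ℝ x ≈ℝ -ℝ y
  -ℝ-cong {x} {y} x≈y = mk≈ λ ε 0<ε →
    let N , p = close (≈ℝ-sym x≈y) ε 0<ε
    in N , λ i N≤i → subst (ℚ._≤ ε)
         (cong ∣_∣ (solve 2 (λ a b → b :- a := (:- a) :- (:- b)) refl (seq x i) (seq y i)))
         (p i N≤i)

  -- If the terms of z are eventually bounded by C, it suffices that those of x
  -- and y differ by at most ε / C.

  *ℝ-congʳ : ∀ {x y z} → x ≈ℝ y → x *ℝ z ≈ℝ y *ℝ z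
  *ℝ-congʳ {x} {y} {z} x≈y = mk≈ λ ε 0<ε →
    let C , 0<C , M , p = RealLemmas.bounded (seq z) (cauchy z)
        δ , 0<δ , δC≡ε  = RealLemmas.quotient ε C 0<ε 0<C
        N , q           = close x≈y δ 0<δ
    in M ℕ.⊔ N , λ i h → begin
         ∣ seq x i ℚ.* seq z i ℚ.- seq y i ℚ.* seq z i ∣
           ≡⟨ cong ∣_∣ (solve 3 (λ a b c → a :* c :- b :* c := (a :- b) :* c) refl (seq x i) (seq y i) (seq z i)) ⟩
         ∣ (seq x i ℚ.- seq y i) ℚ.* seq z i ∣
           ≡⟨ ℚ.∣p*q∣≡∣p∣*∣q∣ (seq x i ℚ.- seq y i) (seq z i) ⟩
         ∣ seq x i ℚ.- seq y i ∣ ℚ.* ∣ seq z i ∣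
           ≤⟨ RealLemmas.*-mono-≤ (ℚ.0≤∣p∣ (seq x i ℚ.- seq y i)) (ℚ.<⇒≤ 0<C)
                (q i (ℕ.m⊔n≤o⇒n≤o M N h)) (p i (ℕ.m⊔n≤o⇒m≤o M N h)) ⟩
         δ ℚ.* C
           ≡⟨ δC≡ε ⟩
         ε ∎
    where open ℚ.≤-Reasoning

  *ℝ-comm : ∀ x y → x *ℝ y ≈ℝ y *ℝ x
  *ℝ-comm x y = pointwise λ i → ℚ.*-comm (seq x i) (seq y i)

  *ℝ-congˡ : ∀ {x y z} → y ≈ℝ z → x *ℝ y ≈ℝ x *ℝ z
  *ℝ-congˡ {x} {y} {z} y≈z =
    ≈ℝ-trans (*ℝ-comm x y) (≈ℝ-trans (*ℝ-congʳ y≈z) (*ℝ-comm z x))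

  *ℝ-cong : ∀ {x x′ y y′} → x ≈ℝ x′ → y ≈ℝ y′ → x *ℝ y ≈ℝ x′ *ℝ y′
  *ℝ-cong p q = ≈ℝ-trans (*ℝ-congʳ p) (*ℝ-congˡ q)

  ℝ-isCommutativeSemiring : IsCommutativeSemiringOn ℝ-rawSemiring
  ℝ-isCommutativeSemiring = commutativeSemiring ℝ-rawSemiring ≈ℝ-isEquivalence
    +ℝ-cong
    (λ x y z → pointwise λ i → ℚ.+-assoc (seq x i) (seq y i) (seq z i))
    (λ x y → pointwise λ i → ℚ.+-comm (seq x i) (seq y i))
    (λ x → pointwise λ i → ℚ.+-identityˡ (seq x i))
    *ℝ-cong
    (λ x y z → pointwise λ i → ℚ.*-assoc (seq x i) (seq y i) (seq z i))
    *ℝ-comm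
    (λ x → pointwise λ i → ℚ.*-identityˡ (seq x i))
    (λ x y z → pointwise λ i → ℚ.*-distribʳ-+ (seq x i) (seq y i) (seq z i))
    (λ x → pointwise λ i → ℚ.*-zeroˡ (seq x i))

-- x < y means that a positive rational eventually separates the sequences.

_<ℝ_ : Rel ℝ 0ℓ
x <ℝ y = ∃ λ ε → 0ℚ ℚ.< ε × ∃ λ N → ∀ i → N ℕ.≤ i → seq x i ℚ.+ ε ℚ.≤ seq y i

abstract
  p<p+ε : ∀ p {ε} → 0ℚ ℚ.< ε → p ℚ.< p ℚ.+ ε
  p<p+ε p {ε} 0<ε = subst (ℚ._< p ℚ.+ ε) (ℚ.+-identityʳ p) (ℚ.+-monoʳ-< p 0<ε)

  <⇒≱ : ∀ {x y} → x <ℝ y → ¬ (y ≤ℝ x)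
  <⇒≱ {x} {y} (ε , 0<ε , M , p) y≤x with below y≤x (½ ℚ.* ε) (RealLemmas.0<½* 0<ε)
  ... | N , q = ℚ.<-irrefl refl (begin-strict
      seq y i                                ≤⟨ q i (ℕ.m≤n⊔m M N) ⟩
      seq x i ℚ.+ ½ ℚ.* ε                    <⟨ p<p+ε _ (RealLemmas.0<½* 0<ε) ⟩
      (seq x i ℚ.+ ½ ℚ.* ε) ℚ.+ ½ ℚ.* ε      ≡⟨ ℚ.+-assoc (seq x i) _ _ ⟩
      seq x i ℚ.+ (½ ℚ.* ε ℚ.+ ½ ℚ.* ε)      ≡⟨ cong (seq x i ℚ.+_) (RealLemmas.halves ε) ⟩
      seq x i ℚ.+ ε                          ≤⟨ p i (ℕ.m≤m⊔n M N) ⟩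
      seq y i                                ∎)
    where
    open ℚ.≤-Reasoning
    i : ℕ
    i = M ℕ.⊔ N

  <⇒≤ : ∀ {x y} → x <ℝ y → x ≤ℝ y
  <⇒≤ {x} {y} (ε , 0<ε , N , p) = mk≤ λ δ 0<δ → N , λ i N≤i →
    ℚ.≤-trans (RealLemmas.p≤p+ε (seq x i) 0<ε)
      (ℚ.≤-trans (p i N≤i) (RealLemmas.p≤p+ε (seq y i) 0<δ))

  -- Both sequences vary by at most η = ε/8 beyond some index K, so the order of
  -- x and y up to ε is decided by comparing their terms of index K.

  ≮⇒≥ : ∀ {x y} → ¬ (x <ℝ y) → y ≤ℝ x
  ≮⇒≥ {x} {y} x≮y = mk≤ λ ε 0<ε → main ε 0<ε
    (RealLemmas.fromCauchy (seq x) (cauchy x) _ (0<η 0<ε))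
    (RealLemmas.fromCauchy (seq y) (cauchy y) _ (0<η 0<ε))
    where
    open ℚ.≤-Reasoning
    eighth : ℚ → ℚ
    eighth ε = ½ ℚ.* (½ ℚ.* (½ ℚ.* ε))
    0<η : ∀ {ε} → 0ℚ ℚ.< ε → 0ℚ ℚ.< eighth ε
    0<η 0<ε = RealLemmas.0<½* (RealLemmas.0<½* (RealLemmas.0<½* 0<ε))
    main : ∀ ε → 0ℚ ℚ.< ε →
      (∃ λ N → ∀ i j → N ℕ.≤ i → N ℕ.≤ j → seq x i ℚ.≤ seq x j ℚ.+ eighth ε) →
      (∃ λ N → ∀ i j → N ℕ.≤ i → N ℕ.≤ j → seq y i ℚ.≤ seq y j ℚ.+ eighth ε) →
      ∃ λ N → ∀ i → N ℕ.≤ i → seq y i ℚ.≤ seq x i ℚ.+ ε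
    main ε 0<ε (M , p) (N , q) = compare (seq y K ℚ.≤? seq x K ℚ.+ 4η)
      where
      K : ℕ
      K = M ℕ.⊔ N
      η 2η 4η : ℚ
      η  = eighth ε
      2η = η ℚ.+ η
      4η = ½ ℚ.* ε
      M≤ : ∀ {i} → K ℕ.≤ i → M ℕ.≤ i
      M≤ = ℕ.m⊔n≤o⇒m≤o M N
      N≤ : ∀ {i} → K ℕ.≤ i → N ℕ.≤ i
      N≤ = ℕ.m⊔n≤o⇒n≤o M N
      4η≡ : 2η ℚ.+ 2η ≡ 4η
      4η≡ = trans (cong₂ ℚ._+_ (RealLemmas.halves (½ ℚ.* (½ ℚ.* ε)))
                         (RealLemmas.halves (½ ℚ.* (½ ℚ.* ε))))
                  (RealLemmas.halves (½ ℚ.* ε))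
      8η≡ : (2η ℚ.+ 2η) ℚ.+ (2η ℚ.+ 2η) ≡ ε
      8η≡ = trans (cong₂ ℚ._+_ 4η≡ 4η≡) (RealLemmas.halves ε)
      compare : Dec (seq y K ℚ.≤ seq x K ℚ.+ 4η) → ∃ λ N → ∀ i → N ℕ.≤ i → seq y i ℚ.≤ seq x i ℚ.+ ε
      compare (yes h) = K , λ i K≤i → begin
        seq y i
          ≤⟨ q i K (N≤ K≤i) (N≤ ℕ.≤-refl) ⟩
        seq y K ℚ.+ η
          ≤⟨ ℚ.+-monoˡ-≤ η h ⟩
        (seq x K ℚ.+ 4η) ℚ.+ η
          ≤⟨ ℚ.+-monoˡ-≤ η (ℚ.+-monoˡ-≤ 4η (p K i (M≤ ℕ.≤-refl) (M≤ K≤i))) ⟩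
        ((seq x i ℚ.+ η) ℚ.+ 4η) ℚ.+ η
          ≤⟨ ℚ.≤-trans (RealLemmas.p≤p+ε _ (0<η 0<ε)) (RealLemmas.p≤p+ε _ (0<η 0<ε)) ⟩
        ((((seq x i ℚ.+ η) ℚ.+ 4η) ℚ.+ η) ℚ.+ η) ℚ.+ η
          ≡⟨ solve 3 (λ a h f → ((((a :+ h) :+ f) :+ h) :+ h) :+ h := a :+ (((h :+ h) :+ (h :+ h)) :+ f)) refl (seq x i) η 4η ⟩
        seq x i ℚ.+ ((2η ℚ.+ 2η) ℚ.+ 4η)
          ≡⟨ cong (seq x i ℚ.+_) (trans (cong ((2η ℚ.+ 2η) ℚ.+_) (sym 4η≡)) 8η≡) ⟩
        seq x i ℚ.+ ε ∎
      compare (no h) = contradiction (2η , ℚ.+-mono-< (0<η 0<ε) (0<η 0<ε) , K , λ i K≤i → begin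
        seq x i ℚ.+ 2η
          ≤⟨ ℚ.+-monoˡ-≤ 2η (p i K (M≤ K≤i) (M≤ ℕ.≤-refl)) ⟩
        (seq x K ℚ.+ η) ℚ.+ 2η
          ≡⟨ solve 2 (λ a h → (a :+ h) :+ (h :+ h) := (a :+ ((h :+ h) :+ (h :+ h))) :- h) refl (seq x K) η ⟩
        (seq x K ℚ.+ (2η ℚ.+ 2η)) ℚ.- η
          ≡⟨ cong (λ r → (seq x K ℚ.+ r) ℚ.- η) 4η≡ ⟩
        (seq x K ℚ.+ 4η) ℚ.- η
          ≤⟨ ℚ.+-monoˡ-≤ (ℚ.- η) (ℚ.<⇒≤ (ℚ.≰⇒> h)) ⟩
        seq y K ℚ.- η
          ≤⟨ ℚ.+-monoˡ-≤ (ℚ.- η) (q K i (N≤ ℕ.≤-refl) (N≤ K≤i)) ⟩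
        (seq y i ℚ.+ η) ℚ.- η
          ≡⟨ solve 2 (λ a h → (a :+ h) :- h := a) refl (seq y i) η ⟩
        seq y i ∎) x≮y

  ≤ℝ-stable : ∀ {x y} → ¬ ¬ (x ≤ℝ y) → x ≤ℝ y
  ≤ℝ-stable ¬¬x≤y = ≮⇒≥ λ y<x → ¬¬x≤y (<⇒≱ y<x)

  ≈ℝ-stable : ∀ {x y} → ¬ ¬ (x ≈ℝ y) → x ≈ℝ y
  ≈ℝ-stable ¬¬x≈y = ≤ℝ-antisym (≤ℝ-stable (¬¬-map ≈⇒≤ ¬¬x≈y)) (≤ℝ-stable (¬¬-map ≥⇐≈ ¬¬x≈y))

  -- The order is total under a double negation.

  ≤ℝ-total : ∀ x y → ¬ ¬ (x ≤ℝ y ⊎ y ≤ℝ x)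
  ≤ℝ-total x y k = k (inj₂ (≮⇒≥ λ x<y → k (inj₁ (<⇒≤ x<y))))

  x≤x⊔y : ∀ x y → x ≤ℝ x ⊔ℝ y
  x≤x⊔y = BoundLemmas.x≤x⊔y

  ⊔ℝ-comm : ∀ x y → x ⊔ℝ y ≈ℝ y ⊔ℝ x
  ⊔ℝ-comm x y = pointwise λ i → ℚ.⊔-comm (seq x i) (seq y i)

  ⊓ℝ-comm : ∀ x y → x ⊓ℝ y ≈ℝ y ⊓ℝ x
  ⊓ℝ-comm x y = pointwise λ i → ℚ.⊓-comm (seq x i) (seq y i)

  y≤x⊔y : ∀ x y → y ≤ℝ x ⊔ℝ y
  y≤x⊔y x y = ≤ℝ-trans (x≤x⊔y y x) (≈⇒≤ (⊔ℝ-comm y x))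

  x⊓y≤x : ∀ x y → x ⊓ℝ y ≤ℝ x
  x⊓y≤x = BoundLemmas.x⊓y≤x

  x⊓y≤y : ∀ x y → x ⊓ℝ y ≤ℝ y
  x⊓y≤y x y = ≤ℝ-trans (≈⇒≤ (⊓ℝ-comm x y)) (x⊓y≤x y x)

  ⊔-least : ∀ {x y z} → x ≤ℝ z → y ≤ℝ z → x ⊔ℝ y ≤ℝ z
  ⊔-least {x} {y} {z} = BoundLemmas.⊔-least x y z

  ⊓-greatest : ∀ {x y z} → z ≤ℝ x → z ≤ℝ y → z ≤ℝ x ⊓ℝ y
  ⊓-greatest {x} {y} {z} = BoundLemmas.⊓-greatest x y z

  ⊔ℝ-cong : ∀ {x x′ y y′} → x ≈ℝ x′ → y ≈ℝ y′ → x ⊔ℝ y ≈ℝ x′ ⊔ℝ y′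
  ⊔ℝ-cong p q = ≤ℝ-antisym (mono (≈⇒≤ p) (≈⇒≤ q)) (mono (≥⇐≈ p) (≥⇐≈ q))
    where
    mono : ∀ {x x′ y y′} → x ≤ℝ x′ → y ≤ℝ y′ → x ⊔ℝ y ≤ℝ x′ ⊔ℝ y′
    mono p q = ⊔-least (≤ℝ-trans p (x≤x⊔y _ _)) (≤ℝ-trans q (y≤x⊔y _ _))

  ⊓ℝ-cong : ∀ {x x′ y y′} → x ≈ℝ x′ → y ≈ℝ y′ → x ⊓ℝ y ≈ℝ x′ ⊓ℝ y′
  ⊓ℝ-cong p q = ≤ℝ-antisym (mono (≈⇒≤ p) (≈⇒≤ q)) (mono (≥⇐≈ p) (≥⇐≈ q))
    where
    mono : ∀ {x x′ y y′} → x ≤ℝ x′ → y ≤ℝ y′ → x ⊓ℝ y ≤ℝ x′ ⊓ℝ y′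
    mono p q = ⊓-greatest (≤ℝ-trans (x⊓y≤x _ _) p) (≤ℝ-trans (x⊓y≤y _ _) q)

  x≤y⇒x⊔y≈y : ∀ {x y} → x ≤ℝ y → x ⊔ℝ y ≈ℝ y
  x≤y⇒x⊔y≈y x≤y = ≤ℝ-antisym (⊔-least x≤y ≤ℝ-refl) (y≤x⊔y _ _)

  y≤x⇒x⊔y≈x : ∀ {x y} → y ≤ℝ x → x ⊔ℝ y ≈ℝ x
  y≤x⇒x⊔y≈x y≤x = ≤ℝ-antisym (⊔-least ≤ℝ-refl y≤x) (x≤x⊔y _ _)

  x≤y⇒x⊓y≈x : ∀ {x y} → x ≤ℝ y → x ⊓ℝ y ≈ℝ x
  x≤y⇒x⊓y≈x x≤y = ≤ℝ-antisym (x⊓y≤x _ _) (⊓-greatest ≤ℝ-refl x≤y)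

  y≤x⇒x⊓y≈y : ∀ {x y} → y ≤ℝ x → x ⊓ℝ y ≈ℝ y
  y≤x⇒x⊓y≈y y≤x = ≤ℝ-antisym (x⊓y≤y _ _) (⊓-greatest y≤x ≤ℝ-refl)

  x≤y⇒0≤y-x : ∀ {x y} → x ≤ℝ y → 0ℝ ≤ℝ y -ℝ x
  x≤y⇒0≤y-x {x} x≤y = ≤ℝ-trans
    (≈⇒≤ (pointwise λ i → sym (ℚ.+-inverseʳ (seq x i)))) (+ℝ-mono-≤ x≤y (≤ℝ-refl { -ℝ x}))

  -- x y ≤ x y + x (z - y) = x z

  *ℝ-monoˡ-≤ : ∀ {x y z} → 0ℝ ≤ℝ x → y ≤ℝ z → x *ℝ y ≤ℝ x *ℝ z
  *ℝ-monoˡ-≤ {x} {y} {z} 0≤x y≤z = ≤ℝ-trans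
    (≈⇒≤ (pointwise λ i → sym (ℚ.+-identityʳ (seq x i ℚ.* seq y i))))
    (≤ℝ-trans (+ℝ-mono-≤ (≤ℝ-refl {x *ℝ y}) (BoundLemmas.*-nonNegative x (z -ℝ y) 0≤x (x≤y⇒0≤y-x y≤z)))
    (≈⇒≤ (pointwise λ i → solve 3 (λ a b c → a :* b :+ a :* (c :- b) := a :* c)
                            refl (seq x i) (seq y i) (seq z i))))

  0≉1 : ¬ (0ℝ ≈ℝ 1ℝ)
  0≉1 0≈1 = <⇒≱ {0ℝ} {1ℝ} (1ℚ , RealLemmas.0<1 , 0 , λ _ _ → ℚ.≤-refl) (≥⇐≈ 0≈1)

¬¬-bind : ∀ {A B : Set} → ¬ ¬ A → (A → ¬ ¬ B) → ¬ ¬ B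
¬¬-bind ¬¬a f ¬b = ¬¬a λ a → f a ¬b

no-models : (T : Formula n) → ¬ Model T → models T ≡ []
no-models {n} T ¬model = List.filter-none (λ I → ⟦ T ⟧ I Bool.≟ true)
  (All.universal (λ I I⊨T → ¬model (I , I⊨T)) (interpretations n))

-- The variables true in an interpretation, in increasing order.

trueVariables : Interpretation n → List (Fin n)
trueVariables {n} I = filter (λ v → lookup I v Bool.≟ true) (allFin n)

∈-trueVariables⁺ : (I : Interpretation n) → ∀ {v} → lookup I v ≡ true → v ∈ trueVariables I
∈-trueVariables⁺ I = ∈.∈-filter⁺ (λ v → lookup I v Bool.≟ true) (∈.∈-allFin _)

∈-trueVariables⁻ : (I : Interpretation n) → ∀ {v} → v ∈ trueVariables I → lookup I v ≡ true
∈-trueVariables⁻ {n} I = proj₂ ∘ ∈.∈-filter⁻ (λ v → lookup I v Bool.≟ true) {xs = allFin n}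

module _ (R : RawSemiring c ℓ) (isR : IsCommutativeSemiringOn R) where
  open RawSemiring R
  open BigOps R
  private module R = IsCommutativeSemiring isR

  -- If negative literals have label 1, only the true variables contribute.

  ⨂-literals : ∀ {α : Literal n → Carrier} → (∀ v → α (neg v) ≈ 1#) → ∀ I →
    ⨂ (map α (literals I)) ≈ ⨂ (map (α ∘ pos) (trueVariables I))
  ⨂-literals {n} {α} α¬≈1 I = go (allFin n)
    where
    go : ∀ vs → ⨂ (map α (map (literal I) vs)) ≈
                ⨂ (map (α ∘ pos) (filter (λ v → lookup I v Bool.≟ true) vs))
    go []       = R.refl
    go (v ∷ vs) with lookup I v
    ... | true  = R.*-cong R.refl (go vs)
    ... | false = R.trans (R.*-cong (α¬≈1 v) (go vs)) (R.*-identityˡ _)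

------------------------------------------------------------------------
-- Greatest and least elements of finite families

-- x ∙ y is an upper bound of x and y with respect to _≤_ and, under a double
-- negation, equal to one of them; ε is neutral.  For a minimum, _≤_ is the
-- reversed order.

record IsSelection {A : Set} (_≈_ _≤_ : Rel A 0ℓ) (_∙_ : Op₂ A) (ε : A) : Set where
  field
    ≈-trans   : ∀ {x y z} → x ≈ y → y ≈ z → x ≈ z
    ≤-trans   : ∀ {x y z} → x ≤ y → y ≤ z → x ≤ z
    x≤x∙y     : ∀ x y → x ≤ (x ∙ y)
    y≤x∙y     : ∀ x y → y ≤ (x ∙ y)
    identityʳ : ∀ x → (x ∙ ε) ≈ x
    selective : ∀ x y → ¬ ¬ ((x ∙ y) ≈ x ⊎ (x ∙ y) ≈ y)

  module _ {I : Set} (f : I → A) where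

    bound : ∀ {i is} → i ∈ is → f i ≤ foldr _∙_ ε (map f is)
    bound (here refl)  = x≤x∙y _ _
    bound (there i∈is) = ≤-trans (bound i∈is) (y≤x∙y _ _)

    attained : ∀ {i is} → i ∈ is → ¬ ¬ ∃ λ j → j ∈ is × foldr _∙_ ε (map f is) ≈ f j
    attained {is = j ∷ []}     _ k = k (j , here refl , identityʳ (f j))
    attained {is = j ∷ k ∷ is} _ = ¬¬-bind (selective _ _) Sum.[
      (λ ≈j none → none (j , here refl , ≈j)) ,
      (λ ≈tail → ¬¬-map (λ (i , i∈ , ≈i) → i , there i∈ , ≈-trans ≈tail ≈i)
        (attained {is = k ∷ is} (here refl))) ]

-- With decidable equality the double negation can be removed.

module DecSelection {A : Set} {_≤_ : Rel A 0ℓ} {_∙_ : Op₂ A} {ε : A}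
  (_≟_ : DecidableEquality A) (selection : IsSelection _≡_ _≤_ _∙_ ε) where
  open IsSelection selection public using (bound)

  attained : ∀ {I : Set} (f : I → A) {i is} → i ∈ is → ∃ λ j → j ∈ is × foldr _∙_ ε (map f is) ≡ f j
  attained f {is = is} i∈is = find (decidable-stable (Any.any? (λ j → _ ≟ f j) is)
    (¬¬-map (λ (j , j∈is , eq) → lose j∈is eq) (IsSelection.attained selection f i∈is)))

------------------------------------------------------------------------
-- Weighted model counting and probabilistic inference

module _ where
  open Morphisms.SemiringMorphisms WMC-rawSemiring ℝ-rawSemiring

  ⌊⌋-isSemiringHomomorphism : IsSemiringHomomorphism ⌊_⌋
  ⌊⌋-isSemiringHomomorphism = semiringHomomorphism WMC-rawSemiring ℝ-rawSemiring ⌊_⌋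
    id (λ _ _ → ≈ℝ-refl) ≈ℝ-refl (λ _ _ → ≈ℝ-refl) ≈ℝ-refl

  WMC-isCommutativeSemiring : IsCommutativeSemiringOn WMC-rawSemiring
  WMC-isCommutativeSemiring = isCommutativeSemiring-transport WMC-rawSemiring ℝ-rawSemiring
    {⌊_⌋} record { isSemiringHomomorphism = ⌊⌋-isSemiringHomomorphism ; injective = id }
    ℝ-isCommutativeSemiring

WMC-correct : (T : Formula n) (α : Literal n → ℝ≥0) →
  ⌊ AMC WMC-rawSemiring α T ⌋ ≈ℝ weightedCount (⌊_⌋ ∘ α) T
WMC-correct T α = AMC-homo WMC-rawSemiring ℝ-rawSemiring ℝ-isCommutativeSemiring
  ⌊⌋-isSemiringHomomorphism {α} (λ _ → ≈ℝ-refl) T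

module _ {w : Literal n → ℝ} {p : Fin n → ℝ}
  (w≈p : ∀ v → w (pos v) ≈ℝ p v × w (neg v) ≈ℝ 1ℝ -ℝ p v) where

  ∏≈mass : ∀ I → ∏ℝ (map w (literals I)) ≈ℝ mass p I
  ∏≈mass I = go (allFin n)
    where
    go : ∀ vs → ∏ℝ (map w (map (literal I) vs)) ≈ℝ
                ∏ℝ (map (λ v → if lookup I v then p v else 1ℝ -ℝ p v) vs)
    go []       = ≈ℝ-refl
    go (v ∷ vs) with lookup I v
    ... | true  = *ℝ-cong (proj₁ (w≈p v)) (go vs)
    ... | false = *ℝ-cong (proj₂ (w≈p v)) (go vs)

  -- Summing over the models is summing over all interpretations with weight 0
  -- for the others.

  weightedCount≈probability : ∀ T → weightedCount w T ≈ℝ probability p T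
  weightedCount≈probability T = go (interpretations n)
    where
    go : ∀ Is → ∑ℝ (map (λ I → ∏ℝ (map w (literals I))) (filter (λ I → ⟦ T ⟧ I Bool.≟ true) Is)) ≈ℝ
                ∑ℝ (map (λ I → if ⟦ T ⟧ I then mass p I else 0ℝ) Is)
    go []       = ≈ℝ-refl
    go (I ∷ Is) with ⟦ T ⟧ I
    ... | true  = +ℝ-cong (∏≈mass I) (go Is)
    ... | false = ≈ℝ-trans (go Is) (≈ℝ-sym (IsCommutativeSemiring.+-identityˡ ℝ-isCommutativeSemiring _))

module _ (p : Fin n → UnitInterval) (α : Literal n → ℝ≥0)
  (α≈p : ∀ v → α (pos v) ≈ℝ≥0 toℝ≥0 (p v) × α (neg v) ≈ℝ≥0 toℝ≥0 (1-ᵘ p v)) (T : Formula n) where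

  PROB-correct : ⌊ AMC WMC-rawSemiring α T ⌋ ≈ℝ probability (⌊_⌋ᵘ ∘ p) T
  PROB-correct = ≈ℝ-trans (WMC-correct T α) (weightedCount≈probability {w = ⌊_⌋ ∘ α} α≈p T)

------------------------------------------------------------------------
-- Most probable states

⊔ℝ-selective : ∀ x y → ¬ ¬ (x ⊔ℝ y ≈ℝ x ⊎ x ⊔ℝ y ≈ℝ y)
⊔ℝ-selective x y = ¬¬-map (Sum.swap ∘ Sum.map x≤y⇒x⊔y≈y y≤x⇒x⊔y≈x) (≤ℝ-total x y)

⊓ℝ-selective : ∀ x y → ¬ ¬ (x ⊓ℝ y ≈ℝ x ⊎ x ⊓ℝ y ≈ℝ y)
⊓ℝ-selective x y = ¬¬-map (Sum.map x≤y⇒x⊓y≈x y≤x⇒x⊓y≈y) (≤ℝ-total x y)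

-- Stability of equality allows comparing y and z.

*ℝ-distribˡ-⊔ : ∀ {x} y z → 0ℝ ≤ℝ x → x *ℝ (y ⊔ℝ z) ≈ℝ x *ℝ y ⊔ℝ x *ℝ z
*ℝ-distribˡ-⊔ {x} y z 0≤x = ≈ℝ-stable (¬¬-map by-cases (≤ℝ-total y z))
  where
  by-cases : y ≤ℝ z ⊎ z ≤ℝ y → x *ℝ (y ⊔ℝ z) ≈ℝ x *ℝ y ⊔ℝ x *ℝ z
  by-cases (inj₁ y≤z) = ≈ℝ-trans (*ℝ-congˡ (x≤y⇒x⊔y≈y y≤z))
    (≈ℝ-sym (x≤y⇒x⊔y≈y (*ℝ-monoˡ-≤ 0≤x y≤z)))
  by-cases (inj₂ z≤y) = ≈ℝ-trans (*ℝ-congˡ (y≤x⇒x⊔y≈x z≤y))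
    (≈ℝ-sym (y≤x⇒x⊔y≈x (*ℝ-monoˡ-≤ 0≤x z≤y)))

MPE-isCommutativeSemiring : IsCommutativeSemiringOn MPE-rawSemiring
MPE-isCommutativeSemiring = commutativeSemiring MPE-rawSemiring
  (On.isEquivalence ⌊_⌋ ≈ℝ-isEquivalence)
  ⊔ℝ-cong
  (λ x y z → pointwise λ i → ℚ.⊔-assoc (seq ⌊ x ⌋ i) (seq ⌊ y ⌋ i) (seq ⌊ z ⌋ i))
  (λ x y → ⊔ℝ-comm ⌊ x ⌋ ⌊ y ⌋)
  (λ x → x≤y⇒x⊔y≈y (ℝ≥0.nonNegative x))
  (λ {x} {y} {u} {v} → *.*-cong {x} {y} {u} {v}) *.*-assoc *.*-comm *.*-identityˡ
  (λ x y z → ≈ℝ-trans (*ℝ-comm (⌊ y ⌋ ⊔ℝ ⌊ z ⌋) ⌊ x ⌋)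
    (≈ℝ-trans (*ℝ-distribˡ-⊔ ⌊ y ⌋ ⌊ z ⌋ (ℝ≥0.nonNegative x))
    (⊔ℝ-cong (*ℝ-comm ⌊ x ⌋ ⌊ y ⌋) (*ℝ-comm ⌊ x ⌋ ⌊ z ⌋))))
  *.zeroˡ
  where module * = IsCommutativeSemiring WMC-isCommutativeSemiring

MPE-isSelection : IsSelection _≈ℝ≥0_ (λ x y → ⌊ x ⌋ ≤ℝ ⌊ y ⌋) _⊔ℝ≥0_ 0ℝ≥0
MPE-isSelection = record
  { ≈-trans   = ≈ℝ-trans
  ; ≤-trans   = ≤ℝ-trans
  ; x≤x∙y     = λ x y → x≤x⊔y ⌊ x ⌋ ⌊ y ⌋
  ; y≤x∙y     = λ x y → y≤x⊔y ⌊ x ⌋ ⌊ y ⌋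
  ; identityʳ = λ x → y≤x⇒x⊔y≈x (ℝ≥0.nonNegative x)
  ; selective = λ x y → ⊔ℝ-selective ⌊ x ⌋ ⌊ y ⌋
  }

module _ (p : Fin n → UnitInterval) (α : Literal n → ℝ≥0)
  (α≈p : ∀ v → α (pos v) ≈ℝ≥0 toℝ≥0 (p v) × α (neg v) ≈ℝ≥0 toℝ≥0 (1-ᵘ p v)) (T : Formula n) where

  private
    weight : Interpretation n → ℝ≥0
    weight I = BigOps.⨂ MPE-rawSemiring (map α (literals I))

    ⌊weight⌋ : ∀ ls → ⌊ BigOps.⨂ MPE-rawSemiring (map α ls) ⌋ ≡ ∏ℝ (map (⌊_⌋ ∘ α) ls)
    ⌊weight⌋ []       = refl
    ⌊weight⌋ (l ∷ ls) = cong (⌊ α l ⌋ *ℝ_) (⌊weight⌋ ls)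

    weight≈mass : ∀ I → ⌊ weight I ⌋ ≈ℝ mass (⌊_⌋ᵘ ∘ p) I
    weight≈mass I = subst (_≈ℝ mass (⌊_⌋ᵘ ∘ p) I) (sym (⌊weight⌋ (literals I)))
      (∏≈mass {w = ⌊_⌋ ∘ α} α≈p I)

  open IsSelection MPE-isSelection using (bound; attained)

  MPE-correct : IsMPE (⌊_⌋ᵘ ∘ p) T ⌊ AMC MPE-rawSemiring α T ⌋
  MPE-correct =
    (λ (_ , nonempty) →
      ¬¬-bind nonempty (λ (I , I⊨T , _) → ¬¬-map
        (λ (J , J∈ , eq) → J , ∈-models⁻ T J∈ , ≈ℝ-trans eq (weight≈mass J))
        (attained weight (∈-models⁺ T I⊨T))) ,
      λ x → ≤ℝ-stable ∘ ¬¬-map λ (I , I⊨T , x≈) →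
        ≤ℝ-trans (≈⇒≤ (≈ℝ-trans x≈ (≈ℝ-sym (weight≈mass I)))) (bound weight (∈-models⁺ T I⊨T))) ,
    λ empty → subst (λ Is → ⌊ BigOps.⨁ MPE-rawSemiring (map weight Is) ⌋ ≈ℝ 0ℝ)
      (sym (no-models T λ (I , I⊨T) → empty (_ , λ k → k (I , I⊨T , ≈ℝ-refl)))) ≈ℝ-refl

------------------------------------------------------------------------
-- Fuzzy constraints

FUZZY-isCommutativeSemiring : IsCommutativeSemiringOn FUZZY-rawSemiring
FUZZY-isCommutativeSemiring = commutativeSemiring FUZZY-rawSemiring
  (On.isEquivalence ⌊_⌋ᵘ ≈ℝ-isEquivalence)
  ⊔ℝ-cong
  (λ x y z → pointwise λ i → ℚ.⊔-assoc (seq ⌊ x ⌋ᵘ i) (seq ⌊ y ⌋ᵘ i) (seq ⌊ z ⌋ᵘ i))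
  (λ x y → ⊔ℝ-comm ⌊ x ⌋ᵘ ⌊ y ⌋ᵘ)
  (λ x → x≤y⇒x⊔y≈y (UnitInterval.nonNegative x))
  ⊓ℝ-cong
  (λ x y z → pointwise λ i → ℚ.⊓-assoc (seq ⌊ x ⌋ᵘ i) (seq ⌊ y ⌋ᵘ i) (seq ⌊ z ⌋ᵘ i))
  (λ x y → ⊓ℝ-comm ⌊ x ⌋ᵘ ⌊ y ⌋ᵘ)
  (λ x → y≤x⇒x⊓y≈y (UnitInterval.atMostOne x))
  (λ x y z → pointwise λ i → ℚ.⊓-distribʳ-⊔ (seq ⌊ x ⌋ᵘ i) (seq ⌊ y ⌋ᵘ i) (seq ⌊ z ⌋ᵘ i))
  (λ x → x≤y⇒x⊓y≈x (UnitInterval.nonNegative x))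

⊔ᵘ-isSelection : IsSelection _≈ᵘ_ _≤ᵘ_ _⊔ᵘ_ 0ᵘ
⊔ᵘ-isSelection = record
  { ≈-trans   = ≈ℝ-trans
  ; ≤-trans   = ≤ℝ-trans
  ; x≤x∙y     = λ x y → x≤x⊔y ⌊ x ⌋ᵘ ⌊ y ⌋ᵘ
  ; y≤x∙y     = λ x y → y≤x⊔y ⌊ x ⌋ᵘ ⌊ y ⌋ᵘ
  ; identityʳ = λ x → y≤x⇒x⊔y≈x (UnitInterval.nonNegative x)
  ; selective = λ x y → ⊔ℝ-selective ⌊ x ⌋ᵘ ⌊ y ⌋ᵘ
  }

⊓ᵘ-isSelection : IsSelection _≈ᵘ_ (flip _≤ᵘ_) _⊓ᵘ_ 1ᵘ
⊓ᵘ-isSelection = record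
  { ≈-trans   = ≈ℝ-trans
  ; ≤-trans   = λ y≤x z≤y → ≤ℝ-trans z≤y y≤x
  ; x≤x∙y     = λ x y → x⊓y≤x ⌊ x ⌋ᵘ ⌊ y ⌋ᵘ
  ; y≤x∙y     = λ x y → x⊓y≤y ⌊ x ⌋ᵘ ⌊ y ⌋ᵘ
  ; identityʳ = λ x → x≤y⇒x⊓y≈x (UnitInterval.atMostOne x)
  ; selective = λ x y → ⊓ℝ-selective ⌊ x ⌋ᵘ ⌊ y ⌋ᵘ
  }

module _ (α : Literal n → UnitInterval) (α¬≈1 : ∀ v → α (neg v) ≈ᵘ 1ᵘ) where
  open BigOps FUZZY-rawSemiring

  private
    degree : Interpretation n → UnitInterval
    degree I = ⨂ (map α (literals I))

    degree≈ : ∀ I → degree I ≈ᵘ ⨂ (map (α ∘ pos) (trueVariables I))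
    degree≈ = ⨂-literals FUZZY-rawSemiring FUZZY-isCommutativeSemiring {α = α} α¬≈1

  module _ (I : Interpretation n) where
    open IsSelection ⊓ᵘ-isSelection using (bound; attained)

    -- The fuzzy degree of I is the least degree of its true variables, which is
    -- the product of its literals since negative literals have label 1.

    degree-correct : ∀ x → x ≈ᵘ degree I → IsFuzzyDegree (α ∘ pos) I x
    degree-correct x x≈ =
      (λ (_ , nonempty) →
        ¬¬-bind nonempty (λ (v , Iv , _) → ¬¬-map
          (λ (w , w∈ , eq) → w , ∈-trueVariables⁻ I w∈ , ≈ℝ-trans x≈′ eq)
          (attained (α ∘ pos) (∈-trueVariables⁺ I Iv))) ,
        λ y → ≤ℝ-stable ∘ ¬¬-map λ (v , Iv , y≈) →
          ≤ℝ-trans (≈⇒≤ x≈′) (≤ℝ-trans (bound (α ∘ pos) (∈-trueVariables⁺ I Iv)) (≥⇐≈ y≈))) ,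
      λ empty → ≈ℝ-trans x≈′ (subst (λ vs → ⨂ (map (α ∘ pos) vs) ≈ᵘ 1ᵘ)
        (sym (List.filter-none (λ v → lookup I v Bool.≟ true)
          (All.universal (λ v Iv → empty (α (pos v) , λ k → k (v , Iv , ≈ℝ-refl))) (allFin n)))) ≈ℝ-refl)
      where
      x≈′ : x ≈ᵘ ⨂ (map (α ∘ pos) (trueVariables I))
      x≈′ = ≈ℝ-trans x≈ (degree≈ I)

    -- Were x different from the degree of I, no variable would be true in I,
    -- and both would be 1.

    degree-unique : ∀ x → IsFuzzyDegree (α ∘ pos) I x → x ≈ᵘ degree I
    degree-unique x (min , none) = ≈ℝ-stable λ x≉ →
      let empty : ¬ ∃ λ y → ¬ ¬ ∃ λ v → lookup I v ≡ true × y ≈ᵘ α (pos v)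
          empty = λ S → let x∈ , x≤ = min S
                            d∈ , d≤ = proj₁ (degree-correct (degree I) ≈ℝ-refl) S
                        in x≉ (≤ℝ-antisym (x≤ (degree I) d∈) (d≤ x x∈))
      in x≉ (≈ℝ-trans (none empty) (≈ℝ-sym (proj₂ (degree-correct (degree I) ≈ℝ-refl) empty)))

  FUZZY-correct : ∀ T → IsFuzzyValue (α ∘ pos) T (AMC FUZZY-rawSemiring α T)
  FUZZY-correct T =
    (λ (_ , nonempty) →
      ¬¬-bind nonempty (λ (I , I⊨T , _) → ¬¬-map
        (λ (J , J∈ , eq) → J , ∈-models⁻ T J∈ , degree-correct J (AMC FUZZY-rawSemiring α T) eq)
        (attained degree (∈-models⁺ T I⊨T))) ,
      λ x → ≤ℝ-stable ∘ ¬¬-map λ (I , I⊨T , x-degree) →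
        ≤ℝ-trans (≈⇒≤ (degree-unique I x x-degree)) (bound degree (∈-models⁺ T I⊨T))) ,
    λ empty → subst (λ Is → ⨁ (map degree Is) ≈ᵘ 0ᵘ)
      (sym (no-models T λ (I , I⊨T) → empty (degree I , λ k → k (I , I⊨T , degree-correct I (degree I) ≈ℝ-refl)))) ≈ℝ-refl
    where open IsSelection ⊔ᵘ-isSelection using (bound; attained)

------------------------------------------------------------------------
-- The tropical semirings on ℕ∞

≤∞-refl : ∀ {x} → x ≤∞ x
≤∞-refl = ≤⁺-reflexive-≡ ℕ.≤-reflexive refl

≤∞-reflexive : ∀ {x y} → x ≡ y → x ≤∞ y
≤∞-reflexive = ≤⁺-reflexive-≡ ℕ.≤-reflexive

≤∞-trans : ∀ {x y z} → x ≤∞ y → y ≤∞ z → x ≤∞ z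
≤∞-trans = ≤⁺-trans ℕ.≤-trans

≤∞-antisym : ∀ {x y} → x ≤∞ y → y ≤∞ x → x ≡ y
≤∞-antisym = ≤⁺-antisym-≡ ℕ.≤-antisym

0≤∞ : ∀ {x} → [ 0 ] ≤∞ x
0≤∞ {[ a ]} = [ ℕ.z≤n ]
0≤∞ {⊤⁺}    = _ ≤⊤⁺

infix 4 _≟∞_
_≟∞_ : DecidableEquality ℕ∞
_≟∞_ = ≡-dec ℕ._≟_

+∞-mono-≤ : ∀ {a b c d} → a ≤∞ b → c ≤∞ d → (a +∞ c) ≤∞ (b +∞ d)
+∞-mono-≤ [ p ]     [ q ]     = [ ℕ.+-mono-≤ p q ]
+∞-mono-≤ [ p ]     (_ ≤⊤⁺)   = _ ≤⊤⁺
+∞-mono-≤ (_ ≤⊤⁺)   _         = _ ≤⊤⁺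

⊓∞-comm : ∀ x y → x ⊓∞ y ≡ y ⊓∞ x
⊓∞-comm [ a ] [ b ] = cong [_] (ℕ.⊓-comm a b)
⊓∞-comm [ a ] ⊤⁺    = refl
⊓∞-comm ⊤⁺    [ b ] = refl
⊓∞-comm ⊤⁺    ⊤⁺    = refl

⊔∞-comm : ∀ x y → x ⊔∞ y ≡ y ⊔∞ x
⊔∞-comm [ a ] [ b ] = cong [_] (ℕ.⊔-comm a b)
⊔∞-comm [ a ] ⊤⁺    = refl
⊔∞-comm ⊤⁺    [ b ] = refl
⊔∞-comm ⊤⁺    ⊤⁺    = refl

+∞-comm : ∀ x y → x +∞ y ≡ y +∞ x
+∞-comm [ a ] [ b ] = cong [_] (ℕ.+-comm a b)
+∞-comm [ a ] ⊤⁺    = refl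
+∞-comm ⊤⁺    [ b ] = refl
+∞-comm ⊤⁺    ⊤⁺    = refl

⊓∞-assoc : ∀ x y z → (x ⊓∞ y) ⊓∞ z ≡ x ⊓∞ (y ⊓∞ z)
⊓∞-assoc [ a ] [ b ] [ c ] = cong [_] (ℕ.⊓-assoc a b c)
⊓∞-assoc [ a ] [ b ] ⊤⁺    = refl
⊓∞-assoc [ a ] ⊤⁺    z     = refl
⊓∞-assoc ⊤⁺    y     z     = refl

⊔∞-assoc : ∀ x y z → (x ⊔∞ y) ⊔∞ z ≡ x ⊔∞ (y ⊔∞ z)
⊔∞-assoc [ a ] [ b ] [ c ] = cong [_] (ℕ.⊔-assoc a b c)
⊔∞-assoc [ a ] [ b ] ⊤⁺    = refl
⊔∞-assoc [ a ] ⊤⁺    z     = refl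
⊔∞-assoc ⊤⁺    y     z     = refl

+∞-assoc : ∀ x y z → (x +∞ y) +∞ z ≡ x +∞ (y +∞ z)
+∞-assoc [ a ] [ b ] [ c ] = cong [_] (ℕ.+-assoc a b c)
+∞-assoc [ a ] [ b ] ⊤⁺    = refl
+∞-assoc [ a ] ⊤⁺    z     = refl
+∞-assoc ⊤⁺    y     z     = refl

+∞-identityˡ : ∀ x → [ 0 ] +∞ x ≡ x
+∞-identityˡ [ a ] = refl
+∞-identityˡ ⊤⁺    = refl

⊔∞-identityˡ : ∀ x → [ 0 ] ⊔∞ x ≡ x
⊔∞-identityˡ [ a ] = refl
⊔∞-identityˡ ⊤⁺    = refl

+∞-distribʳ-⊓∞ : ∀ x y z → (y ⊓∞ z) +∞ x ≡ (y +∞ x) ⊓∞ (z +∞ x)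
+∞-distribʳ-⊓∞ [ a ] [ b ] [ c ] = cong [_] (ℕ.+-distribʳ-⊓ a b c)
+∞-distribʳ-⊓∞ [ a ] [ b ] ⊤⁺    = refl
+∞-distribʳ-⊓∞ ⊤⁺    [ b ] [ c ] = refl
+∞-distribʳ-⊓∞ ⊤⁺    [ b ] ⊤⁺    = refl
+∞-distribʳ-⊓∞ x     ⊤⁺    z     = refl

⊓∞-distribʳ-⊔∞ : ∀ x y z → (y ⊔∞ z) ⊓∞ x ≡ (y ⊓∞ x) ⊔∞ (z ⊓∞ x)
⊓∞-distribʳ-⊔∞ [ a ] [ b ] [ c ] = cong [_] (ℕ.⊓-distribʳ-⊔ a b c)
⊓∞-distribʳ-⊔∞ [ a ] [ b ] ⊤⁺    = cong [_] (sym (ℕ.m≤n⇒m⊔n≡n (ℕ.m⊓n≤n b a)))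
⊓∞-distribʳ-⊔∞ [ a ] ⊤⁺    [ c ] = cong [_] (sym (ℕ.m≥n⇒m⊔n≡m (ℕ.m⊓n≤n c a)))
⊓∞-distribʳ-⊔∞ [ a ] ⊤⁺    ⊤⁺    = cong [_] (sym (ℕ.⊔-idem a))
⊓∞-distribʳ-⊔∞ ⊤⁺    [ b ] [ c ] = refl
⊓∞-distribʳ-⊔∞ ⊤⁺    [ b ] ⊤⁺    = refl
⊓∞-distribʳ-⊔∞ ⊤⁺    ⊤⁺    z     = refl

⊓∞-zeroˡ : ∀ x → [ 0 ] ⊓∞ x ≡ [ 0 ]
⊓∞-zeroˡ [ a ] = refl
⊓∞-zeroˡ ⊤⁺    = refl

S-PATH-isCommutativeSemiring : IsCommutativeSemiringOn S-PATH-rawSemiring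
S-PATH-isCommutativeSemiring = commutativeSemiring S-PATH-rawSemiring isEquivalence
  (cong₂ _⊓∞_) ⊓∞-assoc ⊓∞-comm (λ _ → refl)
  (cong₂ _+∞_) +∞-assoc +∞-comm +∞-identityˡ
  +∞-distribʳ-⊓∞ (λ _ → refl)

W-PATH-isCommutativeSemiring : IsCommutativeSemiringOn W-PATH-rawSemiring
W-PATH-isCommutativeSemiring = commutativeSemiring W-PATH-rawSemiring isEquivalence
  (cong₂ _⊔∞_) ⊔∞-assoc ⊔∞-comm ⊔∞-identityˡ
  (cong₂ _⊓∞_) ⊓∞-assoc ⊓∞-comm (λ _ → refl)
  ⊓∞-distribʳ-⊔∞ ⊓∞-zeroˡ

⊓∞-isSelection : IsSelection _≡_ (flip _≤∞_) _⊓∞_ ⊤⁺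
⊓∞-isSelection = record
  { ≈-trans   = trans
  ; ≤-trans   = λ y≤x z≤y → ≤∞-trans z≤y y≤x
  ; x≤x∙y     = lower
  ; y≤x∙y     = λ x y → subst (_≤∞ y) (⊓∞-comm y x) (lower y x)
  ; identityʳ = λ x → ⊓∞-comm x ⊤⁺
  ; selective = λ x y k → k (selective x y)
  }
  where
  lower : ∀ x y → (x ⊓∞ y) ≤∞ x
  lower [ a ] [ b ] = [ ℕ.m⊓n≤m a b ]
  lower [ a ] ⊤⁺    = ≤∞-refl
  lower ⊤⁺    y     = y ≤⊤⁺
  selective : ∀ x y → x ⊓∞ y ≡ x ⊎ x ⊓∞ y ≡ y
  selective [ a ] [ b ] = Sum.map (cong [_]) (cong [_]) (ℕ.⊓-sel a b)
  selective [ a ] ⊤⁺    = inj₁ refl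
  selective ⊤⁺    y     = inj₂ refl

⊔∞-isSelection : IsSelection _≡_ _≤∞_ _⊔∞_ [ 0 ]
⊔∞-isSelection = record
  { ≈-trans   = trans
  ; ≤-trans   = ≤∞-trans
  ; x≤x∙y     = upper
  ; y≤x∙y     = λ x y → subst (y ≤∞_) (⊔∞-comm y x) (upper y x)
  ; identityʳ = λ x → trans (⊔∞-comm x [ 0 ]) (⊔∞-identityˡ x)
  ; selective = λ x y k → k (selective x y)
  }
  where
  upper : ∀ x y → x ≤∞ (x ⊔∞ y)
  upper [ a ] [ b ] = [ ℕ.m≤m⊔n a b ]
  upper [ a ] ⊤⁺    = _ ≤⊤⁺
  upper ⊤⁺    y     = _ ≤⊤⁺
  selective : ∀ x y → x ⊔∞ y ≡ x ⊎ x ⊔∞ y ≡ y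
  selective [ a ] [ b ] = Sum.map (cong [_]) (cong [_]) (ℕ.⊔-sel a b)
  selective [ a ] ⊤⁺    = inj₂ refl
  selective ⊤⁺    y     = inj₁ refl

module Min∞ = DecSelection _≟∞_ ⊓∞-isSelection

------------------------------------------------------------------------
-- Truncated weights

module KWeight (k : ℕ) where
  open RawSemiring (kWEIGHT-rawSemiring k)
  open BigOps (kWEIGHT-rawSemiring k)
  open ≡-Reasoning

  private
    toℕ≤k : (a : Fin (suc k)) → toℕ a ℕ.≤ k
    toℕ≤k = Fin.toℕ≤pred[n]

  toℕ-+ : ∀ a b → toℕ (a + b) ≡ toℕ a ℕ.⊓ toℕ b
  toℕ-+ a b = trans (Fin.toℕ-fromℕ< _)
    (ℕ.m≤n⇒m⊓n≡m (ℕ.≤-trans (ℕ.m⊓n≤m (toℕ a) (toℕ b)) (toℕ≤k a)))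

  toℕ-* : ∀ a b → toℕ (a * b) ≡ (toℕ a ℕ.+ toℕ b) ℕ.⊓ k
  toℕ-* a b = Fin.toℕ-fromℕ< _

  -- Truncating a summand first does not change the truncated sum.

  truncate-+ : ∀ a b → (a ℕ.⊓ k ℕ.+ b) ℕ.⊓ k ≡ (a ℕ.+ b) ℕ.⊓ k
  truncate-+ a b = begin
    (a ℕ.⊓ k ℕ.+ b) ℕ.⊓ k                ≡⟨ cong (ℕ._⊓ k) (ℕ.+-distribʳ-⊓ b a k) ⟩
    ((a ℕ.+ b) ℕ.⊓ (k ℕ.+ b)) ℕ.⊓ k      ≡⟨ ℕ.⊓-assoc (a ℕ.+ b) (k ℕ.+ b) k ⟩
    (a ℕ.+ b) ℕ.⊓ ((k ℕ.+ b) ℕ.⊓ k)      ≡⟨ cong ((a ℕ.+ b) ℕ.⊓_) (ℕ.m≥n⇒m⊓n≡n (ℕ.m≤m+n k b)) ⟩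
    (a ℕ.+ b) ℕ.⊓ k                      ∎

  *-comm : ∀ a b → a * b ≡ b * a
  *-comm a b = Fin.toℕ-injective (trans (toℕ-* a b)
    (trans (cong (ℕ._⊓ k) (ℕ.+-comm (toℕ a) (toℕ b))) (sym (toℕ-* b a))))

  toℕ-*-* : ∀ a b c → toℕ ((a * b) * c) ≡ (toℕ a ℕ.+ toℕ b ℕ.+ toℕ c) ℕ.⊓ k
  toℕ-*-* a b c = trans (toℕ-* (a * b) c)
    (trans (cong (λ m → (m ℕ.+ toℕ c) ℕ.⊓ k) (toℕ-* a b)) (truncate-+ (toℕ a ℕ.+ toℕ b) (toℕ c)))

  *-assoc : ∀ a b c → (a * b) * c ≡ a * (b * c)
  *-assoc a b c = Fin.toℕ-injective (begin
    toℕ ((a * b) * c)                         ≡⟨ toℕ-*-* a b c ⟩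
    (toℕ a ℕ.+ toℕ b ℕ.+ toℕ c) ℕ.⊓ k         ≡⟨ cong (ℕ._⊓ k) (trans (ℕ.+-assoc (toℕ a) _ _) (ℕ.+-comm (toℕ a) _)) ⟩
    (toℕ b ℕ.+ toℕ c ℕ.+ toℕ a) ℕ.⊓ k         ≡⟨ toℕ-*-* b c a ⟨
    toℕ ((b * c) * a)                         ≡⟨ cong toℕ (*-comm (b * c) a) ⟩
    toℕ (a * (b * c))                         ∎)

  *-distribʳ-+ : ∀ a b c → (b + c) * a ≡ (b * a) + (c * a)
  *-distribʳ-+ a b c = Fin.toℕ-injective (begin
    toℕ ((b + c) * a)                                   ≡⟨ toℕ-* (b + c) a ⟩
    (toℕ (b + c) ℕ.+ x) ℕ.⊓ k                           ≡⟨ cong (λ m → (m ℕ.+ x) ℕ.⊓ k) (toℕ-+ b c) ⟩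
    (y ℕ.⊓ z ℕ.+ x) ℕ.⊓ k                               ≡⟨ cong (ℕ._⊓ k) (ℕ.+-distribʳ-⊓ x y z) ⟩
    ((y ℕ.+ x) ℕ.⊓ (z ℕ.+ x)) ℕ.⊓ k                     ≡⟨ ℕ.mono-≤-distrib-⊓ (ℕ.⊓-monoˡ-≤ k) (y ℕ.+ x) (z ℕ.+ x) ⟩
    ((y ℕ.+ x) ℕ.⊓ k) ℕ.⊓ ((z ℕ.+ x) ℕ.⊓ k)             ≡⟨ cong₂ ℕ._⊓_ (toℕ-* b a) (toℕ-* c a) ⟨
    toℕ (b * a) ℕ.⊓ toℕ (c * a)                         ≡⟨ toℕ-+ (b * a) (c * a) ⟨
    toℕ ((b * a) + (c * a))                             ∎)
    where
    x = toℕ a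
    y = toℕ b
    z = toℕ c

  +-identityˡ : ∀ a → 0# + a ≡ a
  +-identityˡ a = Fin.toℕ-injective (trans (toℕ-+ 0# a)
    (ℕ.m≥n⇒m⊓n≡n (subst (toℕ a ℕ.≤_) (sym (Fin.toℕ-fromℕ k)) (toℕ≤k a))))

  +-comm : ∀ a b → a + b ≡ b + a
  +-comm a b = Fin.toℕ-injective (trans (toℕ-+ a b)
    (trans (ℕ.⊓-comm (toℕ a) (toℕ b)) (sym (toℕ-+ b a))))

  kWEIGHT-isCommutativeSemiring : IsCommutativeSemiringOn (kWEIGHT-rawSemiring k)
  kWEIGHT-isCommutativeSemiring = commutativeSemiring (kWEIGHT-rawSemiring k) isEquivalence
    (cong₂ _+_)
    (λ a b c → Fin.toℕ-injective (begin
      toℕ ((a + b) + c)                 ≡⟨ toℕ-+ (a + b) c ⟩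
      toℕ (a + b) ℕ.⊓ toℕ c             ≡⟨ cong (ℕ._⊓ toℕ c) (toℕ-+ a b) ⟩
      toℕ a ℕ.⊓ toℕ b ℕ.⊓ toℕ c         ≡⟨ ℕ.⊓-assoc (toℕ a) (toℕ b) (toℕ c) ⟩
      toℕ a ℕ.⊓ (toℕ b ℕ.⊓ toℕ c)       ≡⟨ cong (toℕ a ℕ.⊓_) (toℕ-+ b c) ⟨
      toℕ a ℕ.⊓ toℕ (b + c)             ≡⟨ toℕ-+ a (b + c) ⟨
      toℕ (a + (b + c))                 ∎))
    +-comm
    +-identityˡ
    (cong₂ _*_) *-assoc *-comm
    (λ a → Fin.toℕ-injective (trans (toℕ-* 1# a) (ℕ.m≤n⇒m⊓n≡m (toℕ≤k a))))
    *-distribʳ-+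
    (λ a → Fin.toℕ-injective (trans (toℕ-* 0# a)
      (trans (cong (λ m → (m ℕ.+ toℕ a) ℕ.⊓ k) (Fin.toℕ-fromℕ k))
      (trans (ℕ.m≥n⇒m⊓n≡n (ℕ.m≤m+n k (toℕ a))) (sym (Fin.toℕ-fromℕ k))))))

  +-isSelection : IsSelection _≡_ (λ a b → toℕ b ℕ.≤ toℕ a) _+_ 0#
  +-isSelection = record
    { ≈-trans   = trans
    ; ≤-trans   = λ p q → ℕ.≤-trans q p
    ; x≤x∙y     = λ a b → ℕ.≤-trans (ℕ.≤-reflexive (toℕ-+ a b)) (ℕ.m⊓n≤m (toℕ a) (toℕ b))
    ; y≤x∙y     = λ a b → ℕ.≤-trans (ℕ.≤-reflexive (toℕ-+ a b)) (ℕ.m⊓n≤n (toℕ a) (toℕ b))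
    ; identityʳ = λ a → trans (+-comm a 0#) (+-identityˡ a)
    ; selective = λ a b none → none (Sum.map (Fin.toℕ-injective ∘ trans (toℕ-+ a b))
                    (Fin.toℕ-injective ∘ trans (toℕ-+ a b)) (ℕ.⊓-sel (toℕ a) (toℕ b)))
    }

  module _ (α : Literal n → Fin (suc k)) (T : Formula n) where
    private
      module Min = DecSelection Fin._≟_ +-isSelection

      -- The cost before truncation; its minimum is taken in ℕ∞, where the empty
      -- minimum exists.

      cost : Interpretation n → ℕ
      cost = totalCost (toℕ ∘ α)

      weight : Interpretation n → Fin (suc k)
      weight I = ⨂ (map α (literals I))

      -- Truncating after each addition is truncating the sum.

      toℕ-weight : ∀ I → toℕ (weight I) ≡ cost I ℕ.⊓ k
      toℕ-weight I = go (literals I)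
        where
        go : ∀ ls → toℕ (⨂ (map α ls)) ≡ foldr ℕ._+_ 0 (map (toℕ ∘ α) ls) ℕ.⊓ k
        go []       = refl
        go (l ∷ ls) = begin
          toℕ (α l * ⨂ (map α ls))         ≡⟨ cong toℕ (*-comm (α l) (⨂ (map α ls))) ⟩
          toℕ (⨂ (map α ls) * α l)         ≡⟨ toℕ-* (⨂ (map α ls)) (α l) ⟩
          (toℕ (⨂ (map α ls)) ℕ.+ a) ℕ.⊓ k ≡⟨ cong (λ m → (m ℕ.+ a) ℕ.⊓ k) (go ls) ⟩
          (Σ ℕ.⊓ k ℕ.+ a) ℕ.⊓ k            ≡⟨ truncate-+ Σ a ⟩
          (Σ ℕ.+ a) ℕ.⊓ k                  ≡⟨ cong (ℕ._⊓ k) (ℕ.+-comm Σ a) ⟩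
          (a ℕ.+ Σ) ℕ.⊓ k                  ∎
          where
          a = toℕ (α l)
          Σ = foldr ℕ._+_ 0 (map (toℕ ∘ α) ls)

    kWEIGHT-correct : IsTruncatedMinCost k α T (AMC (kWEIGHT-rawSemiring k) α T)
    kWEIGHT-correct = minimum ,
      λ ¬model → cong (λ Is → ⨁ (map weight Is)) (no-models T ¬model)
      where
      minimum : Model T → ∃ λ c →
        IsMinimum ℕ._≤_ (λ x → ∃ λ I → I ⊨ T × x ≡ cost I) c ×
        toℕ (AMC (kWEIGHT-rawSemiring k) α T) ≡ c ℕ.⊓ k
      minimum (I , I⊨T) with Min.attained weight (∈-models⁺ T I⊨T)
                           | Min∞.attained ([_] ∘ cost) (∈-models⁺ T I⊨T)
      ... | J , J∈ , m≡J | K , K∈ , c≡K = cost K , ((K , ∈-models⁻ T K∈ , refl) , least) ,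
        ℕ.≤-antisym
          (ℕ.≤-trans (Min.bound weight K∈) (ℕ.≤-reflexive (toℕ-weight K)))
          (ℕ.≤-trans (ℕ.⊓-monoˡ-≤ k (least (cost J) (J , ∈-models⁻ T J∈ , refl)))
            (ℕ.≤-reflexive (trans (sym (toℕ-weight J)) (cong toℕ (sym m≡J)))))
        where
        -- The cost of K, minimal in ℕ∞, is minimal in ℕ.

        least : ∀ x → (∃ λ I → I ⊨ T × x ≡ cost I) → cost K ℕ.≤ x
        least _ (I , I⊨T , refl) = [≤]-injective
          (subst (_≤∞ [ cost I ]) c≡K (Min∞.bound ([_] ∘ cost) (∈-models⁺ T I⊨T)))

------------------------------------------------------------------------
-- Shortest and widest paths

-- Applied to the nodes of a simple path, this bounds its length.

Unique⇒length≤ : ∀ {m} {xs : List (Fin m)} → Unique xs → length xs ℕ.≤ m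
Unique⇒length≤ xs! = Fin.injective⇒≤ (lookup-injective xs!)

-- The interpretation in which the members of a list are true.

only : List (Fin n) → Interpretation n
only vs = Vec.tabulate λ v → does (_∈?_ Fin._≟_ v vs)

only⁺ : (vs : List (Fin n)) → ∀ {v} → v ∈ vs → lookup (only vs) v ≡ true
only⁺ vs {v} v∈vs = trans (Vec.lookup∘tabulate _ v) (dec-true (_∈?_ Fin._≟_ v vs) v∈vs)

only⁻ : (vs : List (Fin n)) → ∀ {v} → lookup (only vs) v ≡ true → v ∈ vs
only⁻ vs {v} eq with _∈?_ Fin._≟_ v vs | trans (sym (Vec.lookup∘tabulate (λ v → does (_∈?_ Fin._≟_ v vs)) v)) eq
... | yes v∈vs | _ = v∈vs

⋀ᶠ⁺ : (I : Interpretation n) → ∀ {vs} → vs ⊆ trueVariables I → I ⊨ ⋀ᶠ (map var vs)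
⋀ᶠ⁺ I {[]}     _  = refl
⋀ᶠ⁺ I {v ∷ vs} vs⊆ = cong₂ _∧_ (∈-trueVariables⁻ I (vs⊆ (here refl))) (⋀ᶠ⁺ I (vs⊆ ∘ there))

⋀ᶠ⁻ : (I : Interpretation n) → ∀ {vs} → I ⊨ ⋀ᶠ (map var vs) → vs ⊆ trueVariables I
⋀ᶠ⁻ I {v ∷ vs} I⊨ (here refl) = ∈-trueVariables⁺ I (Bool.∧-conicalˡ _ _ I⊨)
⋀ᶠ⁻ I {v ∷ vs} I⊨ (there v∈)  = ⋀ᶠ⁻ I (Bool.∧-conicalʳ (lookup I v) _ I⊨) v∈

⋁ᶠ⁺ : (I : Interpretation n) → ∀ {φs φ} → φ ∈ φs → I ⊨ φ → I ⊨ ⋁ᶠ φs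
⋁ᶠ⁺ I (here refl) I⊨φ = cong (_∨ _) I⊨φ
⋁ᶠ⁺ I {ψ ∷ φs} (there φ∈) I⊨φ = trans (cong (⟦ ψ ⟧ I ∨_) (⋁ᶠ⁺ I φ∈ I⊨φ)) (Bool.∨-zeroʳ (⟦ ψ ⟧ I))

⋁ᶠ⁻ : (I : Interpretation n) → ∀ {φs} → I ⊨ ⋁ᶠ φs → ∃ λ φ → φ ∈ φs × I ⊨ φ
⋁ᶠ⁻ I {ψ ∷ φs} I⊨ with ⟦ ψ ⟧ I in eq
... | true  = ψ , here refl , eq
... | false = let φ , φ∈ , I⊨φ = ⋁ᶠ⁻ I I⊨ in φ , there φ∈ , I⊨φ

trueVariables-unique : (I : Interpretation n) → Unique (trueVariables I)
trueVariables-unique {n} I = Unique.filter⁺ (λ v → lookup I v Bool.≟ true) (Unique.allFin⁺ n)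

module _ (G : Digraph n) where
  open Digraph G

  -- A simple path through s has a simple final segment that starts at s.

  suffix : ∀ {s u t} es → IsSimplePath u t es → s ∈ u ∷ map target es →
    ∃ λ es′ → IsSimplePath s t es′ × es′ ⊆ es
  suffix es       simple                     (here refl) = es , simple , id
  suffix (e ∷ es) ((_ , path) , _ ∷ nodes!) (there s∈)  =
    let es′ , simple , es′⊆es = suffix es (path , nodes!) s∈ in es′ , simple , there ∘ es′⊆es

  -- A path is made simple by adding its edges from the last to the first; when
  -- an edge leads out of a node already visited, the loop is cut off.

  simplify : ∀ {s t} es → IsPath s t es → ∃ λ es′ → IsSimplePath s t es′ × es′ ⊆ es
  simplify []       s≡t           = [] , (s≡t , [] ∷ []) , id
  simplify (e ∷ es) (refl , path) with simplify es path
  ... | es′ , (path′ , nodes!) , es′⊆es with _∈?_ Fin._≟_ (source e) (target e ∷ map target es′)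
  ...   | yes s∈ = let es″ , simple , es″⊆es′ = suffix es′ (path′ , nodes!) s∈
                   in es″ , simple , there ∘ es′⊆es ∘ es″⊆es′
  ...   | no s∉  = e ∷ es′ , ((refl , path′) , All.¬Any⇒All¬ _ s∉ ∷ nodes!) ,
                   λ { (here refl) → here refl ; (there e∈) → there (es′⊆es e∈) }

  ∈-edgeLists : ∀ es → es ∈ edgeLists (length es)
  ∈-edgeLists []       = here refl
  ∈-edgeLists (e ∷ es) = ∈.∈-cartesianProductWith⁺ _∷_ (∈.∈-allFin e) (∈-edgeLists es)

  ∈-simplePaths⁺ : ∀ {s t es} → IsSimplePath s t es → es ∈ simplePaths s t
  ∈-simplePaths⁺ {s} {t} {es} simple = ∈.∈-filter⁺ (isSimplePath? s t)
    (∈.∈-concatMap⁺ edgeLists (lose (∈.∈-upTo⁺ short) (∈-edgeLists es))) simple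
    where
    short : length es ℕ.< #nodes
    short = subst (ℕ._< #nodes) (List.length-map target es) (Unique⇒length≤ (proj₂ simple))

  pathTheory⁺ : ∀ {s t es} I → IsSimplePath s t es → es ⊆ trueVariables I → I ⊨ pathTheory s t
  pathTheory⁺ I simple es⊆ =
    ⋁ᶠ⁺ I (∈.∈-map⁺ (λ es → ⋀ᶠ (map var es)) (∈-simplePaths⁺ simple)) (⋀ᶠ⁺ I es⊆)

  pathTheory⁻ : ∀ {s t} I → I ⊨ pathTheory s t →
    ∃ λ es → IsSimplePath s t es × es ⊆ trueVariables I
  pathTheory⁻ {s} {t} I I⊨T with ⋁ᶠ⁻ I I⊨T
  ... | _ , φ∈ , I⊨φ with ∈.∈-map⁻ (λ es → ⋀ᶠ (map var es)) φ∈
  ...   | es , es∈ , refl =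
    es , proj₂ (∈.∈-filter⁻ (isSimplePath? s t) {xs = List.concatMap edgeLists (List.upTo #nodes)} es∈) , ⋀ᶠ⁻ I I⊨φ

  -- Optimal paths in a semiring whose sum selects a summand, the best with
  -- respect to _⊴_.  Adding edges to a set may only worsen the product of its
  -- labels (⨂-antitone), whence the best model consists of the edges of a
  -- best path.

  module OptimalPath (R : RawSemiring 0ℓ 0ℓ) (isR : IsCommutativeSemiringOn R)
    (_⊴_ : Rel (RawSemiring.Carrier R) 0ℓ) where
    open RawSemiring R
    open BigOps R

    module Weights (≈⇒≡ : ∀ {x y} → x ≈ y → x ≡ y) (_≟_ : DecidableEquality Carrier)
      (selection : IsSelection _≡_ _⊴_ _+_ 0#)
      (⊴-antisym : ∀ {x y} → x ⊴ y → y ⊴ x → x ≡ y)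
      (α : Literal n → Carrier) (α¬≈1 : ∀ v → α (neg v) ≈ 1#)
      (⨂-antitone : ∀ {xs ys} → Unique xs → xs ⊆ ys →
        ⨂ (map (α ∘ pos) ys) ⊴ ⨂ (map (α ∘ pos) xs))
      (s t : Node) where
      open IsSelection selection using () renaming (≤-trans to ⊴-trans)
      open DecSelection _≟_ selection

      private
        weight : Interpretation n → Carrier
        weight I = ⨂ (map α (literals I))

        weight≡ : ∀ I → weight I ≡ ⨂ (map (α ∘ pos) (trueVariables I))
        weight≡ I = ≈⇒≡ (⨂-literals R isR {α = α} α¬≈1 I)

        -- The result of algebraic model counting.

        m : Carrier
        m = AMC R α (pathTheory s t)

      pathWeight : List (Fin n) → Carrier
      pathWeight es = ⨂ (map (α ∘ pos) es)

      private
        -- The edges of a simple path form a model, whose weight is bounded by m.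
        simplePath-⊴ : ∀ {es} → IsSimplePath s t es → pathWeight es ⊴ m
        simplePath-⊴ {es} simple = ⊴-trans
          (subst (pathWeight es ⊴_) (sym (weight≡ (only es)))
            (⨂-antitone (trueVariables-unique (only es)) (only⁻ es ∘ ∈-trueVariables⁻ (only es))))
          (bound weight (∈-models⁺ (pathTheory s t)
            (pathTheory⁺ (only es) simple (∈-trueVariables⁺ (only es) ∘ only⁺ es))))

        edges! : ∀ {es} → IsSimplePath s t es → Unique es
        edges! (_ , _ ∷ targets!) = Unique.map⁻ targets!

      path-⊴ : ∀ {es} → IsPath s t es → pathWeight es ⊴ m
      path-⊴ path =
        let es′ , simple , es′⊆es = simplify _ path
        in ⊴-trans (⨂-antitone (edges! simple) es′⊆es) (simplePath-⊴ simple)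

      -- A model of weight m contains a simple path, which is at least as good and,
      -- by the previous bound, no better.

      path-attained : ∀ {es} → IsPath s t es → ∃ λ es′ → IsPath s t es′ × m ≡ pathWeight es′
      path-attained path =
        let es , simple , _ = simplify _ path
            I , I∈ , m≡     = attained weight (∈-models⁺ (pathTheory s t)
              (pathTheory⁺ (only es) simple (∈-trueVariables⁺ (only es) ∘ only⁺ es)))
            es′ , simple′ , es′⊆ = pathTheory⁻ I (∈-models⁻ (pathTheory s t) I∈)
        in es′ , proj₁ simple′ , ⊴-antisym
             (subst (_⊴ pathWeight es′) (trans (sym (weight≡ I)) (sym m≡))
               (⨂-antitone (edges! simple′) es′⊆))
             (simplePath-⊴ simple′)

      no-path : ¬ (∃ λ es → IsPath s t es) → m ≡ 0#
      no-path none = cong (λ Is → ⨁ (map weight Is)) (no-models (pathTheory s t)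
        λ (I , I⊨T) → let es , simple , _ = pathTheory⁻ I I⊨T in none (es , proj₁ simple))

  module _ {s t : Node} {α : Literal n → ℕ∞} (α¬≡0 : ∀ v → α (neg v) ≡ [ 0 ]) where
    open BigOps S-PATH-rawSemiring

    private
      w : Fin n → ℕ∞
      w = α ∘ pos

      -- As edge labels are nonnegative, a sum over a list grows with the list; xs
      -- must not repeat an edge that ys contains once.

      length-mono : ∀ {xs ys} → Unique xs → xs ⊆ ys → ⨂ (map w xs) ≤∞ ⨂ (map w ys)
      length-mono []                   _     = 0≤∞
      length-mono (_∷_ {x} x∉xs xs!) xs⊆ys = ≤∞-trans
        (+∞-mono-≤ ≤∞-refl (length-mono xs! λ z∈xs → ∈-others (xs⊆ys (there z∈xs))
          λ { refl → All.lookup x∉xs z∈xs refl }))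
        (≤∞-reflexive (sym (fold-others w)))
        where
        open Fold (IsCommutativeSemiring.*-isCommutativeMonoid S-PATH-isCommutativeSemiring)
        open Extraction (extract (xs⊆ys (here refl)))

    private
      module Opt = OptimalPath.Weights S-PATH-rawSemiring S-PATH-isCommutativeSemiring (flip _≤∞_)
                      
                      id _≟∞_ ⊓∞-isSelection (flip ≤∞-antisym) α α¬≡0 length-mono s t

    S-PATH-correct : IsShortestPathLength (α ∘ pos) s t (AMC S-PATH-rawSemiring α (pathTheory s t))
    S-PATH-correct =
      (λ (_ , _ , path , _) → Opt.path-attained path , λ { _ (es , path , refl) → Opt.path-⊴ path }) ,
      λ none → Opt.no-path λ (es , path) → none (_ , es , path , refl)

  module _ {s t : Node} (s≢t : s ≢ t) {α : Literal n → ℕ∞} (α¬≡∞ : ∀ v → α (neg v) ≡ ⊤⁺) where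
    open BigOps W-PATH-rawSemiring

    private
      w : Fin n → ℕ∞
      w = α ∘ pos

      width-antitone : ∀ {xs ys} → Unique xs → xs ⊆ ys → ⨂ (map w ys) ≤∞ ⨂ (map w xs)
      width-antitone {[]}     _         _     = _ ≤⊤⁺
      width-antitone {x ∷ xs} (_ ∷ xs!) xs⊆ys with Min∞.attained w {is = x ∷ xs} (here refl)
      ... | y , y∈ , eq = ≤∞-trans (Min∞.bound w (xs⊆ys y∈)) (≤∞-reflexive (sym eq))

      -- The endpoints differ, so a path has an edge and its width is attained.

      nonempty : ∀ {es} → IsPath s t es → ∃ λ e → e ∈ es
      nonempty {[]}    s≡t = contradiction s≡t s≢t
      nonempty {e ∷ _} _   = e , here refl

      -- x is the least label on the path es.

      Width : List (Fin n) → ℕ∞ → Set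
      Width es = IsMinimum _≤∞_ (λ y → ∃ λ e → e ∈ es × y ≡ w e)

      width : ∀ {es} → IsPath s t es → Width es (⨂ (map w es))
      width path = Min∞.attained w (proj₂ (nonempty path)) ,
        λ { _ (e , e∈ , refl) → Min∞.bound w e∈ }

      width-unique : ∀ {es x} → IsPath s t es → Width es x → x ≡ ⨂ (map w es)
      width-unique path (x∈ , x≤) = ≤∞-antisym (x≤ _ (proj₁ (width path))) (proj₂ (width path) _ x∈)

      module Opt = OptimalPath.Weights W-PATH-rawSemiring W-PATH-isCommutativeSemiring _≤∞_
                      id _≟∞_ ⊔∞-isSelection ≤∞-antisym α α¬≡∞ width-antitone s t

    W-PATH-correct : IsWidestPathWidth (α ∘ pos) s t (AMC W-PATH-rawSemiring α (pathTheory s t))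
    W-PATH-correct =
      (λ (_ , _ , path , _) →
        (let es , path′ , m≡ = Opt.path-attained path
         in es , path′ , subst (Width es) (sym m≡) (width path′)) ,
        λ { _ (es , path , x-width) →
          subst (_≤∞ _) (sym (width-unique path x-width)) (Opt.path-⊴ path) }) ,
      λ none → Opt.no-path λ (es , path) → none (_ , es , path , width path)

------------------------------------------------------------------------
-- Binary decision diagrams

-- In the Boolean semiring, with the literals labelled by their values in J,
-- the only model of non-zero weight is J itself.

AMC-truth : (T : Formula n) (J : Interpretation n) {α : Literal n → Bool} →
  (∀ v → α (pos v) ≡ lookup J v × α (neg v) ≡ not (lookup J v)) →
  AMC SAT-rawSemiring α T ≡ ⟦ T ⟧ J
AMC-truth {n} T J {α} α≡J = Bool.⇔→≡ (mk⇔
  (λ eq → let I , I∈ , w = ⋁-true⁻ weight (models T) eq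
          in subst (_⊨ T) (lookup-ext λ v → agree I (allFin n) w (∈.∈-allFin v)) (∈-models⁻ T I∈))
  (λ J⊨T → ⋁-true⁺ weight (∈-models⁺ T J⊨T) weight-J))
  where
  open BigOps SAT-rawSemiring
  weight : Interpretation n → Bool
  weight I = ⨂ (map α (literals I))

  agree-at : ∀ I v → α (literal I v) ≡ true → lookup I v ≡ lookup J v
  agree-at I v αl with lookup I v
  ... | true  = sym (trans (sym (proj₁ (α≡J v))) αl)
  ... | false = sym (Bool.not-injective (trans (sym (proj₂ (α≡J v))) αl))

  -- A model of non-zero weight makes the same literals true as J.

  agree : ∀ I vs → ⨂ (map α (map (literal I) vs)) ≡ true → ∀ {v} → v ∈ vs → lookup I v ≡ lookup J v
  agree I (v ∷ vs) w (here refl) = agree-at I v (Bool.∧-conicalˡ _ _ w)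
  agree I (v ∷ vs) w (there v∈) = agree I vs (Bool.∧-conicalʳ _ _ w) v∈

  weight-J : weight J ≡ true
  weight-J = subst (λ bs → ⨂ bs ≡ true) (List.map-∘ (allFin n))
    (Fold.fold-ε (IsCommutativeSemiring.*-isCommutativeMonoid SAT-isCommutativeSemiring)
      (allFin n) λ {v} _ → label v)
    where
    label : ∀ v → α (literal J v) ≡ true
    label v with lookup J v in eq
    ... | true  = trans (proj₁ (α≡J v)) eq
    ... | false = trans (proj₂ (α≡J v)) (cong not eq)

module _ {_<_ : Rel (Fin n) 0ℓ} (isOrder : IsStrictTotalOrder _≡_ _<_) where
  open Diagrams isOrder
  open OBDD
  open IsStrictTotalOrder isOrder using (compare; irrefl) renaming (trans to <-trans)

  ⟦branch⟧ : ∀ v lo hi I → ⟦ branch v lo hi ⟧ᴮ I ≡ (if lookup I v then ⟦ hi ⟧ᴮ I else ⟦ lo ⟧ᴮ I)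
  ⟦branch⟧ v lo hi I with lo ≟ᴮ hi
  ... | yes refl = sym (Bool.if-eta (lookup I v))
  ... | no _     = refl

  -- The interpretation that agrees with J on vs, and with I elsewhere.

  overwrite : List (Fin n) → Interpretation n → Interpretation n → Interpretation n
  overwrite []       I J = I
  overwrite (v ∷ vs) I J = overwrite vs (I [ v ]≔ lookup J v) J

  ⟦expand⟧ : ∀ vs f I J → ⟦ expand vs f I ⟧ᴮ J ≡ f (overwrite vs I J)
  ⟦expand⟧ []       f I J = refl
  ⟦expand⟧ (v ∷ vs) f I J = trans
    (⟦branch⟧ v (expand vs f (I [ v ]≔ false)) (expand vs f (I [ v ]≔ true)) J) test
    where
    test : (if lookup J v then ⟦ expand vs f (I [ v ]≔ true) ⟧ᴮ J
                          else ⟦ expand vs f (I [ v ]≔ false) ⟧ᴮ J) ≡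
           f (overwrite vs (I [ v ]≔ lookup J v) J)
    test with lookup J v
    ... | true  = ⟦expand⟧ vs f (I [ v ]≔ true) J
    ... | false = ⟦expand⟧ vs f (I [ v ]≔ false) J

  -- The value at v comes from J if v is overwritten or I and J agree there.

  lookup-overwrite : ∀ vs I J {v} → v ∈ vs ⊎ lookup I v ≡ lookup J v →
    lookup (overwrite vs I J) v ≡ lookup J v
  lookup-overwrite []       I J     (inj₂ eq) = eq
  lookup-overwrite (u ∷ vs) I J {v} h with v Fin.≟ u | h
  ... | yes refl | _                   = lookup-overwrite vs _ J (inj₂ (Vec.lookup∘update v I (lookup J v)))
  ... | no v≢u   | inj₁ (here v≡u)     = contradiction v≡u v≢u
  ... | no v≢u   | inj₁ (there v∈vs)   = lookup-overwrite vs _ J (inj₁ v∈vs)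
  ... | no v≢u   | inj₂ eq             = lookup-overwrite vs _ J
    (inj₂ (trans (Vec.lookup∘update′ v≢u I (lookup J u)) eq))

  -- The Shannon expansion represents the function, as it tests every variable.

  ⟦fromFunction⟧ : ∀ f J → ⟦ diagram (fromFunction f) ⟧ᴮ J ≡ f J
  ⟦fromFunction⟧ f J = trans (⟦expand⟧ variables f (Vec.replicate n false) J)
    (cong f (lookup-ext λ v → lookup-overwrite variables _ J
      (inj₁ (Perm.∈-resp-↭ (Perm.↭-sym (S.sort-↭ (allFin n))) (∈.∈-allFin v)))))

  ≺-trans : ∀ {u v} D → u < v → v ≺ D → u ≺ D
  ≺-trans (leaf _)     _   _   = _
  ≺-trans (node _ _ _) u<v v<w = <-trans u<v v<w

  -- The function of an ordered diagram does not depend on a variable before its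
  -- root.

  ⟦⟧-independent : ∀ {u} D → u ≺ D → Ordered D → ∀ I b → ⟦ D ⟧ᴮ (I [ u ]≔ b) ≡ ⟦ D ⟧ᴮ I
  ⟦⟧-independent (leaf _)       _   _                 I b = refl
  ⟦⟧-independent {u} (node w lo hi) u<w (w≺lo , w≺hi , lo! , hi!) I b
    rewrite Vec.lookup∘update′ {i = w} {j = u} (λ { refl → irrefl refl u<w }) I b
          | ⟦⟧-independent lo (≺-trans lo u<w w≺lo) lo! I b
          | ⟦⟧-independent hi (≺-trans hi u<w w≺hi) hi! I b = refl

  module _ {v lo hi} (ordered : Ordered (node v lo hi)) where

    -- The two branches represent the cofactors of the function.

    ⟦lo⟧ : ∀ I → ⟦ node v lo hi ⟧ᴮ (I [ v ]≔ false) ≡ ⟦ lo ⟧ᴮ I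
    ⟦lo⟧ I rewrite Vec.lookup∘update v I false =
      ⟦⟧-independent lo (proj₁ ordered) (proj₁ (proj₂ (proj₂ ordered))) I false

    ⟦hi⟧ : ∀ I → ⟦ node v lo hi ⟧ᴮ (I [ v ]≔ true) ≡ ⟦ hi ⟧ᴮ I
    ⟦hi⟧ I rewrite Vec.lookup∘update v I true =
      ⟦⟧-independent hi (proj₁ (proj₂ ordered)) (proj₂ (proj₂ (proj₂ ordered))) I true

    -- A root test that the function does not depend on has two equivalent
    -- branches.

    module _ {D} (v≺D : v ≺ D) (D! : Ordered D) (eq : ∀ I → ⟦ node v lo hi ⟧ᴮ I ≡ ⟦ D ⟧ᴮ I) where

      ⟦lo⟧≡ : ∀ I → ⟦ lo ⟧ᴮ I ≡ ⟦ D ⟧ᴮ I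
      ⟦lo⟧≡ I = trans (sym (⟦lo⟧ I)) (trans (eq _) (⟦⟧-independent D v≺D D! I false))

      ⟦hi⟧≡ : ∀ I → ⟦ hi ⟧ᴮ I ≡ ⟦ D ⟧ᴮ I
      ⟦hi⟧≡ I = trans (sym (⟦hi⟧ I)) (trans (eq _) (⟦⟧-independent D v≺D D! I true))

  -- Reduced ordered diagrams that represent the same function are equal.  Were
  -- the roots different, the smaller root variable would be irrelevant to the
  -- other diagram, hence to the function, and both its branches would represent
  -- that function.

  canonical : ∀ D E → Ordered D → Reduced D → Ordered E → Reduced E →
    (∀ I → ⟦ D ⟧ᴮ I ≡ ⟦ E ⟧ᴮ I) → D ≡ E
  canonical (leaf a) (leaf b) _ _ _ _ eq = cong leaf (eq (Vec.replicate n false))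
  canonical (node v l h) E@(leaf _) D!@(_ , _ , l! , h!) (l≢h , l↓ , h↓) E! E↓ eq = contradiction
    (trans (canonical l E l! l↓ E! E↓ (⟦lo⟧≡ D! {E} _ E! eq))
      (sym (canonical h E h! h↓ E! E↓ (⟦hi⟧≡ D! {E} _ E! eq)))) l≢h
  canonical D@(leaf _) (node w l h) D! D↓ E!@(_ , _ , l! , h!) (l≢h , l↓ , h↓) eq = contradiction
    (trans (sym (canonical D l D! D↓ l! l↓ (sym ∘ ⟦lo⟧≡ E! {D} _ D! (sym ∘ eq))))
      (canonical D h D! D↓ h! h↓ (sym ∘ ⟦hi⟧≡ E! {D} _ D! (sym ∘ eq)))) l≢h
  canonical D@(node v l h) E@(node w l′ h′) D!@(_ , _ , l! , h!) D↓@(l≢h , l↓ , h↓)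
    E!@(_ , _ , l′! , h′!) E↓@(l′≢h′ , l′↓ , h′↓) eq = byOrder (compare v w)
    (λ v<w → contradiction
      (trans (canonical l E l! l↓ E! E↓ (⟦lo⟧≡ D! {E} v<w E! eq))
        (sym (canonical h E h! h↓ E! E↓ (⟦hi⟧≡ D! {E} v<w E! eq)))) l≢h)
    (λ v≡w → node-cong v≡w
      (canonical l l′ l! l↓ l′! l′↓ (proj₁ (branches-≡ v≡w D! E! eq)))
      (canonical h h′ h! h↓ h′! h′↓ (proj₂ (branches-≡ v≡w D! E! eq))))
    (λ w<v → contradiction
      (trans (sym (canonical D l′ D! D↓ l′! l′↓ (sym ∘ ⟦lo⟧≡ E! {D} w<v D! (sym ∘ eq))))
        (canonical D h′ D! D↓ h′! h′↓ (sym ∘ ⟦hi⟧≡ E! {D} w<v D! (sym ∘ eq)))) l′≢h′)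
    where
    -- A function instead of a pattern match, so that the recursion on pairs of
    -- diagrams stays structural.
    byOrder : ∀ {A B C X : Set} → Tri A B C → (A → X) → (B → X) → (C → X) → X
    byOrder (tri< a _ _) f g h = f a
    byOrder (tri≈ _ b _) f g h = g b
    byOrder (tri> _ _ c) f g h = h c

    node-cong : ∀ {v w : Fin n} {l l′ h h′} → v ≡ w → l ≡ l′ → h ≡ h′ → node v l h ≡ node w l′ h′
    node-cong refl refl refl = refl

    branches-≡ : ∀ {v w l l′ h h′} → v ≡ w → Ordered (node v l h) → Ordered (node w l′ h′) →
      (∀ I → ⟦ node v l h ⟧ᴮ I ≡ ⟦ node w l′ h′ ⟧ᴮ I) →
      (∀ I → ⟦ l ⟧ᴮ I ≡ ⟦ l′ ⟧ᴮ I) × (∀ I → ⟦ h ⟧ᴮ I ≡ ⟦ h′ ⟧ᴮ I)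
    branches-≡ refl D! E! eq =
      (λ I → trans (sym (⟦lo⟧ D! I)) (trans (eq _) (⟦lo⟧ E! I))) ,
      (λ I → trans (sym (⟦hi⟧ D! I)) (trans (eq _) (⟦hi⟧ E! I)))

  -- The Boolean function of a diagram.

  ⟦_⟧ᴼ : OBDD → Interpretation n → Bool
  ⟦ D ⟧ᴼ = ⟦ diagram D ⟧ᴮ

  ⟦⟧ᴼ-injective : ∀ {D E} → (∀ I → ⟦ D ⟧ᴼ I ≡ ⟦ E ⟧ᴼ I) → D ≈ᴼ E
  ⟦⟧ᴼ-injective {D} {E} = canonical (diagram D) (diagram E) (ordered D) (reduced D) (ordered E) (reduced E)

  -- Boolean functions on interpretations, with pointwise operations.

  functions-rawSemiring : RawSemiring 0ℓ 0ℓ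
  functions-rawSemiring = record
    { Carrier = Interpretation n → Bool
    ; _≈_ = λ f g → ∀ I → f I ≡ g I
    ; _+_ = λ f g I → f I ∨ g I
    ; _*_ = λ f g I → f I ∧ g I
    ; 0#  = λ _ → false
    ; 1#  = λ _ → true
    }

  OBDD-isCommutativeSemiring : IsCommutativeSemiringOn OBDD-rawSemiring
  OBDD-isCommutativeSemiring = isCommutativeSemiring-transport OBDD-rawSemiring functions-rawSemiring
    record
      { isSemiringHomomorphism = semiringHomomorphism OBDD-rawSemiring functions-rawSemiring ⟦_⟧ᴼ
          (λ eq I → cong (λ D → ⟦ D ⟧ᴮ I) eq)
          (λ _ _ → ⟦fromFunction⟧ _) (⟦fromFunction⟧ _) (λ _ _ → ⟦fromFunction⟧ _) (⟦fromFunction⟧ _)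
      ; injective = λ {D} {E} → ⟦⟧ᴼ-injective {D} {E}
      }
    (Pointwise.isCommutativeSemiring (Interpretation n) SAT-isCommutativeSemiring)

  module _ (T : Formula n) (α : Literal n → OBDD)
    (α≈ : ∀ v → α (pos v) ≈ᴼ obdd (var v) × α (neg v) ≈ᴼ ¬ᴼ obdd (var v)) where

    OBDD-represents : Represents T (AMC OBDD-rawSemiring α T)
    OBDD-represents J = trans
      (AMC-homo OBDD-rawSemiring SAT-rawSemiring SAT-isCommutativeSemiring
        (semiringHomomorphism OBDD-rawSemiring SAT-rawSemiring (λ D → ⟦ D ⟧ᴼ J)
          (cong (λ D → ⟦ D ⟧ᴮ J))
          (λ _ _ → ⟦fromFunction⟧ _ J) (⟦fromFunction⟧ _ J) (λ _ _ → ⟦fromFunction⟧ _ J) (⟦fromFunction⟧ _ J))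
        {α} (λ _ → refl) T)
      (AMC-truth T J λ v →
        trans (cong (λ D → ⟦ D ⟧ᴮ J) (proj₁ (α≈ v))) (⟦fromFunction⟧ _ J) ,
        trans (cong (λ D → ⟦ D ⟧ᴮ J) (proj₂ (α≈ v)))
          (trans (⟦fromFunction⟧ _ J) (cong not (⟦fromFunction⟧ _ J))))

    OBDD-correct : AMC OBDD-rawSemiring α T ≈ᴼ obdd T × IsDiagramOf T (AMC OBDD-rawSemiring α T)
    OBDD-correct = ⟦⟧ᴼ-injective {AMC OBDD-rawSemiring α T} {obdd T} (λ I → trans (OBDD-represents I) (sym (⟦fromFunction⟧ _ I))) ,
      OBDD-represents ,
      λ E E-represents → ⟦⟧ᴼ-injective {E} {AMC OBDD-rawSemiring α T}
        λ I → trans (E-represents I) (sym (OBDD-represents I))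

------------------------------------------------------------------------
-- Finite sums and products of reals

open SetoidReasoning ℝ-setoid

module +ℝ where
  open IsCommutativeSemiring ℝ-isCommutativeSemiring using (+-isCommutativeMonoid)
  open Fold +-isCommutativeMonoid public

module *ℝ where
  open IsCommutativeSemiring ℝ-isCommutativeSemiring using (*-isCommutativeMonoid)
  open Fold *-isCommutativeMonoid public

open IsCommutativeSemiring ℝ-isCommutativeSemiring using ()
  renaming (+-identityˡ to +ℝ-identityˡ; +-identityʳ to +ℝ-identityʳ; *-identityˡ to *ℝ-identityˡ;
            *-identityʳ to *ℝ-identityʳ; zeroˡ to *ℝ-zeroˡ; zeroʳ to *ℝ-zeroʳ; *-assoc to *ℝ-assoc;
            +-assoc to +ℝ-assoc; +-comm to +ℝ-comm; distribʳ to *ℝ-distribʳ-+)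

≈ℝ-reflexive : ∀ {x y} → x ≡ y → x ≈ℝ y
≈ℝ-reflexive refl = ≈ℝ-refl

-ℝ-inverseʳ : ∀ x → x -ℝ x ≈ℝ 0ℝ
-ℝ-inverseʳ x = pointwise λ i → ℚ.+-inverseʳ (seq x i)

x-y≈0⇒x≈y : ∀ {x y} → x -ℝ y ≈ℝ 0ℝ → x ≈ℝ y
x-y≈0⇒x≈y {x} {y} x-y≈0 = begin
  x               ≈⟨ pointwise (λ i → solve 2 (λ a b → a := (a :- b) :+ b) refl (seq x i) (seq y i)) ⟩
  x -ℝ y +ℝ y     ≈⟨ +ℝ-cong x-y≈0 ≈ℝ-refl ⟩
  0ℝ +ℝ y         ≈⟨ +ℝ-identityˡ y ⟩
  y               ∎

infix 4 _≟ᴹ_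
_≟ᴹ_ : (μ ν : Monomial n) → Dec (μ ≡ ν)
_≟ᴹ_ = Vec.≡-dec ℕ._≟_

-- The product of monomials adds the exponents.

infixl 6 _+ᴹ_
_+ᴹ_ : Monomial n → Monomial n → Monomial n
_+ᴹ_ = Vec.zipWith ℕ._+_

-- The monomial 1.

0ᴹ : Monomial n
0ᴹ = Vec.replicate _ 0

------------------------------------------------------------------------
-- Polynomials as linear functionals

-- The linear functional of a polynomial: h μ is substituted for each
-- monomial μ.

⟪_,_⟫ : Poly n → (Monomial n → ℝ) → ℝ
⟪ P , h ⟫ = ∑ℝ (map (λ (a , μ) → a *ℝ h μ) P)

⟪⟫-cong : (P : Poly n) {h h′ : Monomial n → ℝ} → (∀ μ → h μ ≈ℝ h′ μ) → ⟪ P , h ⟫ ≈ℝ ⟪ P , h′ ⟫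
⟪⟫-cong P h≈h′ = +ℝ.fold-cong P λ {t} _ → *ℝ-congˡ (h≈h′ (proj₂ t))

module _ (h : Monomial n → ℝ) where

  ⟪⟫-++ : ∀ P Q → ⟪ P ++ Q , h ⟫ ≈ℝ ⟪ P , h ⟫ +ℝ ⟪ Q , h ⟫
  ⟪⟫-++ []            Q = ≈ℝ-sym (+ℝ-identityˡ _)
  ⟪⟫-++ ((a , μ) ∷ P) Q = ≈ℝ-trans (+ℝ-cong ≈ℝ-refl (⟪⟫-++ P Q)) (≈ℝ-sym (+ℝ-assoc _ _ _))

  ⟪⟫-neg : ∀ P → ⟪ map (λ (b , ν) → -ℝ b , ν) P , h ⟫ ≈ℝ -ℝ ⟪ P , h ⟫
  ⟪⟫-neg []            = pointwise λ _ → refl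
  ⟪⟫-neg ((a , μ) ∷ P) = ≈ℝ-trans (+ℝ-cong ≈ℝ-refl (⟪⟫-neg P))
    (pointwise λ i → solve 3 (λ a h s → (:- a) :* h :+ (:- s) := :- (a :* h :+ s)) refl
      (seq a i) (seq (h μ) i) (seq ⟪ P , h ⟫ i))

  ⟪⟫-minus : ∀ P Q → ⟪ P -ᴾ Q , h ⟫ ≈ℝ ⟪ P , h ⟫ -ℝ ⟪ Q , h ⟫
  ⟪⟫-minus P Q = ≈ℝ-trans (⟪⟫-++ P (map (λ (b , ν) → -ℝ b , ν) Q)) (+ℝ-cong ≈ℝ-refl (⟪⟫-neg Q))

  ⟪⟫-*ʳ : ∀ P r → ⟪ P , (λ μ → r *ℝ h μ) ⟫ ≈ℝ r *ℝ ⟪ P , h ⟫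
  ⟪⟫-*ʳ []            r = ≈ℝ-sym (*ℝ-zeroʳ r)
  ⟪⟫-*ʳ ((a , μ) ∷ P) r = ≈ℝ-trans (+ℝ-cong ≈ℝ-refl (⟪⟫-*ʳ P r))
    (pointwise λ i → solve 4 (λ a r h s → a :* (r :* h) :+ r :* s := r :* (a :* h :+ s)) refl
      (seq a i) (seq r i) (seq (h μ) i) (seq ⟪ P , h ⟫ i))

  ⟪⟫-shift : ∀ a μ Q → ⟪ map (λ (b , ν) → a *ℝ b , μ +ᴹ ν) Q , h ⟫ ≈ℝ a *ℝ ⟪ Q , (λ ν → h (μ +ᴹ ν)) ⟫
  ⟪⟫-shift a μ []            = ≈ℝ-sym (*ℝ-zeroʳ a)
  ⟪⟫-shift a μ ((b , ν) ∷ Q) = ≈ℝ-trans (+ℝ-cong ≈ℝ-refl (⟪⟫-shift a μ Q))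
    (pointwise λ i → solve 4 (λ a b h s → (a :* b) :* h :+ a :* s := a :* (b :* h :+ s)) refl
      (seq a i) (seq b i) (seq (h (μ +ᴹ ν)) i) (seq ⟪ Q , (λ ν → h (μ +ᴹ ν)) ⟫ i))

  -- The product of polynomials becomes an iterated sum.

  ⟪⟫-* : ∀ P Q → ⟪ P *ᴾ Q , h ⟫ ≈ℝ ⟪ P , (λ μ → ⟪ Q , (λ ν → h (μ +ᴹ ν)) ⟫) ⟫
  ⟪⟫-* []            Q = ≈ℝ-refl
  ⟪⟫-* ((a , μ) ∷ P) Q = ≈ℝ-trans (⟪⟫-++ (map (λ (b , ν) → a *ℝ b , μ +ᴹ ν) Q) (P *ᴾ Q))
    (+ℝ-cong (⟪⟫-shift a μ Q) (⟪⟫-* P Q))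

⟪⟫-+ʳ : (P : Poly n) (h h′ : Monomial n → ℝ) → ⟪ P , (λ μ → h μ +ℝ h′ μ) ⟫ ≈ℝ ⟪ P , h ⟫ +ℝ ⟪ P , h′ ⟫
⟪⟫-+ʳ P h h′ = ≈ℝ-trans
  (+ℝ.fold-cong P λ {t} _ → pointwise λ i → ℚ.*-distribˡ-+ (seq (proj₁ t) i) (seq (h (proj₂ t)) i) (seq (h′ (proj₂ t)) i))
  (+ℝ.fold-∙ (λ (a , μ) → a *ℝ h μ) (λ (a , μ) → a *ℝ h′ μ) P)

⟪⟫-0ʳ : (P : Poly n) {h : Monomial n → ℝ} → (∀ μ → h μ ≈ℝ 0ℝ) → ⟪ P , h ⟫ ≈ℝ 0ℝ
⟪⟫-0ʳ P h≈0 = +ℝ.fold-ε P λ {t} _ → ≈ℝ-trans (*ℝ-congˡ (h≈0 (proj₂ t))) (*ℝ-zeroʳ _)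

-- Interchange of two finite sums.

⟪⟫-swap : ∀ (P Q : Poly n) (h : Monomial n → Monomial n → ℝ) →
  ⟪ P , (λ μ → ⟪ Q , h μ ⟫) ⟫ ≈ℝ ⟪ Q , (λ ν → ⟪ P , (λ μ → h μ ν) ⟫) ⟫
⟪⟫-swap []            Q h = ≈ℝ-sym (⟪⟫-0ʳ Q λ _ → ≈ℝ-refl)
⟪⟫-swap ((a , μ) ∷ P) Q h = ≈ℝ-trans
  (+ℝ-cong (≈ℝ-sym (⟪⟫-*ʳ (h μ) Q a)) (⟪⟫-swap P Q h))
  (≈ℝ-sym (⟪⟫-+ʳ Q (λ ν → a *ℝ h μ ν) (λ ν → ⟪ P , (λ μ → h μ ν) ⟫)))

-- The indicator function of a monomial; pairing with it gives the coefficient.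

δ : Monomial n → Monomial n → ℝ
δ μ ν = if does (ν ≟ᴹ μ) then 1ℝ else 0ℝ

δ-diagonal : (μ : Monomial n) → δ μ μ ≡ 1ℝ
δ-diagonal μ = cong (if_then 1ℝ else 0ℝ) (dec-true (μ ≟ᴹ μ) refl)

δ-off-diagonal : {μ ν : Monomial n} → ν ≢ μ → δ μ ν ≡ 0ℝ
δ-off-diagonal {μ = μ} {ν} ν≢μ = cong (if_then 1ℝ else 0ℝ) (dec-false (ν ≟ᴹ μ) ν≢μ)

coeff≈⟪⟫ : (P : Poly n) (μ : Monomial n) → coeff P μ ≈ℝ ⟪ P , δ μ ⟫
coeff≈⟪⟫ []            μ = ≈ℝ-refl
coeff≈⟪⟫ ((a , ν) ∷ P) μ with ν ≟ᴹ μ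
... | yes _ = +ℝ-cong (≈ℝ-sym (*ℝ-identityʳ a)) (coeff≈⟪⟫ P μ)
... | no _  = ≈ℝ-trans (coeff≈⟪⟫ P μ)
  (≈ℝ-sym (≈ℝ-trans (+ℝ-cong (*ℝ-zeroʳ a) ≈ℝ-refl) (+ℝ-identityˡ _)))

-- The monomials of the terms of P, possibly with repetitions.

monomials : Poly n → List (Monomial n)
monomials = map proj₂

-- Terms with the same monomial are collected: L lists, once each, at least
-- the monomials that occur in P.

⟪⟫-expand : ∀ {L} → Unique L → (P : Poly n) → (∀ {t} → t ∈ P → proj₂ t ∈ L) → ∀ h →
  ⟪ P , h ⟫ ≈ℝ ∑ℝ (map (λ ν → coeff P ν *ℝ h ν) L)
⟪⟫-expand {L = L} L! P P⊆L h = ≈ℝ-trans (go P P⊆L)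
  (+ℝ.fold-cong L λ {ν} _ → *ℝ-congʳ (≈ℝ-sym (coeff≈⟪⟫ P ν)))
  where
  go : ∀ P → (∀ {t} → t ∈ P → proj₂ t ∈ L) → ⟪ P , h ⟫ ≈ℝ ∑ℝ (map (λ ν → ⟪ P , δ ν ⟫ *ℝ h ν) L)
  go []            _   = ≈ℝ-sym (+ℝ.fold-ε L λ _ → *ℝ-zeroˡ _)
  go ((a , μ) ∷ P) P⊆L = begin
    a *ℝ h μ +ℝ ⟪ P , h ⟫
      ≈⟨ +ℝ-cong head (go P (P⊆L ∘ there)) ⟩
    ∑ℝ (map (λ ν → (a *ℝ δ ν μ) *ℝ h ν) L) +ℝ ∑ℝ (map (λ ν → ⟪ P , δ ν ⟫ *ℝ h ν) L)
      ≈⟨ +ℝ.fold-∙ (λ ν → (a *ℝ δ ν μ) *ℝ h ν) (λ ν → ⟪ P , δ ν ⟫ *ℝ h ν) L ⟨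
    ∑ℝ (map (λ ν → (a *ℝ δ ν μ) *ℝ h ν +ℝ ⟪ P , δ ν ⟫ *ℝ h ν) L)
      ≈⟨ +ℝ.fold-cong L (λ {ν} _ → ≈ℝ-sym (*ℝ-distribʳ-+ (h ν) (a *ℝ δ ν μ) ⟪ P , δ ν ⟫)) ⟩
    ∑ℝ (map (λ ν → (a *ℝ δ ν μ +ℝ ⟪ P , δ ν ⟫) *ℝ h ν) L) ∎
    where
    -- Among the monomials of L, only μ itself contributes to the first term.
    δ-vanishes : ∀ {ν} → ν ≢ μ → (a *ℝ δ ν μ) *ℝ h ν ≈ℝ 0ℝ
    δ-vanishes {ν} ν≢μ rewrite δ-off-diagonal {μ = ν} {μ} (ν≢μ ∘ sym) =
      ≈ℝ-trans (*ℝ-congʳ (*ℝ-zeroʳ a)) (*ℝ-zeroˡ (h ν))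
    δ-unit : (a *ℝ δ μ μ) *ℝ h μ ≈ℝ a *ℝ h μ
    δ-unit rewrite δ-diagonal μ = *ℝ-congʳ (*ℝ-identityʳ a)
    head : a *ℝ h μ ≈ℝ ∑ℝ (map (λ ν → (a *ℝ δ ν μ) *ℝ h ν) L)
    head = ≈ℝ-sym (≈ℝ-trans (+ℝ.fold-single L! (P⊆L (here refl)) δ-vanishes) δ-unit)

private
  distinct : List (Monomial n) → List (Monomial n)
  distinct = List.deduplicate _≟ᴹ_

-- The functional of a polynomial depends only on its coefficients.

⟪⟫-resp-≈ᴾ : {P Q : Poly n} → P ≈ᴾ Q → ∀ h → ⟪ P , h ⟫ ≈ℝ ⟪ Q , h ⟫
⟪⟫-resp-≈ᴾ {P = P} {Q} P≈Q h = begin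
  ⟪ P , h ⟫                                ≈⟨ ⟪⟫-expand (DecUnique.deduplicate-! _≟ᴹ_ L) P
                                                (∈.∈-deduplicate⁺ _≟ᴹ_ ∘ ∈.∈-++⁺ˡ ∘ ∈.∈-map⁺ proj₂) h ⟩
  ∑ℝ (map (λ ν → coeff P ν *ℝ h ν) (distinct L)) ≈⟨ +ℝ.fold-cong (distinct L) (λ {ν} _ → *ℝ-congʳ (P≈Q ν)) ⟩
  ∑ℝ (map (λ ν → coeff Q ν *ℝ h ν) (distinct L)) ≈⟨ ⟪⟫-expand (DecUnique.deduplicate-! _≟ᴹ_ L) Q
                                                (∈.∈-deduplicate⁺ _≟ᴹ_ ∘ ∈.∈-++⁺ʳ (monomials P) ∘ ∈.∈-map⁺ proj₂) h ⟨
  ⟪ Q , h ⟫                                ∎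
  where L = monomials P ++ monomials Q

-- Only the products of the coefficients with the values of h matter.

⟪⟫-local : (P : Poly n) (h h′ : Monomial n → ℝ) →
  (∀ {ν} → ν ∈ monomials P → coeff P ν *ℝ h ν ≈ℝ coeff P ν *ℝ h′ ν) → ⟪ P , h ⟫ ≈ℝ ⟪ P , h′ ⟫
⟪⟫-local P h h′ eq = begin
  ⟪ P , h ⟫                                      ≈⟨ expand h ⟩
  ∑ℝ (map (λ ν → coeff P ν *ℝ h ν) L)            ≈⟨ +ℝ.fold-cong L (eq ∘ ∈.∈-deduplicate⁻ _≟ᴹ_ (monomials P)) ⟩
  ∑ℝ (map (λ ν → coeff P ν *ℝ h′ ν) L)           ≈⟨ expand h′ ⟨
  ⟪ P , h′ ⟫                                     ∎
  where
  L = distinct (monomials P)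
  expand = ⟪⟫-expand (DecUnique.deduplicate-! _≟ᴹ_ (monomials P)) P
    (∈.∈-deduplicate⁺ _≟ᴹ_ ∘ ∈.∈-map⁺ proj₂)

⟪⟫-injective : {P Q : Poly n} → (∀ h → ⟪ P , h ⟫ ≈ℝ ⟪ Q , h ⟫) → P ≈ᴾ Q
⟪⟫-injective {P = P} {Q} eq μ = ≈ℝ-trans (coeff≈⟪⟫ P μ) (≈ℝ-trans (eq (δ μ)) (≈ℝ-sym (coeff≈⟪⟫ Q μ)))

coeff-minus : (P Q : Poly n) → ∀ μ → coeff (P -ᴾ Q) μ ≈ℝ coeff P μ -ℝ coeff Q μ
coeff-minus P Q μ = begin
  coeff (P -ᴾ Q) μ              ≈⟨ coeff≈⟪⟫ (P -ᴾ Q) μ ⟩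
  ⟪ P -ᴾ Q , δ μ ⟫              ≈⟨ ⟪⟫-minus (δ μ) P Q ⟩
  ⟪ P , δ μ ⟫ -ℝ ⟪ Q , δ μ ⟫    ≈⟨ +ℝ-cong (coeff≈⟪⟫ P μ) (-ℝ-cong (coeff≈⟪⟫ Q μ)) ⟨
  coeff P μ -ℝ coeff Q μ        ∎

-ᴾ-cong : {P P′ Q Q′ : Poly n} → P ≈ᴾ P′ → Q ≈ᴾ Q′ → P -ᴾ Q ≈ᴾ P′ -ᴾ Q′
-ᴾ-cong {P = P} {P′} {Q} {Q′} P≈P′ Q≈Q′ μ = begin
  coeff (P -ᴾ Q) μ              ≈⟨ coeff-minus P Q μ ⟩
  coeff P μ -ℝ coeff Q μ        ≈⟨ +ℝ-cong (P≈P′ μ) (-ℝ-cong (Q≈Q′ μ)) ⟩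
  coeff P′ μ -ℝ coeff Q′ μ      ≈⟨ coeff-minus P′ Q′ μ ⟨
  coeff (P′ -ᴾ Q′) μ            ∎

≈ᴾ-isEquivalence : IsEquivalence (_≈ᴾ_ {n})
≈ᴾ-isEquivalence = record
  { refl  = λ _ → ≈ℝ-refl
  ; sym   = λ P≈Q μ → ≈ℝ-sym (P≈Q μ)
  ; trans = λ P≈Q Q≈R μ → ≈ℝ-trans (P≈Q μ) (Q≈R μ)
  }

SENS-isCommutativeSemiring : IsCommutativeSemiringOn (SENS-rawSemiring n)
SENS-isCommutativeSemiring {n} = commutativeSemiring (SENS-rawSemiring n) ≈ᴾ-isEquivalence
  (λ {P} {P′} {Q} {Q′} → +-cong {P} {P′} {Q} {Q′}) +-assoc +-comm (λ P μ → ≈ℝ-refl)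
  (λ {P} {P′} {Q} {Q′} → *-cong {P} {P′} {Q} {Q′}) *-assoc *-comm *-identityˡ distribʳ (λ _ _ → ≈ℝ-refl)
  where
  -- ⟪ P *ᴾ Q , h ⟫ is ⟪ P , shifted Q h ⟫.

  shifted : Poly n → (Monomial n → ℝ) → Monomial n → ℝ
  shifted Q h μ = ⟪ Q , (λ ν → h (μ +ᴹ ν)) ⟫

  +-cong : ∀ {P P′ Q Q′} → P ≈ᴾ P′ → Q ≈ᴾ Q′ → P +ᴾ Q ≈ᴾ P′ +ᴾ Q′
  +-cong {P} {P′} {Q} {Q′} P≈P′ Q≈Q′ = ⟪⟫-injective {P = P +ᴾ Q} {P′ +ᴾ Q′} λ h → begin
    ⟪ P +ᴾ Q , h ⟫              ≈⟨ ⟪⟫-++ h P Q ⟩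
    ⟪ P , h ⟫ +ℝ ⟪ Q , h ⟫      ≈⟨ +ℝ-cong (⟪⟫-resp-≈ᴾ {P = P} {P′} P≈P′ h) (⟪⟫-resp-≈ᴾ {P = Q} {Q′} Q≈Q′ h) ⟩
    ⟪ P′ , h ⟫ +ℝ ⟪ Q′ , h ⟫    ≈⟨ ⟪⟫-++ h P′ Q′ ⟨
    ⟪ P′ +ᴾ Q′ , h ⟫            ∎

  +-assoc : ∀ P Q R → (P +ᴾ Q) +ᴾ R ≈ᴾ P +ᴾ (Q +ᴾ R)
  +-assoc P Q R μ rewrite List.++-assoc P Q R = ≈ℝ-refl

  +-comm : ∀ P Q → P +ᴾ Q ≈ᴾ Q +ᴾ P
  +-comm P Q = ⟪⟫-injective {P = P +ᴾ Q} {Q +ᴾ P} λ h →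
    ≈ℝ-trans (⟪⟫-++ h P Q) (≈ℝ-trans (+ℝ-comm _ _) (≈ℝ-sym (⟪⟫-++ h Q P)))

  *-cong : ∀ {P P′ Q Q′} → P ≈ᴾ P′ → Q ≈ᴾ Q′ → P *ᴾ Q ≈ᴾ P′ *ᴾ Q′
  *-cong {P} {P′} {Q} {Q′} P≈P′ Q≈Q′ = ⟪⟫-injective {P = P *ᴾ Q} {P′ *ᴾ Q′} λ h → begin
    ⟪ P *ᴾ Q , h ⟫            ≈⟨ ⟪⟫-* h P Q ⟩
    ⟪ P , shifted Q h ⟫       ≈⟨ ⟪⟫-resp-≈ᴾ {P = P} {P′} P≈P′ (shifted Q h) ⟩
    ⟪ P′ , shifted Q h ⟫      ≈⟨ ⟪⟫-cong P′ (λ μ → ⟪⟫-resp-≈ᴾ {P = Q} {Q′} Q≈Q′ (λ ν → h (μ +ᴹ ν))) ⟩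
    ⟪ P′ , shifted Q′ h ⟫     ≈⟨ ⟪⟫-* h P′ Q′ ⟨
    ⟪ P′ *ᴾ Q′ , h ⟫          ∎

  *-assoc : ∀ P Q R → (P *ᴾ Q) *ᴾ R ≈ᴾ P *ᴾ (Q *ᴾ R)
  *-assoc P Q R = ⟪⟫-injective {P = (P *ᴾ Q) *ᴾ R} {P *ᴾ (Q *ᴾ R)} λ h → begin
    ⟪ (P *ᴾ Q) *ᴾ R , h ⟫
      ≈⟨ ⟪⟫-* h (P *ᴾ Q) R ⟩
    ⟪ P *ᴾ Q , shifted R h ⟫
      ≈⟨ ⟪⟫-* (shifted R h) P Q ⟩
    ⟪ P , (λ μ → ⟪ Q , (λ ν → ⟪ R , (λ ρ → h ((μ +ᴹ ν) +ᴹ ρ)) ⟫) ⟫) ⟫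
      ≈⟨ ⟪⟫-cong P (λ μ → ⟪⟫-cong Q λ ν → ⟪⟫-cong R λ ρ →
           subst (λ κ → h ((μ +ᴹ ν) +ᴹ ρ) ≈ℝ h κ) (Vec.zipWith-assoc ℕ.+-assoc μ ν ρ) ≈ℝ-refl) ⟩
    ⟪ P , (λ μ → ⟪ Q , (λ ν → ⟪ R , (λ ρ → h (μ +ᴹ (ν +ᴹ ρ))) ⟫) ⟫) ⟫
      ≈⟨ ⟪⟫-cong P (λ μ → ⟪⟫-* (λ ν → h (μ +ᴹ ν)) Q R) ⟨
    ⟪ P , shifted (Q *ᴾ R) h ⟫
      ≈⟨ ⟪⟫-* h P (Q *ᴾ R) ⟨
    ⟪ P *ᴾ (Q *ᴾ R) , h ⟫ ∎

  *-comm : ∀ P Q → P *ᴾ Q ≈ᴾ Q *ᴾ P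
  *-comm P Q = ⟪⟫-injective {P = P *ᴾ Q} {Q *ᴾ P} λ h → begin
    ⟪ P *ᴾ Q , h ⟫                                  ≈⟨ ⟪⟫-* h P Q ⟩
    ⟪ P , (λ μ → ⟪ Q , (λ ν → h (μ +ᴹ ν)) ⟫) ⟫      ≈⟨ ⟪⟫-swap P Q (λ μ ν → h (μ +ᴹ ν)) ⟩
    ⟪ Q , (λ ν → ⟪ P , (λ μ → h (μ +ᴹ ν)) ⟫) ⟫      ≈⟨ ⟪⟫-cong Q (λ ν → ⟪⟫-cong P λ μ →
                                                         subst (λ κ → h (μ +ᴹ ν) ≈ℝ h κ) (Vec.zipWith-comm ℕ.+-comm μ ν) ≈ℝ-refl) ⟩
    ⟪ Q , (λ ν → ⟪ P , (λ μ → h (ν +ᴹ μ)) ⟫) ⟫      ≈⟨ ⟪⟫-* h Q P ⟨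
    ⟪ Q *ᴾ P , h ⟫                                  ∎

  *-identityˡ : ∀ P → constᴾ 1ℝ *ᴾ P ≈ᴾ P
  *-identityˡ P = ⟪⟫-injective {P = constᴾ 1ℝ *ᴾ P} {P} λ h → begin
    ⟪ constᴾ 1ℝ *ᴾ P , h ⟫                          ≈⟨ ⟪⟫-* h (constᴾ 1ℝ) P ⟩
    1ℝ *ℝ shifted P h 0ᴹ +ℝ 0ℝ                      ≈⟨ ≈ℝ-trans (+ℝ-identityʳ _) (*ℝ-identityˡ _) ⟩
    shifted P h 0ᴹ                                  ≈⟨ ⟪⟫-cong P (λ μ →
                                                         subst (λ κ → h (0ᴹ +ᴹ μ) ≈ℝ h κ) (Vec.zipWith-identityˡ ℕ.+-identityˡ μ) ≈ℝ-refl) ⟩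
    ⟪ P , h ⟫                                       ∎

  distribʳ : ∀ P Q R → (Q +ᴾ R) *ᴾ P ≈ᴾ (Q *ᴾ P) +ᴾ (R *ᴾ P)
  distribʳ P Q R = ⟪⟫-injective {P = (Q +ᴾ R) *ᴾ P} {(Q *ᴾ P) +ᴾ (R *ᴾ P)} λ h → begin
    ⟪ (Q +ᴾ R) *ᴾ P , h ⟫                           ≈⟨ ⟪⟫-* h (Q +ᴾ R) P ⟩
    ⟪ Q +ᴾ R , shifted P h ⟫                        ≈⟨ ⟪⟫-++ (shifted P h) Q R ⟩
    ⟪ Q , shifted P h ⟫ +ℝ ⟪ R , shifted P h ⟫      ≈⟨ +ℝ-cong (⟪⟫-* h Q P) (⟪⟫-* h R P) ⟨
    ⟪ Q *ᴾ P , h ⟫ +ℝ ⟪ R *ᴾ P , h ⟫                ≈⟨ ⟪⟫-++ h (Q *ᴾ P) (R *ᴾ P) ⟨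
    ⟪ (Q *ᴾ P) +ᴾ (R *ᴾ P) , h ⟫                    ∎

------------------------------------------------------------------------
-- Evaluation of polynomials

^ℝ-cong : ∀ {x y} k → x ≈ℝ y → x ^ℝ k ≈ℝ y ^ℝ k
^ℝ-cong zero    x≈y = ≈ℝ-refl
^ℝ-cong (suc k) x≈y = *ℝ-cong x≈y (^ℝ-cong k x≈y)

^ℝ-+ : ∀ x j k → x ^ℝ (j ℕ.+ k) ≈ℝ x ^ℝ j *ℝ x ^ℝ k
^ℝ-+ x zero    k = ≈ℝ-sym (*ℝ-identityˡ _)
^ℝ-+ x (suc j) k = ≈ℝ-trans (*ℝ-congˡ (^ℝ-+ x j k)) (≈ℝ-sym (*ℝ-assoc x (x ^ℝ j) (x ^ℝ k)))

1^ℝ : ∀ k → 1ℝ ^ℝ k ≈ℝ 1ℝ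
1^ℝ zero    = ≈ℝ-refl
1^ℝ (suc k) = ≈ℝ-trans (*ℝ-identityˡ _) (1^ℝ k)

-- The value of a monomial at the point x.

monomialValue : (Fin n → ℝ) → Monomial n → ℝ
monomialValue {n} x μ = ∏ℝ (map (λ v → x v ^ℝ lookup μ v) (allFin n))

-- For a product of functions of μ and of ν, the iterated sum factors.

⟪⟫-product : ∀ (P Q : Poly n) f g → ⟪ P , (λ μ → ⟪ Q , (λ ν → f μ *ℝ g ν) ⟫) ⟫ ≈ℝ ⟪ P , f ⟫ *ℝ ⟪ Q , g ⟫
⟪⟫-product P Q f g = begin
  ⟪ P , (λ μ → ⟪ Q , (λ ν → f μ *ℝ g ν) ⟫) ⟫      ≈⟨ ⟪⟫-cong P (λ μ → ⟪⟫-*ʳ g Q (f μ)) ⟩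
  ⟪ P , (λ μ → f μ *ℝ ⟪ Q , g ⟫) ⟫                ≈⟨ ⟪⟫-cong P (λ μ → *ℝ-comm (f μ) ⟪ Q , g ⟫) ⟩
  ⟪ P , (λ μ → ⟪ Q , g ⟫ *ℝ f μ) ⟫                ≈⟨ ⟪⟫-*ʳ f P ⟪ Q , g ⟫ ⟩
  ⟪ Q , g ⟫ *ℝ ⟪ P , f ⟫                          ≈⟨ *ℝ-comm ⟪ Q , g ⟫ ⟪ P , f ⟫ ⟩
  ⟪ P , f ⟫ *ℝ ⟪ Q , g ⟫                          ∎

module Evaluation (x : Fin n → ℝ) where

  value : Monomial n → ℝ
  value = monomialValue x

  value-+ : ∀ μ ν → value (μ +ᴹ ν) ≈ℝ value μ *ℝ value ν
  value-+ μ ν = ≈ℝ-trans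
    (*ℝ.fold-cong (allFin n) λ {v} _ →
      subst (λ k → x v ^ℝ k ≈ℝ x v ^ℝ lookup μ v *ℝ x v ^ℝ lookup ν v)
        (sym (Vec.lookup-zipWith ℕ._+_ v μ ν)) (^ℝ-+ (x v) (lookup μ v) (lookup ν v)))
    (*ℝ.fold-∙ (λ v → x v ^ℝ lookup μ v) (λ v → x v ^ℝ lookup ν v) (allFin n))

  value-0 : value 0ᴹ ≈ℝ 1ℝ
  value-0 = *ℝ.fold-ε (allFin n) λ {v} _ →
    subst (λ k → x v ^ℝ k ≈ℝ 1ℝ) (sym (Vec.lookup-replicate v 0)) ≈ℝ-refl

  evaluate-const : ∀ a → evaluate (constᴾ a) x ≈ℝ a
  evaluate-const a = begin
    a *ℝ value 0ᴹ +ℝ 0ℝ    ≈⟨ +ℝ-identityʳ _ ⟩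
    a *ℝ value 0ᴹ          ≈⟨ *ℝ-congˡ value-0 ⟩
    a *ℝ 1ℝ                ≈⟨ *ℝ-identityʳ a ⟩
    a                      ∎

  evaluate-var : ∀ v → evaluate (varᴾ v) x ≈ℝ x v
  evaluate-var v = begin
    1ℝ *ℝ value e +ℝ 0ℝ    ≈⟨ ≈ℝ-trans (+ℝ-identityʳ _) (*ℝ-identityˡ _) ⟩
    value e                ≈⟨ *ℝ.fold-single (Unique.allFin⁺ n) (∈.∈-allFin v) (λ {u} u≢v →
                                subst (λ k → x u ^ℝ k ≈ℝ 1ℝ)
                                  (sym (trans (Vec.lookup∘update′ u≢v 0ᴹ 1) (Vec.lookup-replicate u 0))) ≈ℝ-refl) ⟩
    x v ^ℝ lookup e v      ≡⟨ cong (x v ^ℝ_) (Vec.lookup∘update v 0ᴹ 1) ⟩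
    x v *ℝ 1ℝ              ≈⟨ *ℝ-identityʳ (x v) ⟩
    x v                    ∎
    where
    e : Monomial n
    e = 0ᴹ [ v ]≔ 1

  evaluate-1-var : ∀ v → evaluate (constᴾ 1ℝ -ᴾ varᴾ v) x ≈ℝ 1ℝ -ℝ x v
  evaluate-1-var v = ≈ℝ-trans (⟪⟫-minus value (constᴾ 1ℝ) (varᴾ v))
    (+ℝ-cong (evaluate-const 1ℝ) (-ℝ-cong (evaluate-var v)))

  open Morphisms.SemiringMorphisms (SENS-rawSemiring n) ℝ-rawSemiring

  evaluate-* : ∀ P Q → evaluate (P *ᴾ Q) x ≈ℝ evaluate P x *ℝ evaluate Q x
  evaluate-* P Q = begin
    ⟪ P *ᴾ Q , value ⟫                                  ≈⟨ ⟪⟫-* value P Q ⟩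
    ⟪ P , (λ μ → ⟪ Q , (λ ν → value (μ +ᴹ ν)) ⟫) ⟫      ≈⟨ ⟪⟫-cong P (λ μ → ⟪⟫-cong Q (value-+ μ)) ⟩
    ⟪ P , (λ μ → ⟪ Q , (λ ν → value μ *ℝ value ν) ⟫) ⟫  ≈⟨ ⟪⟫-product P Q value value ⟩
    ⟪ P , value ⟫ *ℝ ⟪ Q , value ⟫                      ∎

  evaluate-isSemiringHomomorphism : IsSemiringHomomorphism (λ P → evaluate P x)
  evaluate-isSemiringHomomorphism = semiringHomomorphism (SENS-rawSemiring n) ℝ-rawSemiring (λ P → evaluate P x)
    (λ {P} {Q} P≈Q → ⟪⟫-resp-≈ᴾ {P = P} {Q} P≈Q value)
    (⟪⟫-++ value) ≈ℝ-refl evaluate-* (evaluate-const 1ℝ)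

-- Evaluation at constant points separates variables and constants.

varᴾ≉constᴾ : ∀ (v : Fin n) {a} → ¬ (varᴾ v ≈ᴾ constᴾ a)
varᴾ≉constᴾ {n} v {a} var≈const = 0≉1 (≈ℝ-trans (at 0ℝ) (≈ℝ-sym (at 1ℝ)))
  where
  at : ∀ r → r ≈ℝ a
  at r = begin
    r                             ≈⟨ evaluate-var v ⟨
    evaluate (varᴾ v) (λ _ → r)   ≈⟨ ⟪⟫-resp-≈ᴾ {P = varᴾ v} {constᴾ {n} a} var≈const value ⟩
    evaluate (constᴾ {n} a) (λ _ → r) ≈⟨ evaluate-const a ⟩
    a                              ∎
    where open Evaluation {n} (λ _ → r)

constᴾ-injective : ∀ {a b} → constᴾ {n} a ≈ᴾ constᴾ {n} b → a ≈ℝ b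
constᴾ-injective {n} {a} {b} a≈b = begin
  a                               ≈⟨ evaluate-const a ⟨
  evaluate (constᴾ {n} a) (λ _ → 0ℝ)  ≈⟨ ⟪⟫-resp-≈ᴾ {P = constᴾ {n} a} {constᴾ {n} b} a≈b value ⟩
  evaluate (constᴾ {n} b) (λ _ → 0ℝ)  ≈⟨ evaluate-const b ⟩
  b                                ∎
  where open Evaluation {n} (λ _ → 0ℝ)

------------------------------------------------------------------------
-- Differentiation and dual numbers

-- Dual numbers: (a , b) stands for a + b ε with ε² = 0.

Dual-rawSemiring : RawSemiring 0ℓ 0ℓ
Dual-rawSemiring = record
  { Carrier = ℝ × ℝ
  ; _≈_     = λ (a₁ , a₂) (b₁ , b₂) → (a₁ ≈ℝ b₁) × (a₂ ≈ℝ b₂)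
  ; _+_     = λ (a₁ , a₂) (b₁ , b₂) → a₁ +ℝ b₁ , a₂ +ℝ b₂
  ; _*_     = λ (a₁ , a₂) (b₁ , b₂) → a₁ *ℝ b₁ , a₁ *ℝ b₂ +ℝ a₂ *ℝ b₁
  ; 0#      = 0ℝ , 0ℝ
  ; 1#      = 1ℝ , 0ℝ
  }

Dual-isCommutativeSemiring : IsCommutativeSemiringOn Dual-rawSemiring
Dual-isCommutativeSemiring = commutativeSemiring Dual-rawSemiring
  record
    { refl  = ≈ℝ-refl , ≈ℝ-refl
    ; sym   = λ (p , q) → ≈ℝ-sym p , ≈ℝ-sym q
    ; trans = λ (p , q) (p′ , q′) → ≈ℝ-trans p p′ , ≈ℝ-trans q q′
    }
  (λ (p , q) (p′ , q′) → +ℝ-cong p p′ , +ℝ-cong q q′)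
  (λ (a , a′) (b , b′) (c , c′) → +ℝ-assoc a b c , +ℝ-assoc a′ b′ c′)
  (λ (a , a′) (b , b′) → +ℝ-comm a b , +ℝ-comm a′ b′)
  (λ (a , a′) → +ℝ-identityˡ a , +ℝ-identityˡ a′)
  (λ (p , q) (p′ , q′) → *ℝ-cong p p′ , +ℝ-cong (*ℝ-cong p q′) (*ℝ-cong q p′))
  (λ (a , a′) (b , b′) (c , c′) → *ℝ-assoc a b c , pointwise λ i →
    solve 6 (λ a a′ b b′ c c′ → (a :* b) :* c′ :+ (a :* b′ :+ a′ :* b) :* c :=
                                a :* (b :* c′ :+ b′ :* c) :+ a′ :* (b :* c)) refl
      (seq a i) (seq a′ i) (seq b i) (seq b′ i) (seq c i) (seq c′ i))
  (λ (a , a′) (b , b′) → *ℝ-comm a b , pointwise λ i →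
    solve 4 (λ a a′ b b′ → a :* b′ :+ a′ :* b := b :* a′ :+ b′ :* a) refl
      (seq a i) (seq a′ i) (seq b i) (seq b′ i))
  (λ (a , a′) → *ℝ-identityˡ a ,
    ≈ℝ-trans (+ℝ-cong (*ℝ-identityˡ a′) (*ℝ-zeroˡ a)) (+ℝ-identityʳ a′))
  (λ (a , a′) (b , b′) (c , c′) → *ℝ-distribʳ-+ a b c , pointwise λ i →
    solve 6 (λ a a′ b b′ c c′ → (b :+ c) :* a′ :+ (b′ :+ c′) :* a :=
                                (b :* a′ :+ b′ :* a) :+ (c :* a′ :+ c′ :* a)) refl
      (seq a i) (seq a′ i) (seq b i) (seq b′ i) (seq c i) (seq c′ i))
  (λ (a , a′) → *ℝ-zeroˡ a , ≈ℝ-trans (+ℝ-cong (*ℝ-zeroˡ a′) (*ℝ-zeroˡ a)) (+ℝ-identityʳ 0ℝ))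

-- The gradient semiring consists of the dual numbers with a nonnegative first
-- component.

⌊_⌋ᴳ : ℝ≥0 × ℝ → ℝ × ℝ
⌊ a , b ⌋ᴳ = ⌊ a ⌋ , b

module _ where
  open Morphisms.SemiringMorphisms GRAD-rawSemiring Dual-rawSemiring
  open IsCommutativeSemiring Dual-isCommutativeSemiring using () renaming (refl to ≈ᴰ-refl)

  ⌊⌋ᴳ-isSemiringHomomorphism : IsSemiringHomomorphism ⌊_⌋ᴳ
  ⌊⌋ᴳ-isSemiringHomomorphism = semiringHomomorphism GRAD-rawSemiring Dual-rawSemiring ⌊_⌋ᴳ
    id (λ _ _ → ≈ᴰ-refl) ≈ᴰ-refl (λ _ _ → ≈ᴰ-refl) ≈ᴰ-refl

  GRAD-isCommutativeSemiring : IsCommutativeSemiringOn GRAD-rawSemiring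
  GRAD-isCommutativeSemiring = isCommutativeSemiring-transport GRAD-rawSemiring Dual-rawSemiring
    {⌊_⌋ᴳ} record { isSemiringHomomorphism = ⌊⌋ᴳ-isSemiringHomomorphism ; injective = id }
    Dual-isCommutativeSemiring

-- Values at x and partial derivatives with respect to the variable k.

module Derivative (x : Fin n → ℝ) (k : Fin n) where
  open Evaluation x
  open *ℝ.Extraction (*ℝ.extract (∈.∈-allFin k))

  -- The contribution of the variables other than k to the value of a monomial.

  otherValue : Monomial n → ℝ
  otherValue μ = ∏ℝ (map (λ v → x v ^ℝ lookup μ v) others)

  value-split : ∀ μ → value μ ≈ℝ x k ^ℝ lookup μ k *ℝ otherValue μ
  value-split μ = fold-others λ v → x v ^ℝ lookup μ v

  others≢k : ∀ {v} → v ∈ others → v ≢ k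
  others≢k = others-≢ (Unique.allFin⁺ n)

  otherValue-+ : ∀ μ ν → otherValue (μ +ᴹ ν) ≈ℝ otherValue μ *ℝ otherValue ν
  otherValue-+ μ ν = ≈ℝ-trans
    (*ℝ.fold-cong others λ {v} _ →
      subst (λ k → x v ^ℝ k ≈ℝ x v ^ℝ lookup μ v *ℝ x v ^ℝ lookup ν v)
        (sym (Vec.lookup-zipWith ℕ._+_ v μ ν)) (^ℝ-+ (x v) (lookup μ v) (lookup ν v)))
    (*ℝ.fold-∙ (λ v → x v ^ℝ lookup μ v) (λ v → x v ^ℝ lookup ν v) others)

  -- The derivative of the m-th power at x k; it is 0 for m = 0, where the
  -- exponent pred m is irrelevant.

  dpower : ℕ → ℝ
  dpower m = (m ·ℝ 1ℝ) *ℝ x k ^ℝ pred m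

  dpower-0 : dpower 0 ≈ℝ 0ℝ
  dpower-0 = *ℝ-zeroˡ 1ℝ

  dpower-suc : ∀ m → dpower (suc m) ≈ℝ x k ^ℝ m +ℝ x k *ℝ dpower m
  dpower-suc m = ≈ℝ-trans (*ℝ-distribʳ-+ (x k ^ℝ m) 1ℝ (m ·ℝ 1ℝ)) (+ℝ-cong (*ℝ-identityˡ _) (lower m))
    where
    lower : ∀ m → (m ·ℝ 1ℝ) *ℝ x k ^ℝ m ≈ℝ x k *ℝ dpower m
    lower zero    = ≈ℝ-trans dpower-0 (≈ℝ-sym (≈ℝ-trans (*ℝ-congˡ dpower-0) (*ℝ-zeroʳ (x k))))
    lower (suc m) = pointwise λ i →
      solve 3 (λ m x y → m :* (x :* y) := x :* (m :* y)) refl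
        (seq (suc m ·ℝ 1ℝ) i) (seq (x k) i) (seq (x k ^ℝ m) i)

  -- The product rule for powers.

  dpower-+ : ∀ l m → dpower (l ℕ.+ m) ≈ℝ dpower l *ℝ x k ^ℝ m +ℝ x k ^ℝ l *ℝ dpower m
  dpower-+ zero    m = ≈ℝ-sym (≈ℝ-trans
    (+ℝ-cong (≈ℝ-trans (*ℝ-congʳ dpower-0) (*ℝ-zeroˡ _)) (*ℝ-identityˡ _)) (+ℝ-identityˡ _))
  dpower-+ (suc l) m = begin
    dpower (suc (l ℕ.+ m))
      ≈⟨ dpower-suc (l ℕ.+ m) ⟩
    x k ^ℝ (l ℕ.+ m) +ℝ x k *ℝ dpower (l ℕ.+ m)
      ≈⟨ +ℝ-cong (^ℝ-+ (x k) l m) (*ℝ-congˡ (dpower-+ l m)) ⟩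
    xˡ *ℝ xᵐ +ℝ x k *ℝ (dpower l *ℝ xᵐ +ℝ xˡ *ℝ dpower m)
      ≈⟨ pointwise (λ i → solve 5 (λ x xˡ xᵐ dˡ dᵐ → xˡ :* xᵐ :+ x :* (dˡ :* xᵐ :+ xˡ :* dᵐ) :=
                                      (xˡ :+ x :* dˡ) :* xᵐ :+ (x :* xˡ) :* dᵐ) refl
           (seq (x k) i) (seq xˡ i) (seq xᵐ i) (seq (dpower l) i) (seq (dpower m) i)) ⟩
    (xˡ +ℝ x k *ℝ dpower l) *ℝ xᵐ +ℝ (x k *ℝ xˡ) *ℝ dpower m
      ≈⟨ +ℝ-cong (*ℝ-congʳ (≈ℝ-sym (dpower-suc l))) ≈ℝ-refl ⟩
    dpower (suc l) *ℝ xᵐ +ℝ x k ^ℝ suc l *ℝ dpower m ∎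
    where
    xˡ = x k ^ℝ l
    xᵐ = x k ^ℝ m

  -- The value at x of the derivative of a monomial with respect to k.

  dvalue : Monomial n → ℝ
  dvalue μ = dpower (lookup μ k) *ℝ otherValue μ

  -- The product rule for monomials.

  leibniz : ∀ μ ν → dvalue (μ +ᴹ ν) ≈ℝ value μ *ℝ dvalue ν +ℝ dvalue μ *ℝ value ν
  leibniz μ ν = begin
    dpower (lookup (μ +ᴹ ν) k) *ℝ otherValue (μ +ᴹ ν)
      ≡⟨ cong (λ j → dpower j *ℝ otherValue (μ +ᴹ ν)) (Vec.lookup-zipWith ℕ._+_ k μ ν) ⟩
    dpower (l ℕ.+ m) *ℝ otherValue (μ +ᴹ ν)
      ≈⟨ *ℝ-cong (dpower-+ l m) (otherValue-+ μ ν) ⟩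
    (dpower l *ℝ xᵐ +ℝ xˡ *ℝ dpower m) *ℝ (otherValue μ *ℝ otherValue ν)
      ≈⟨ pointwise (λ i → solve 6 (λ dˡ dᵐ xˡ xᵐ o o′ → (dˡ :* xᵐ :+ xˡ :* dᵐ) :* (o :* o′) :=
                                      (xˡ :* o) :* (dᵐ :* o′) :+ (dˡ :* o) :* (xᵐ :* o′)) refl
           (seq (dpower l) i) (seq (dpower m) i) (seq xˡ i) (seq xᵐ i)
           (seq (otherValue μ) i) (seq (otherValue ν) i)) ⟩
    (xˡ *ℝ otherValue μ) *ℝ dvalue ν +ℝ dvalue μ *ℝ (xᵐ *ℝ otherValue ν)
      ≈⟨ +ℝ-cong (*ℝ-congʳ (value-split μ)) (*ℝ-congˡ (value-split ν)) ⟨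
    value μ *ℝ dvalue ν +ℝ dvalue μ *ℝ value ν ∎
    where
    l = lookup μ k
    m = lookup ν k
    xˡ = x k ^ℝ l
    xᵐ = x k ^ℝ m

  evaluate-∂ : ∀ P → evaluate (∂ k P) x ≈ℝ ⟪ P , dvalue ⟫
  evaluate-∂ []            = ≈ℝ-refl
  evaluate-∂ ((a , μ) ∷ P) = +ℝ-cong term (evaluate-∂ P)
    where
    ·ℝ-* : ∀ m → m ·ℝ a ≈ℝ (m ·ℝ 1ℝ) *ℝ a
    ·ℝ-* zero    = ≈ℝ-sym (*ℝ-zeroˡ a)
    ·ℝ-* (suc m) = ≈ℝ-trans (+ℝ-cong (≈ℝ-sym (*ℝ-identityˡ a)) (·ℝ-* m))
      (≈ℝ-sym (*ℝ-distribʳ-+ a 1ℝ (m ·ℝ 1ℝ)))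

    μ′ : Monomial n
    μ′ = updateAt μ k pred

    term : (lookup μ k ·ℝ a) *ℝ value μ′ ≈ℝ a *ℝ dvalue μ
    term = begin
      (lookup μ k ·ℝ a) *ℝ value μ′
        ≈⟨ *ℝ-cong (·ℝ-* (lookup μ k)) (value-split μ′) ⟩
      ((lookup μ k ·ℝ 1ℝ) *ℝ a) *ℝ (x k ^ℝ lookup μ′ k *ℝ otherValue μ′)
        ≈⟨ *ℝ-congˡ (*ℝ-congˡ (*ℝ.fold-cong others λ {v} v∈ →
             subst (λ j → x v ^ℝ j ≈ℝ x v ^ℝ lookup μ v)
               (sym (Vec.lookup∘updateAt′ v k (others≢k v∈) μ)) ≈ℝ-refl)) ⟩
      ((lookup μ k ·ℝ 1ℝ) *ℝ a) *ℝ (x k ^ℝ lookup μ′ k *ℝ otherValue μ)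
        ≡⟨ cong (λ j → ((lookup μ k ·ℝ 1ℝ) *ℝ a) *ℝ (x k ^ℝ j *ℝ otherValue μ)) (Vec.lookup∘updateAt k μ) ⟩
      ((lookup μ k ·ℝ 1ℝ) *ℝ a) *ℝ (x k ^ℝ pred (lookup μ k) *ℝ otherValue μ)
        ≈⟨ pointwise (λ i → solve 4 (λ m a y o → (m :* a) :* (y :* o) := a :* ((m :* y) :* o)) refl
             (seq (lookup μ k ·ℝ 1ℝ) i) (seq a i) (seq (x k ^ℝ pred (lookup μ k)) i) (seq (otherValue μ) i)) ⟩
      a *ℝ dvalue μ ∎

  ⟪⟫-dvalue-* : ∀ P Q → ⟪ P *ᴾ Q , dvalue ⟫ ≈ℝ
    ⟪ P , value ⟫ *ℝ ⟪ Q , dvalue ⟫ +ℝ ⟪ P , dvalue ⟫ *ℝ ⟪ Q , value ⟫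
  ⟪⟫-dvalue-* P Q = begin
    ⟪ P *ᴾ Q , dvalue ⟫
      ≈⟨ ⟪⟫-* dvalue P Q ⟩
    ⟪ P , (λ μ → ⟪ Q , (λ ν → dvalue (μ +ᴹ ν)) ⟫) ⟫
      ≈⟨ ⟪⟫-cong P (λ μ → ≈ℝ-trans (⟪⟫-cong Q (leibniz μ))
           (⟪⟫-+ʳ Q (λ ν → value μ *ℝ dvalue ν) (λ ν → dvalue μ *ℝ value ν))) ⟩
    ⟪ P , (λ μ → ⟪ Q , (λ ν → value μ *ℝ dvalue ν) ⟫ +ℝ ⟪ Q , (λ ν → dvalue μ *ℝ value ν) ⟫) ⟫
      ≈⟨ ⟪⟫-+ʳ P (λ μ → ⟪ Q , (λ ν → value μ *ℝ dvalue ν) ⟫) (λ μ → ⟪ Q , (λ ν → dvalue μ *ℝ value ν) ⟫) ⟩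
    ⟪ P , (λ μ → ⟪ Q , (λ ν → value μ *ℝ dvalue ν) ⟫) ⟫ +ℝ ⟪ P , (λ μ → ⟪ Q , (λ ν → dvalue μ *ℝ value ν) ⟫) ⟫
      ≈⟨ +ℝ-cong (⟪⟫-product P Q value dvalue) (⟪⟫-product P Q dvalue value) ⟩
    ⟪ P , value ⟫ *ℝ ⟪ Q , dvalue ⟫ +ℝ ⟪ P , dvalue ⟫ *ℝ ⟪ Q , value ⟫ ∎

  dvalue-vanishes : ∀ μ → lookup μ k ≡ 0 → dvalue μ ≈ℝ 0ℝ
  dvalue-vanishes μ eq = ≈ℝ-trans
    (*ℝ-congʳ (subst (λ j → dpower j ≈ℝ 0ℝ) (sym eq) dpower-0)) (*ℝ-zeroˡ (otherValue μ))

  ∂-const : ∀ a → ⟪ constᴾ a , dvalue ⟫ ≈ℝ 0ℝ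
  ∂-const a = ⟪⟫-vanishes (Vec.lookup-replicate k 0)
    where
    ⟪⟫-vanishes : lookup 0ᴹ k ≡ 0 → a *ℝ dvalue 0ᴹ +ℝ 0ℝ ≈ℝ 0ℝ
    ⟪⟫-vanishes eq = ≈ℝ-trans (+ℝ-identityʳ _) (≈ℝ-trans (*ℝ-congˡ (dvalue-vanishes 0ᴹ eq)) (*ℝ-zeroʳ a))

  ∂-other : ∀ {v} → v ≢ k → ⟪ varᴾ v , dvalue ⟫ ≈ℝ 0ℝ
  ∂-other v≢k = ≈ℝ-trans (+ℝ-identityʳ _) (≈ℝ-trans (*ℝ-identityˡ _)
    (dvalue-vanishes (0ᴹ [ _ ]≔ 1) (trans (Vec.lookup∘update′ (v≢k ∘ sym) 0ᴹ 1) (Vec.lookup-replicate k 0))))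

  ∂-same : ⟪ varᴾ k , dvalue ⟫ ≈ℝ 1ℝ
  ∂-same = begin
    1ℝ *ℝ dvalue e +ℝ 0ℝ           ≈⟨ ≈ℝ-trans (+ℝ-identityʳ _) (*ℝ-identityˡ _) ⟩
    dpower (lookup e k) *ℝ otherValue e ≡⟨ cong (λ j → dpower j *ℝ otherValue e) (Vec.lookup∘update k 0ᴹ 1) ⟩
    dpower 1 *ℝ otherValue e       ≈⟨ *ℝ-cong dpower-1 otherValue-e ⟩
    1ℝ *ℝ 1ℝ                       ≈⟨ *ℝ-identityˡ 1ℝ ⟩
    1ℝ                             ∎
    where
    e : Monomial n
    e = 0ᴹ [ k ]≔ 1
    dpower-1 : dpower 1 ≈ℝ 1ℝ
    dpower-1 = ≈ℝ-trans (*ℝ-identityʳ _) (+ℝ-identityʳ 1ℝ)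
    otherValue-e : otherValue e ≈ℝ 1ℝ
    otherValue-e = *ℝ.fold-ε others λ {v} v∈ → subst (λ j → x v ^ℝ j ≈ℝ 1ℝ)
      (sym (trans (Vec.lookup∘update′ (others≢k v∈) 0ᴹ 1) (Vec.lookup-replicate v 0))) ≈ℝ-refl

  -- The value and the derivative of a polynomial, as a dual number.

  dual : Poly n → ℝ × ℝ
  dual P = ⟪ P , value ⟫ , ⟪ P , dvalue ⟫

  open Morphisms.SemiringMorphisms (SENS-rawSemiring n) Dual-rawSemiring

  dual-isSemiringHomomorphism : IsSemiringHomomorphism dual
  dual-isSemiringHomomorphism = semiringHomomorphism (SENS-rawSemiring n) Dual-rawSemiring dual
    (λ {P} {Q} P≈Q → ⟪⟫-resp-≈ᴾ {P = P} {Q} P≈Q value , ⟪⟫-resp-≈ᴾ {P = P} {Q} P≈Q dvalue)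
    (λ P Q → ⟪⟫-++ value P Q , ⟪⟫-++ dvalue P Q)
    (≈ℝ-refl , ≈ℝ-refl)
    (λ P Q → evaluate-* P Q , ⟪⟫-dvalue-* P Q)
    (evaluate-const 1ℝ , ∂-const 1ℝ)

------------------------------------------------------------------------
-- Sensitivity polynomials

≢⇒lookup-≢ : {μ ν : Monomial n} → μ ≢ ν → ∃ λ v → lookup μ v ≢ lookup ν v
≢⇒lookup-≢ {n} {μ} {ν} μ≢ν = Fin.¬∀⟶∃¬ n _ (λ v → lookup μ v ℕ.≟ lookup ν v) (μ≢ν ∘ lookup-ext)

-- v does not occur in P.

Free : Fin n → Poly n → Set
Free v = All (λ (_ , μ) → lookup μ v ≡ 0)

module _ {v : Fin n} where

  Free-const : ∀ a → Free v (constᴾ a)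
  Free-const a = Vec.lookup-replicate v 0 ∷ []

  Free-var : ∀ {u} → u ≢ v → Free v (varᴾ u)
  Free-var u≢v = trans (Vec.lookup∘update′ (u≢v ∘ sym) 0ᴹ 1) (Vec.lookup-replicate v 0) ∷ []

  Free-minus : ∀ {P Q} → Free v P → Free v Q → Free v (P -ᴾ Q)
  Free-minus P-free Q-free = All.++⁺ P-free (All.map⁺ Q-free)

  Free-* : ∀ {P Q} → Free v P → Free v Q → Free v (P *ᴾ Q)
  Free-* []                              Q-free = []
  Free-* (_∷_ {x = _ , μ} μv≡0 P-free) Q-free = All.++⁺
    (All.map⁺ (All.map (λ {(_ , ν)} νv≡0 → trans (Vec.lookup-zipWith ℕ._+_ v μ ν) (cong₂ ℕ._+_ μv≡0 νv≡0)) Q-free))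
    (Free-* P-free Q-free)

  coeff-Free : ∀ {P μ} → Free v P → lookup μ v ≢ 0 → coeff P μ ≡ 0ℝ
  coeff-Free {P} {μ} P-free μv≢0 = cong (λ ts → ∑ℝ (map proj₁ ts))
    (List.filter-none (λ t → proj₂ t ≟ᴹ μ) (All.map (λ νv≡0 ν≡μ → μv≢0 (trans (cong (λ κ → lookup κ v) (sym ν≡μ)) νv≡0)) P-free))

-- The real number with a constant sequence.

fromℚ : ℚ → ℝ
fromℚ q = mkℝ (λ _ → q) (RealLemmas.const-cauchy q)

-- ½^ k is the k-th power of 1/2.

½^ : ℕ → ℚ
½^ zero    = 1ℚ
½^ (suc k) = ½ ℚ.* ½^ k

0<½^ : ∀ k → 0ℚ ℚ.< ½^ k
0<½^ zero    = RealLemmas.0<1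
0<½^ (suc k) = RealLemmas.0<½* (0<½^ k)

½<1 : ½ ℚ.< 1ℚ
½<1 = ℚ.*<* (ℤ.+<+ (ℕ.s≤s (ℕ.s≤s ℕ.z≤n)))

½^-decreasing : ∀ {j k} → j ℕ.< k → ½^ k ℚ.< ½^ j
½^-decreasing {j} {suc k} (ℕ.s≤s j≤k) = ℚ.<-≤-trans step (weak (ℕ.m≤n⇒m<n∨m≡n j≤k))
  where
  step : ½^ (suc k) ℚ.< ½^ k
  step = subst (½^ (suc k) ℚ.<_) (ℚ.*-identityˡ (½^ k))
    (ℚ.*-monoˡ-<-pos (½^ k) {{ℚ.positive (0<½^ k)}} ½<1)
  weak : j ℕ.< k ⊎ j ≡ k → ½^ k ℚ.≤ ½^ j
  weak (inj₁ j<k)  = ℚ.<⇒≤ (½^-decreasing j<k)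
  weak (inj₂ refl) = ℚ.≤-refl

½^-injective : ∀ {j k} → ½^ j ≡ ½^ k → j ≡ k
½^-injective {j} {k} eq with ℕ.<-cmp j k
... | tri< j<k _ _ = contradiction (½^-decreasing j<k) (ℚ.<-irrefl (sym eq))
... | tri≈ _ j≡k _ = j≡k
... | tri> _ _ k<j = contradiction (½^-decreasing k<j) (ℚ.<-irrefl eq)

½^-*-^ℝ : ∀ x k → (fromℚ ½ *ℝ x) ^ℝ k ≈ℝ fromℚ (½^ k) *ℝ x ^ℝ k
½^-*-^ℝ x zero    = ≈ℝ-sym (*ℝ-identityˡ 1ℝ)
½^-*-^ℝ x (suc k) = ≈ℝ-trans (*ℝ-congˡ (½^-*-^ℝ x k)) (pointwise λ i →
  solve 4 (λ h x a y → (h :* x) :* (a :* y) := (h :* a) :* (x :* y)) refl ½ (seq x i) (½^ k) (seq (x ^ℝ k) i))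

abstract
  0≤½*x : ∀ x → 0ℝ ≤ℝ x → 0ℝ ≤ℝ fromℚ ½ *ℝ x
  0≤½*x x = BoundLemmas.*-nonNegative (fromℚ ½) x (<⇒≤ (½ , 0<½^ 1 , 0 , λ _ _ → ℚ.≤-refl))

  ½*x≤1 : ∀ x → 0ℝ ≤ℝ x → x ≤ℝ 1ℝ → fromℚ ½ *ℝ x ≤ℝ 1ℝ
  ½*x≤1 x 0≤x x≤1 = ≤ℝ-trans (≈⇒≤ (*ℝ-comm (fromℚ ½) x))
    (≤ℝ-trans (*ℝ-monoˡ-≤ 0≤x ½≤1) (≤ℝ-trans (≈⇒≤ (*ℝ-identityʳ x)) x≤1))
    where
    ½≤1 : fromℚ ½ ≤ℝ 1ℝ
    ½≤1 = <⇒≤ (½ , 0<½^ 1 , 0 , λ _ _ → ℚ.≤-refl)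

-- Multiplication by 1/2 on the unit interval.

halve : UnitInterval → UnitInterval
halve (mkUnit x 0≤x x≤1) = mkUnit (fromℚ ½ *ℝ x) (0≤½*x x 0≤x) (½*x≤1 x 0≤x x≤1)

-- The point p with its coordinate v halved.

halveAt : Fin n → (Fin n → UnitInterval) → Fin n → UnitInterval
halveAt v p u = if does (u Fin.≟ v) then halve (p u) else p u

halveAt-same : ∀ v (p : Fin n → UnitInterval) → halveAt v p v ≡ halve (p v)
halveAt-same v p = cong (if_then halve (p v) else p v) (dec-true (v Fin.≟ v) refl)

halveAt-other : ∀ {v u} (p : Fin n → UnitInterval) → u ≢ v → halveAt v p u ≡ p u
halveAt-other {v = v} {u} p u≢v = cong (if_then halve (p u) else p u) (dec-false (u Fin.≟ v) u≢v)

-- The value of a monomial at a point of the unit cube.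

unitValue : (Fin n → UnitInterval) → Monomial n → ℝ
unitValue p = monomialValue (⌊_⌋ᵘ ∘ p)

-- Halving coordinate v multiplies a monomial μ by a power of 1/2 determined
-- by the exponent of v.

unitValue-halveAt : ∀ v (p : Fin n → UnitInterval) μ →
  unitValue (halveAt v p) μ ≈ℝ fromℚ (½^ (lookup μ v)) *ℝ unitValue p μ
unitValue-halveAt v p μ = begin
  unitValue (halveAt v p) μ
    ≈⟨ Half.value-split μ ⟩
  ⌊ halveAt v p v ⌋ᵘ ^ℝ k *ℝ Half.otherValue μ
    ≡⟨ cong (λ u → ⌊ u ⌋ᵘ ^ℝ k *ℝ Half.otherValue μ) (halveAt-same v p) ⟩
  (fromℚ ½ *ℝ x) ^ℝ k *ℝ Half.otherValue μ
    ≈⟨ *ℝ-cong (½^-*-^ℝ x k) (*ℝ.fold-cong others λ {u} u∈ →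
         subst (λ q → ⌊ q ⌋ᵘ ^ℝ lookup μ u ≈ℝ ⌊ p u ⌋ᵘ ^ℝ lookup μ u)
           (sym (halveAt-other p (Full.others≢k u∈))) ≈ℝ-refl) ⟩
  (fromℚ (½^ k) *ℝ x ^ℝ k) *ℝ Full.otherValue μ
    ≈⟨ *ℝ-assoc (fromℚ (½^ k)) (x ^ℝ k) (Full.otherValue μ) ⟩
  fromℚ (½^ k) *ℝ (x ^ℝ k *ℝ Full.otherValue μ)
    ≈⟨ *ℝ-congˡ (Full.value-split μ) ⟨
  fromℚ (½^ k) *ℝ unitValue p μ ∎
  where
  module Half = Derivative (⌊_⌋ᵘ ∘ halveAt v p) v
  module Full = Derivative (⌊_⌋ᵘ ∘ p) v
  open *ℝ.Extraction (*ℝ.extract (∈.∈-allFin v)) using (others)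
  k = lookup μ v
  x = ⌊ p v ⌋ᵘ

-- Q vanishes at the admissible points, a set of points of the unit cube that
-- is closed under halving symbolic coordinates.  The coefficients of Q are
-- shown to be 0 if they are 0 at monomials that contain a variable that is
-- not symbolic, and some admissible point has all symbolic coordinates 1.

module Separation {n} (Symbolic : Fin n → Set) (symbolic? : ∀ v → Dec (Symbolic v))
  (Admissible : (Fin n → UnitInterval) → Set)
  (halveAt-admissible : ∀ {v p} → Symbolic v → Admissible p → Admissible (halveAt v p))
  (Q : Poly n) (vanishes : ∀ p → Admissible p → ⟪ Q , unitValue p ⟫ ≈ℝ 0ℝ) where

  -- The functional of Q annihilates the product of g with the value of the
  -- monomial, at every admissible point.

  Annihilates : (Monomial n → ℝ) → Set
  Annihilates g = ∀ p → Admissible p → ⟪ Q , (λ ν → g ν *ℝ unitValue p ν) ⟫ ≈ℝ 0ℝ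

  annihilates-1 : Annihilates (λ _ → 1ℝ)
  annihilates-1 p adm = ≈ℝ-trans (⟪⟫-cong Q λ ν → *ℝ-identityˡ _) (vanishes p adm)

  -- The value at the halved point, minus r times the value at the point itself.

  annihilates-step : ∀ {g v} → Symbolic v → ∀ r → Annihilates g →
    Annihilates (λ ν → g ν *ℝ (fromℚ (½^ (lookup ν v)) -ℝ r))
  annihilates-step {g} {v} sym-v r g-ann p adm = begin
    ⟪ Q , (λ ν → (g ν *ℝ (fromℚ (½^ (lookup ν v)) -ℝ r)) *ℝ unitValue p ν) ⟫
      ≈⟨ ⟪⟫-cong Q (λ ν → ≈ℝ-trans
           (pointwise λ i → solve 4 (λ g h r u → (g :* (h :- r)) :* u := g :* (h :* u) :+ (:- r) :* (g :* u)) refl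
             (seq (g ν) i) (½^ (lookup ν v)) (seq r i) (seq (unitValue p ν) i))
           (+ℝ-cong (*ℝ-congˡ (≈ℝ-sym (unitValue-halveAt v p ν))) (≈ℝ-refl {(-ℝ r) *ℝ (g ν *ℝ unitValue p ν)}))) ⟩
    ⟪ Q , (λ ν → g ν *ℝ unitValue (halveAt v p) ν +ℝ (-ℝ r) *ℝ (g ν *ℝ unitValue p ν)) ⟫
      ≈⟨ ⟪⟫-+ʳ Q (λ ν → g ν *ℝ unitValue (halveAt v p) ν) (λ ν → (-ℝ r) *ℝ (g ν *ℝ unitValue p ν)) ⟩
    ⟪ Q , (λ ν → g ν *ℝ unitValue (halveAt v p) ν) ⟫ +ℝ ⟪ Q , (λ ν → (-ℝ r) *ℝ (g ν *ℝ unitValue p ν)) ⟫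
      ≈⟨ +ℝ-cong (g-ann (halveAt v p) (halveAt-admissible sym-v adm))
           (≈ℝ-trans (⟪⟫-*ʳ (λ ν → g ν *ℝ unitValue p ν) Q (-ℝ r)) (*ℝ-congˡ (g-ann p adm))) ⟩
    0ℝ +ℝ (-ℝ r) *ℝ 0ℝ
      ≈⟨ ≈ℝ-trans (+ℝ-identityˡ _) (*ℝ-zeroʳ (-ℝ r)) ⟩
    0ℝ ∎

  -- μ and ν differ in the exponent of a symbolic variable.

  Differs : Monomial n → Monomial n → Set
  Differs μ ν = ∃ λ v → Symbolic v × lookup μ v ≢ lookup ν v

  differs? : ∀ μ ν → Dec (Differs μ ν)
  differs? μ ν = Fin.any? λ v → symbolic? v ×-dec ¬? (lookup μ v ℕ.≟ lookup ν v)

  Invertible : ℝ → Set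
  Invertible x = ∃ λ y → x *ℝ y ≈ℝ 1ℝ

  -- Distinct powers of 1/2 differ by a non-zero rational.

  difference-invertible : ∀ {j k} → j ≢ k → Invertible (fromℚ (½^ j) -ℝ fromℚ (½^ k))
  difference-invertible {j} {k} j≢k = fromℚ (ℚ.1/ d) , pointwise λ _ → ℚ.*-inverseʳ d
    where
    d : ℚ
    d = ½^ j ℚ.- ½^ k
    d≢0 : d ≢ 0ℚ
    d≢0 d≡0 = j≢k (½^-injective (trans
      (solve 2 (λ a b → a := (a :- b) :+ b) refl (½^ j) (½^ k))
      (trans (cong (ℚ._+ ½^ k) d≡0) (ℚ.+-identityˡ (½^ k)))))
    instance
      d-nonZero : ℚ.NonZero d
      d-nonZero = ℚ.≢-nonZero d≢0

  *ℝ-invertible : ∀ {x y} → Invertible x → Invertible y → Invertible (x *ℝ y)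
  *ℝ-invertible {x} {y} (x⁻¹ , xx⁻¹) (y⁻¹ , yy⁻¹) = x⁻¹ *ℝ y⁻¹ ,
    ≈ℝ-trans (*ℝ.interchange x y x⁻¹ y⁻¹) (≈ℝ-trans (*ℝ-cong xx⁻¹ yy⁻¹) (*ℝ-identityˡ 1ℝ))

  -- A product of factors that vanishes at the monomials of L that differ from
  -- μ in a symbolic variable, but not at μ.

  separate : ∀ μ (L : List (Monomial n)) → ∃ λ g → Annihilates g × Invertible (g μ) ×
    (∀ {ν} → ν ∈ L → Differs μ ν → g ν ≈ℝ 0ℝ)
  separate μ []      = (λ _ → 1ℝ) , annihilates-1 , (1ℝ , *ℝ-identityˡ 1ℝ) , λ ()
  separate μ (ν ∷ L) with separate μ L | differs? μ ν
  ... | g , g-ann , gμ-inv , g-zero | no same = g , g-ann , gμ-inv , λ where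
    (here refl) μ#ν → contradiction μ#ν same
    (there κ∈)  μ#κ → g-zero κ∈ μ#κ
  ... | g , g-ann , gμ-inv , g-zero | yes (v , sym-v , μv≢νv) =
    (λ κ → g κ *ℝ factor κ) ,
    annihilates-step {g} sym-v (fromℚ (½^ (lookup ν v))) g-ann ,
    *ℝ-invertible gμ-inv (difference-invertible μv≢νv) ,
    λ where
      (here refl) _   → ≈ℝ-trans (*ℝ-congˡ (-ℝ-inverseʳ _)) (*ℝ-zeroʳ (g ν))
      (there κ∈)  μ#κ → ≈ℝ-trans (*ℝ-congʳ (g-zero κ∈ μ#κ)) (*ℝ-zeroˡ _)
    where
    factor : Monomial n → ℝ
    factor κ = fromℚ (½^ (lookup κ v)) -ℝ fromℚ (½^ (lookup ν v))

  module _ (p : Fin n → UnitInterval) (p-admissible : Admissible p)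
    (p-symbolic : ∀ v → Symbolic v → ⌊ p v ⌋ᵘ ≈ℝ 1ℝ)
    (coeff-vanishes : ∀ v μ → ¬ Symbolic v → lookup μ v ≢ 0 → coeff Q μ ≈ℝ 0ℝ) where

    -- The separating function leaves only the term of μ, evaluated at the corner
    -- point p where μ has the value 1.

    coeff≈0-symbolic : ∀ μ → (∀ v → ¬ Symbolic v → lookup μ v ≡ 0) → coeff Q μ ≈ℝ 0ℝ
    coeff≈0-symbolic μ constants-absent = conclude (separate μ (monomials Q))
      where
      unitValue≈1 : unitValue p μ ≈ℝ 1ℝ
      unitValue≈1 = *ℝ.fold-ε (allFin n) λ {v} _ → power v (symbolic? v)
        where
        power : ∀ v → Dec (Symbolic v) → ⌊ p v ⌋ᵘ ^ℝ lookup μ v ≈ℝ 1ℝ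
        power v (yes sym-v)  = ≈ℝ-trans (^ℝ-cong (lookup μ v) (p-symbolic v sym-v)) (1^ℝ (lookup μ v))
        power v (no v-const) = ≈ℝ-reflexive (cong (⌊ p v ⌋ᵘ ^ℝ_) (constants-absent v v-const))

      conclude : (∃ λ g → Annihilates g × Invertible (g μ) ×
        (∀ {ν} → ν ∈ monomials Q → Differs μ ν → g ν ≈ℝ 0ℝ)) → coeff Q μ ≈ℝ 0ℝ
      conclude (g , g-ann , (r , gμr≈1) , g-zero) = begin
        coeff Q μ                             ≈⟨ *ℝ-identityʳ (coeff Q μ) ⟨
        coeff Q μ *ℝ 1ℝ                       ≈⟨ *ℝ-congˡ gμr≈1 ⟨
        coeff Q μ *ℝ (g μ *ℝ r)               ≈⟨ pointwise (λ i → solve 3 (λ c g r → c :* (g :* r) := (g :* c) :* r) refl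
                                                   (seq (coeff Q μ) i) (seq (g μ) i) (seq r i)) ⟩
        (g μ *ℝ coeff Q μ) *ℝ r               ≈⟨ *ℝ-congʳ (*ℝ-congˡ (coeff≈⟪⟫ Q μ)) ⟩
        (g μ *ℝ ⟪ Q , δ μ ⟫) *ℝ r             ≈⟨ *ℝ-congʳ (⟪⟫-*ʳ (δ μ) Q (g μ)) ⟨
        ⟪ Q , (λ ν → g μ *ℝ δ μ ν) ⟫ *ℝ r     ≈⟨ *ℝ-congʳ (⟪⟫-local Q h (λ ν → g μ *ℝ δ μ ν) (λ {ν} ν∈ → agree ν ν∈ (ν ≟ᴹ μ))) ⟨
        ⟪ Q , h ⟫ *ℝ r                        ≈⟨ *ℝ-congʳ (g-ann p p-admissible) ⟩
        0ℝ *ℝ r                               ≈⟨ *ℝ-zeroˡ r ⟩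
        0ℝ                                    ∎
        where
        h : Monomial n → ℝ
        h ν = g ν *ℝ unitValue p ν

        agree : ∀ ν → ν ∈ monomials Q → Dec (ν ≡ μ) → coeff Q ν *ℝ h ν ≈ℝ coeff Q ν *ℝ (g μ *ℝ δ μ ν)
        agree ν _ (yes refl) = *ℝ-congˡ (*ℝ-congˡ (≈ℝ-trans unitValue≈1 (≈ℝ-reflexive (sym (δ-diagonal μ)))))
        agree ν ν∈ (no ν≢μ) = ≈ℝ-trans (vanish (differs? μ ν)) (≈ℝ-sym (≈ℝ-trans
          (*ℝ-congˡ (≈ℝ-trans (*ℝ-congˡ (≈ℝ-reflexive (δ-off-diagonal ν≢μ))) (*ℝ-zeroʳ (g μ))))
          (*ℝ-zeroʳ (coeff Q ν))))
          where
          -- A monomial of Q other than μ that agrees with μ on the symbolic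
          -- variables contains one that is not symbolic.
          vanish : Dec (Differs μ ν) → coeff Q ν *ℝ h ν ≈ℝ 0ℝ
          vanish (yes μ#ν) = ≈ℝ-trans (*ℝ-congˡ (≈ℝ-trans (*ℝ-congʳ (g-zero ν∈ μ#ν)) (*ℝ-zeroˡ (unitValue p ν))))
            (*ℝ-zeroʳ (coeff Q ν))
          vanish (no same) = ≈ℝ-trans (*ℝ-congʳ (vanish-const (≢⇒lookup-≢ (ν≢μ ∘ sym)))) (*ℝ-zeroˡ (h ν))
            where
            vanish-const : (∃ λ v → lookup μ v ≢ lookup ν v) → coeff Q ν ≈ℝ 0ℝ
            vanish-const (v , μv≢νv) = coeff-vanishes v ν v-const
              λ νv≡0 → μv≢νv (trans (constants-absent v v-const) (sym νv≡0))
              where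
              v-const : ¬ Symbolic v
              v-const sym-v = same (v , sym-v , μv≢νv)

    coeff≈0 : ∀ μ → coeff Q μ ≈ℝ 0ℝ
    coeff≈0 μ = by-cases (Fin.any? λ v → ¬? (symbolic? v) ×-dec ¬? (lookup μ v ℕ.≟ 0))
      where
      by-cases : Dec (∃ λ v → ¬ Symbolic v × lookup μ v ≢ 0) → coeff Q μ ≈ℝ 0ℝ
      by-cases (yes (v , v-const , μv≢0)) = coeff-vanishes v μ v-const μv≢0
      by-cases (no none) = coeff≈0-symbolic μ λ v v-const →
        decidable-stable (lookup μ v ℕ.≟ 0) λ μv≢0 → none (v , v-const , μv≢0)

-- A property that the semiring operations preserve passes from the labels to
-- the result.

AMC-closed : (R : RawSemiring 0ℓ 0ℓ) (let open RawSemiring R) {P : Carrier → Set} →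
  (∀ {a b} → P a → P b → P (a + b)) → P 0# → (∀ {a b} → P a → P b → P (a * b)) → P 1# →
  ∀ {α : Literal n → Carrier} → (∀ l → P (α l)) → ∀ T → P (AMC R α T)
AMC-closed {n} R {P} +-closed 0-closed *-closed 1-closed {α} α-closed T = sums (models T)
  where
  products : ∀ ls → P (BigOps.⨂ R (map α ls))
  products []       = 1-closed
  products (l ∷ ls) = *-closed (α-closed l) (products ls)
  sums : ∀ Is → P (BigOps.⨁ R (map (λ I → BigOps.⨂ R (map α (literals I))) Is))
  sums []       = 0-closed
  sums (I ∷ Is) = +-closed (products (literals I)) (sums Is)

-- Each variable is labelled, up to equality of polynomials, by itself
-- (symbolic) or by a constant.

module Sensitivity (T : Formula n) (α : Literal n → Poly n)
  (kind : ∀ v → α (pos v) ≈ᴾ varᴾ v ⊎ ∃ λ (a : UnitInterval) → α (pos v) ≈ᴾ constᴾ ⌊ a ⌋ᵘ)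
  (α¬≈ : ∀ v → α (neg v) ≈ᴾ constᴾ 1ℝ -ᴾ α (pos v)) where

  -- The label of v is the variable v.

  Symbolic : Fin n → Set
  Symbolic v = α (pos v) ≈ᴾ varᴾ v

  const⇒¬symbolic : ∀ v {a} → α (pos v) ≈ᴾ constᴾ a → ¬ Symbolic v
  const⇒¬symbolic v {a} e e′ = varᴾ≉constᴾ v {a} λ μ → ≈ℝ-trans (≈ℝ-sym (e′ μ)) (e μ)

  symbolic? : ∀ v → Dec (Symbolic v)
  symbolic? v with kind v
  ... | inj₁ e       = yes e
  ... | inj₂ (a , e) = no (const⇒¬symbolic v {⌊ a ⌋ᵘ} e)

  -- The point p agrees with the constant labels.

  Admissible : (Fin n → UnitInterval) → Set
  Admissible p = ∀ v (a : UnitInterval) → α (pos v) ≈ᴾ constᴾ ⌊ a ⌋ᵘ → p v ≈ᵘ a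

  halveAt-admissible : ∀ {v p} → Symbolic v → Admissible p → Admissible (halveAt v p)
  halveAt-admissible {v} {p} sym-v adm u a e with u Fin.≟ v
  ... | yes refl = contradiction sym-v (const⇒¬symbolic v {⌊ a ⌋ᵘ} e)
  ... | no _     = adm u a e

  -- The label of v in its syntactically simplest form, from which it is
  -- manifest which variables occur.

  parameter : Fin n → Poly n
  parameter v with kind v
  ... | inj₁ _       = varᴾ v
  ... | inj₂ (a , _) = constᴾ ⌊ a ⌋ᵘ

  α≈parameter : ∀ v → α (pos v) ≈ᴾ parameter v
  α≈parameter v with kind v
  ... | inj₁ e       = e
  ... | inj₂ (_ , e) = e

  -- The labelling α up to equality, with the labels in that form.

  labelling : Literal n → Poly n
  labelling (pos v) = parameter v
  labelling (neg v) = constᴾ 1ℝ -ᴾ parameter v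

  α≈labelling : ∀ l → α l ≈ᴾ labelling l
  α≈labelling (pos v) = α≈parameter v
  α≈labelling (neg v) μ = ≈ℝ-trans (α¬≈ v μ)
    (-ᴾ-cong {P = constᴾ 1ℝ} {constᴾ 1ℝ} {α (pos v)} {parameter v} (λ _ → ≈ℝ-refl) (α≈parameter v) μ)

  parameter-Free : ∀ {v} → ¬ Symbolic v → ∀ u → Free v (parameter u)
  parameter-Free v-const u with kind u
  ... | inj₁ e       = Free-var λ { refl → v-const e }
  ... | inj₂ (a , _) = Free-const ⌊ a ⌋ᵘ

  labelling-Free : ∀ {v} → ¬ Symbolic v → ∀ l → Free v (labelling l)
  labelling-Free v-const (pos u) = parameter-Free v-const u
  labelling-Free v-const (neg u) = Free-minus (Free-const 1ℝ) (parameter-Free v-const u)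

  -- The result of algebraic model counting.

  A : Poly n
  A = AMC (SENS-rawSemiring n) α T

  coeff-A : ∀ v μ → ¬ Symbolic v → lookup μ v ≢ 0 → coeff A μ ≈ℝ 0ℝ
  coeff-A v μ v-const μv≢0 = begin
    coeff A μ
      ≈⟨ AMC-cong (SENS-rawSemiring n) SENS-isCommutativeSemiring {α} {labelling} α≈labelling T μ ⟩
    coeff (AMC (SENS-rawSemiring n) labelling T) μ
      ≡⟨ coeff-Free (AMC-closed (SENS-rawSemiring n) {Free v} All.++⁺ [] Free-* (Free-const 1ℝ)
           {labelling} (labelling-Free v-const) T) μv≢0 ⟩
    0ℝ ∎

  evaluate-A : ∀ p → Admissible p → evaluate A (⌊_⌋ᵘ ∘ p) ≈ℝ probability (⌊_⌋ᵘ ∘ p) T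
  evaluate-A p adm = ≈ℝ-trans
    (AMC-homo (SENS-rawSemiring n) ℝ-rawSemiring ℝ-isCommutativeSemiring evaluate-isSemiringHomomorphism
      {α} (λ _ → ≈ℝ-refl) T)
    (weightedCount≈probability (λ v → positive v , negative v) T)
    where
    x : Fin n → ℝ
    x = ⌊_⌋ᵘ ∘ p
    open Evaluation x
    positive : ∀ v → evaluate (α (pos v)) x ≈ℝ x v
    positive v with kind v
    ... | inj₁ e       = ≈ℝ-trans (⟪⟫-resp-≈ᴾ {P = α (pos v)} {varᴾ v} e value) (evaluate-var v)
    ... | inj₂ (a , e) = ≈ℝ-trans (⟪⟫-resp-≈ᴾ {P = α (pos v)} {constᴾ ⌊ a ⌋ᵘ} e value)
      (≈ℝ-trans (evaluate-const ⌊ a ⌋ᵘ) (≈ℝ-sym (adm v a e)))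
    negative : ∀ v → evaluate (α (neg v)) x ≈ℝ 1ℝ -ℝ x v
    negative v = ≈ℝ-trans (⟪⟫-resp-≈ᴾ {P = α (neg v)} {constᴾ 1ℝ -ᴾ α (pos v)} (α¬≈ v) value)
      (≈ℝ-trans (⟪⟫-minus value (constᴾ 1ℝ) (α (pos v)))
      (+ℝ-cong (evaluate-const 1ℝ) (-ℝ-cong (positive v))))

  A-isSensitivityPoly : IsSensitivityPoly α T A
  A-isSensitivityPoly = coeff-A , evaluate-A

  -- The admissible point at which the symbolic parameters are 1.

  corner : Fin n → UnitInterval
  corner v with kind v
  ... | inj₁ _       = 1ᵘ
  ... | inj₂ (a , _) = a

  corner-admissible : Admissible corner
  corner-admissible v a e with kind v
  ... | inj₁ e′       = contradiction e′ (const⇒¬symbolic v {⌊ a ⌋ᵘ} e)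
  ... | inj₂ (b , e′) = constᴾ-injective {n} λ μ → ≈ℝ-trans (≈ℝ-sym (e′ μ)) (e μ)

  corner-symbolic : ∀ v → Symbolic v → ⌊ corner v ⌋ᵘ ≈ℝ 1ℝ
  corner-symbolic v e with kind v
  ... | inj₁ _       = ≈ℝ-refl
  ... | inj₂ (b , e′) = contradiction e (const⇒¬symbolic v {⌊ b ⌋ᵘ} e′)

  A-unique : ∀ P → IsSensitivityPoly α T P → A ≈ᴾ P
  A-unique P (coeff-P , evaluate-P) μ = x-y≈0⇒x≈y
    (≈ℝ-trans (≈ℝ-sym (coeff-minus A P μ)) (coeff≈0 corner corner-admissible corner-symbolic difference-coeff μ))
    where
    difference-vanishes : ∀ p → Admissible p → ⟪ A -ᴾ P , unitValue p ⟫ ≈ℝ 0ℝ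
    difference-vanishes p adm = begin
      ⟪ A -ᴾ P , unitValue p ⟫                    ≈⟨ ⟪⟫-minus (unitValue p) A P ⟩
      ⟪ A , unitValue p ⟫ -ℝ ⟪ P , unitValue p ⟫  ≈⟨ +ℝ-cong (evaluate-A p adm) (-ℝ-cong (evaluate-P p adm)) ⟩
      probability (⌊_⌋ᵘ ∘ p) T -ℝ probability (⌊_⌋ᵘ ∘ p) T ≈⟨ -ℝ-inverseʳ _ ⟩
      0ℝ                                          ∎
    open Separation Symbolic symbolic? Admissible
      (λ {v} {p} → halveAt-admissible {v} {p}) (A -ᴾ P) difference-vanishes
    difference-coeff : ∀ v μ → ¬ Symbolic v → lookup μ v ≢ 0 → coeff (A -ᴾ P) μ ≈ℝ 0ℝ
    difference-coeff v μ v-const μv≢0 = ≈ℝ-trans (coeff-minus A P μ)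
      (≈ℝ-trans (+ℝ-cong (coeff-A v μ v-const μv≢0) (-ℝ-cong (coeff-P v μ v-const μv≢0))) (-ℝ-inverseʳ 0ℝ))

------------------------------------------------------------------------
-- Gradients

-- All variables are treated as symbolic parameters.

module Gradient (T : Formula n) where

  α₀ : Literal n → Poly n
  α₀ (pos v) = varᴾ v
  α₀ (neg v) = constᴾ 1ℝ -ᴾ varᴾ v

  open Sensitivity T α₀ (λ v → inj₁ λ _ → ≈ℝ-refl) (λ v _ → ≈ℝ-refl)

  probabilityPoly : Poly n
  probabilityPoly = A

  probabilityPoly-correct : IsProbabilityPoly T probabilityPoly
  probabilityPoly-correct p = evaluate-A p λ v a e → contradiction e (varᴾ≉constᴾ v {⌊ a ⌋ᵘ})

  probabilityPoly-unique : ∀ P → IsProbabilityPoly T P → A ≈ᴾ P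
  probabilityPoly-unique P P-prob = A-unique P
    ((λ v μ v-const _ → contradiction (λ _ → ≈ℝ-refl) v-const) , λ p _ → P-prob p)

  module _ (k : Fin n) (p : Fin n → UnitInterval) (α : Literal n → ℝ≥0 × ℝ)
    (αₖ≈ : α (pos k) ≈ᴳ (toℝ≥0 (p k) , 1ℝ))
    (α¬ₖ≈ : α (neg k) ≈ᴳ (toℝ≥0 (1-ᵘ p k) , -ℝ 1ℝ))
    (αᵢ≈ : ∀ i → i ≢ k → α (pos i) ≈ᴳ (toℝ≥0 (p i) , 0ℝ)
                       × α (neg i) ≈ᴳ (toℝ≥0 (1-ᵘ p i) , 0ℝ)) where
    private
      x : Fin n → ℝ
      x = ⌊_⌋ᵘ ∘ p
    open Derivative x k
    open Evaluation x using (evaluate-var; evaluate-1-var)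
    open IsCommutativeSemiring Dual-isCommutativeSemiring using () renaming (sym to ≈ᴰ-sym; trans to ≈ᴰ-trans)

    ∂-1-var : ∀ {v r} → ⟪ varᴾ v , dvalue ⟫ ≈ℝ r → ⟪ constᴾ 1ℝ -ᴾ varᴾ v , dvalue ⟫ ≈ℝ -ℝ r
    ∂-1-var {v} e = ≈ℝ-trans (⟪⟫-minus dvalue (constᴾ 1ℝ) (varᴾ v))
      (≈ℝ-trans (+ℝ-cong (∂-const 1ℝ) (-ℝ-cong e)) (+ℝ-identityˡ _))

    labels-agree : ∀ l → RawSemiring._≈_ Dual-rawSemiring ⌊ α l ⌋ᴳ (dual (α₀ l))
    labels-agree (pos v) with v Fin.≟ k
    ... | yes refl = ≈ℝ-trans (proj₁ αₖ≈) (≈ℝ-sym (evaluate-var k)) , ≈ℝ-trans (proj₂ αₖ≈) (≈ℝ-sym ∂-same)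
    ... | no v≢k   = ≈ℝ-trans (proj₁ (proj₁ (αᵢ≈ v v≢k))) (≈ℝ-sym (evaluate-var v)) ,
                     ≈ℝ-trans (proj₂ (proj₁ (αᵢ≈ v v≢k))) (≈ℝ-sym (∂-other v≢k))
    labels-agree (neg v) with v Fin.≟ k
    ... | yes refl = ≈ℝ-trans (proj₁ α¬ₖ≈) (≈ℝ-sym (evaluate-1-var k)) ,
                     ≈ℝ-trans (proj₂ α¬ₖ≈) (≈ℝ-sym (∂-1-var ∂-same))
    ... | no v≢k   = ≈ℝ-trans (proj₁ (proj₂ (αᵢ≈ v v≢k))) (≈ℝ-sym (evaluate-1-var v)) ,
                     ≈ℝ-trans (proj₂ (proj₂ (αᵢ≈ v v≢k)))
                       (≈ℝ-sym (≈ℝ-trans (∂-1-var (∂-other v≢k)) (pointwise λ _ → refl)))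

    -- Both sides count models with dual numbers as labels.

    AMC≈dual : RawSemiring._≈_ Dual-rawSemiring ⌊ AMC GRAD-rawSemiring α T ⌋ᴳ (dual A)
    AMC≈dual = ≈ᴰ-trans
      (AMC-homo GRAD-rawSemiring Dual-rawSemiring Dual-isCommutativeSemiring ⌊⌋ᴳ-isSemiringHomomorphism
        {α} {dual ∘ α₀} labels-agree T)
      (≈ᴰ-sym (AMC-homo (SENS-rawSemiring n) Dual-rawSemiring Dual-isCommutativeSemiring
        dual-isSemiringHomomorphism {α₀} (λ _ → ≈ℝ-refl , ≈ℝ-refl) T))

    GRAD-correct : ∀ P → IsProbabilityPoly T P →
      IsGradient P k x (AMC GRAD-rawSemiring α T)
    GRAD-correct P P-prob =
      ≈ℝ-trans (proj₁ AMC≈dual) (⟪⟫-resp-≈ᴾ {P = A} {P} A≈P (monomialValue x)) ,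
      ≈ℝ-trans (proj₂ AMC≈dual) (≈ℝ-trans (⟪⟫-resp-≈ᴾ {P = A} {P} A≈P dvalue) (≈ℝ-sym (evaluate-∂ P)))
      where
      A≈P : A ≈ᴾ P
      A≈P = probabilityPoly-unique P P-prob

------------------------------------------------------------------------
-- The twelve tasks

theorem1 : ∀ {n : ℕ} (T : Formula n) →
  -- SAT
  (IsCommutativeSemiringOn SAT-rawSemiring ×
   (∀ α → (∀ v → α (pos v) ≡ true × α (neg v) ≡ true) →
    (AMC SAT-rawSemiring α T ≡ true ⇔ Model T)))
  ×
  -- #SAT
  (IsCommutativeSemiringOn #SAT-rawSemiring ×
   (∀ α → (∀ v → α (pos v) ≡ 1 × α (neg v) ≡ 1) →
    (Fin (AMC #SAT-rawSemiring α T) ↔ Model T)))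
  ×
  -- WMC
  (IsCommutativeSemiringOn WMC-rawSemiring ×
   (∀ α → ⌊ AMC WMC-rawSemiring α T ⌋ ≈ℝ weightedCount (⌊_⌋ ∘ α) T))
  ×
  -- PROB
  (IsCommutativeSemiringOn WMC-rawSemiring ×
   (∀ (p : Fin n → UnitInterval) α →
    (∀ v → α (pos v) ≈ℝ≥0 toℝ≥0 (p v) × α (neg v) ≈ℝ≥0 toℝ≥0 (1-ᵘ p v)) →
    ⌊ AMC WMC-rawSemiring α T ⌋ ≈ℝ probability (⌊_⌋ᵘ ∘ p) T))
  ×
  -- SENS
  (IsCommutativeSemiringOn (SENS-rawSemiring n) ×
   (∀ α →
    (∀ v → α (pos v) ≈ᴾ varᴾ v ⊎ ∃ λ (a : UnitInterval) → α (pos v) ≈ᴾ constᴾ ⌊ a ⌋ᵘ) →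
    (∀ v → α (neg v) ≈ᴾ constᴾ 1ℝ -ᴾ α (pos v)) →
    IsSensitivityPoly α T (AMC (SENS-rawSemiring n) α T) ×
    (∀ P → IsSensitivityPoly α T P → AMC (SENS-rawSemiring n) α T ≈ᴾ P)))
  ×
  -- GRAD
  (IsCommutativeSemiringOn GRAD-rawSemiring ×
   (∀ (k : Fin n) (p : Fin n → UnitInterval) α →
    α (pos k) ≈ᴳ (toℝ≥0 (p k) , 1ℝ) →
    α (neg k) ≈ᴳ (toℝ≥0 (1-ᵘ p k) , -ℝ_ 1ℝ) →
    (∀ i → i ≢ k → α (pos i) ≈ᴳ (toℝ≥0 (p i) , 0ℝ)
                 × α (neg i) ≈ᴳ (toℝ≥0 (1-ᵘ p i) , 0ℝ)) →
    (∃ λ P → IsProbabilityPoly T P) ×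
    (∀ P → IsProbabilityPoly T P →
     IsGradient P k (⌊_⌋ᵘ ∘ p) (AMC GRAD-rawSemiring α T))))
  ×
  -- MPE
  (IsCommutativeSemiringOn MPE-rawSemiring ×
   (∀ (p : Fin n → UnitInterval) α →
    (∀ v → α (pos v) ≈ℝ≥0 toℝ≥0 (p v) × α (neg v) ≈ℝ≥0 toℝ≥0 (1-ᵘ p v)) →
    IsMPE (⌊_⌋ᵘ ∘ p) T ⌊ AMC MPE-rawSemiring α T ⌋))
  ×
  -- S-PATH
  (IsCommutativeSemiringOn S-PATH-rawSemiring ×
   (∀ (G : Digraph n) → let open Digraph G in
    ∀ (s t : Node) → s ≢ t →
    T ≡ pathTheory s t →
    ∀ α → (∀ v → (∃ λ a → α (pos v) ≡ [ a ]) × α (neg v) ≡ [ 0 ]) →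
    IsShortestPathLength (α ∘ pos) s t (AMC S-PATH-rawSemiring α T)))
  ×
  -- W-PATH
  (IsCommutativeSemiringOn W-PATH-rawSemiring ×
   (∀ (G : Digraph n) → let open Digraph G in
    ∀ (s t : Node) → s ≢ t →
    T ≡ pathTheory s t →
    ∀ α → (∀ v → (∃ λ a → α (pos v) ≡ [ a ]) × α (neg v) ≡ ⊤⁺) →
    IsWidestPathWidth (α ∘ pos) s t (AMC W-PATH-rawSemiring α T)))
  ×
  -- FUZZY
  (IsCommutativeSemiringOn FUZZY-rawSemiring ×
   (∀ α → (∀ v → α (neg v) ≈ᵘ 1ᵘ) →
    IsFuzzyValue (α ∘ pos) T (AMC FUZZY-rawSemiring α T)))
  ×
  -- kWEIGHT
  (∀ (k : ℕ) → IsCommutativeSemiringOn (kWEIGHT-rawSemiring k) ×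
   (∀ α → IsTruncatedMinCost k α T (AMC (kWEIGHT-rawSemiring k) α T)))
  ×
  -- OBDD
  (∀ (_<_ : Rel (Fin n) 0ℓ) (isOrder : IsStrictTotalOrder _≡_ _<_) →
   let open Diagrams isOrder in
   IsCommutativeSemiringOn OBDD-rawSemiring ×
   (∀ α → (∀ v → α (pos v) ≈ᴼ obdd (var v) × α (neg v) ≈ᴼ ¬ᴼ obdd (var v)) →
    AMC OBDD-rawSemiring α T ≈ᴼ obdd T ×
    IsDiagramOf T (AMC OBDD-rawSemiring α T)))
theorem1 {n} T =
  (SAT-isCommutativeSemiring , SAT-correct T) ,
  (ℕ.+-*-isCommutativeSemiring , #SAT-correct T) ,
  (WMC-isCommutativeSemiring , WMC-correct T) ,
  (WMC-isCommutativeSemiring , λ p α α≈p → PROB-correct p α α≈p T) ,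
  (SENS-isCommutativeSemiring , λ α kind α¬≈ →
    let open Sensitivity T α kind α¬≈ in A-isSensitivityPoly , A-unique) ,
  (GRAD-isCommutativeSemiring , λ k p α αₖ≈ α¬ₖ≈ αᵢ≈ →
    let open Gradient T in
    (probabilityPoly , probabilityPoly-correct) , GRAD-correct k p α αₖ≈ α¬ₖ≈ αᵢ≈) ,
  (MPE-isCommutativeSemiring , λ p α α≈p → MPE-correct p α α≈p T) ,
  (S-PATH-isCommutativeSemiring , λ G s t s≢t T≡ α α-labels →
    subst (λ T → Digraph.IsShortestPathLength G (α ∘ pos) s t (AMC S-PATH-rawSemiring α T)) (sym T≡)
      (S-PATH-correct G (proj₂ ∘ α-labels))) ,
  (W-PATH-isCommutativeSemiring , λ G s t s≢t T≡ α α-labels →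
    subst (λ T → Digraph.IsWidestPathWidth G (α ∘ pos) s t (AMC W-PATH-rawSemiring α T)) (sym T≡)
      (W-PATH-correct G s≢t (proj₂ ∘ α-labels))) ,
  (FUZZY-isCommutativeSemiring , λ α α¬≈1 → FUZZY-correct α α¬≈1 T) ,
  (λ k → KWeight.kWEIGHT-isCommutativeSemiring k , λ α → KWeight.kWEIGHT-correct k α T) ,
  (λ _<_ isOrder → OBDD-isCommutativeSemiring isOrder , OBDD-correct isOrder T)
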